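{- There is no positive integer $n$ with $p^2(n,5)=188$; that is, no positive integer can be expressed as the sum of exactly $5$ positive squares in exactly $188$ ways.
   Context: $p^2(n,j)$ denotes the number of ways to write $n$ as a sum of exactly $j$ positive squares, up to order of summands (the number of partitions of $n$ into exactly $j$ parts that are positive squares). -}

module Defs where

open import Data.Nat using (ℕ; zero; suc; _+_; _*_; _≟_)
open import Data.List using (List; []; _∷_; map; concatMap; filter; length; upTo)
open import Data.Nat.ListAction using (sum)

-- NonIncr j m : all non-increasing lists (a₁ ≥ a₂ ≥ … ≥ a_j) of length j
-- whose entries lie in {1, …, m}.  Each multiset of j positive integers
-- bounded by m is represented exactly once (sorted in non-increasing order).
NonIncr : ℕ → ℕ → List (List ℕ)
NonIncr zero    m = [] ∷ []
NonIncr (suc j) m =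
  concatMap (λ i → map (suc i ∷_) (NonIncr j (suc i))) (upTo m)

sqsum : List ℕ → ℕ
sqsum xs = sum (map (λ a → a * a) xs)

-- p²(n, j): number of partitions of n into exactly j parts that are positive
-- squares, i.e. number of multisets {a₁,…,a_j} of positive integers with
-- a₁² + … + a_j² = n.  Every part a satisfies a ≤ a² ≤ n, so bounding parts
-- by n loses nothing.
p² : ℕ → ℕ → ℕ
p² n j = length (filter (λ xs → sqsum xs ≟ n) (NonIncr j n))

{-# OPTIONS --safe #-}
module Submission where

-- Many representations.  For odd k there are exactly σ(k) ordered quadruples of positive odd
-- squares with sum 4k (Jacobi), so subtracting a suitable square a² from n, for every a in a
-- residue class chosen from n modulo 32, leaves a number with at least a constant times n − a²
-- representations by four positive squares.  Only for n ≡ 2 (mod 4) may zeros occur among the four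
-- squares, and altogether they cost no more than σ(n/2).  This gives p²(n, 5) ≥ 189 for n ≥ 2¹⁶.
--
-- Jacobi's count.  Both sides satisfy Σ (N − 5x²) F(N − x²) = 0, the sum being over odd x with
-- N ≡ 5 (mod 8): for sums of squares by the symmetry of x² + y² + z² + t² + u² = N, and for σ
-- because Σ d(de − x²) over the solutions of x² + 4de = N vanishes by an exchange of variables.
--
-- Few representations.  For n < 2¹⁶ the numbers p²(n, 5) are read off as the digits of a
-- generating function evaluated at a large base.

open import Defs
open import Algebra.Structures using (IsCommutativeSemiring)
open import Data.Bool using (Bool; true; false; T; not; _∧_)
open import Data.Empty using (⊥)
open import Data.Integer as ℤ using (ℤ; +_; -[1+_]; 0ℤ; ∣_∣)
import Data.Integer.Properties as ℤₚ
import Data.Integer.Tactic.RingSolver as ℤ-Solver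
open import Data.List using (List; []; _∷_; _++_; map; concatMap; filter; length; applyUpTo)
open import Data.List.Properties using (filter-accept; filter-reject)
open import Data.Nat
open import Data.Nat.Divisibility using (m∣m*n; divides-refl)
open import Data.Nat.DivMod
open import Data.Nat.Properties
import Data.Nat.Tactic.RingSolver as ℕ-Solver
open import Data.Product using (∃; _×_; _,_; proj₁; proj₂)
open import Data.Sum using (inj₁; inj₂)
open import Function using (_∘_)
open import Relation.Binary.Definitions using (tri<; tri≈; tri>)
open import Relation.Binary.PropositionalEquality
open import Relation.Nullary using (¬_; yes; no; contradiction)

-- Three classes of totals have a linear lower bound for four positive squares: 4 (mod 8), where σ
-- counts the odd quadruples; 16 (mod 32), by doubling those; and 7 (mod 8), where one entry is even
-- and non-zero, three are odd, and σ counts these up to a factor 8. Subtracting a suitable square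
-- leads every n into one of these classes unless n ≡ 2 (mod 4): squares are 0, 1 or 4 (mod 8), so
-- such an n only reaches 1, 2, 5 and 6 (mod 8). That class therefore needs its own argument. Only
-- σ(k) ≥ k is used below, which already yields totals of order n^(3/2). The upper bound for σ(n/2)
-- in the exceptional class has the same order, and it is its smaller constant that decides. The 5
-- in N - 5x² is the number of squares. On x² + 4de = N it gives N - 5x² = 4(de - x²), and N ≡ 5
-- (mod 8) excludes the solutions with x = 0 and x = e - d, which would have no image under the
-- exchange of variables. For small n a single natural number carries all the counts, so that the
-- table costs a few multiplications per size of part instead of an enumeration of lists.

-- Finite sums

module Summation {A : Set} {_⊕_ _⊛_ : A → A → A} {𝟘 𝟙 : A}
  (isCommutativeSemiring : IsCommutativeSemiring _≡_ _⊕_ _⊛_ 𝟘 𝟙) where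

  open IsCommutativeSemiring isCommutativeSemiring
    using (zeroʳ; distribˡ)
    renaming (+-identityʳ to ⊕-identityʳ; +-identityˡ to ⊕-identityˡ; +-assoc to ⊕-assoc; +-comm to ⊕-comm)
  open ≡-Reasoning

  ∑ : ℕ → (ℕ → A) → A
  ∑ zero    f = 𝟘
  ∑ (suc n) f = ∑ n f ⊕ f n

  private variable
    f g : ℕ → A

  ∑-cong-< : ∀ n → (∀ k → k < n → f k ≡ g k) → ∑ n f ≡ ∑ n g
  ∑-cong-< zero    eq = refl
  ∑-cong-< (suc n) eq = cong₂ _⊕_ (∑-cong-< n λ k k<n → eq k (m<n⇒m<1+n k<n)) (eq n ≤-refl)

  ∑-cong : ∀ n → (∀ k → f k ≡ g k) → ∑ n f ≡ ∑ n g
  ∑-cong n eq = ∑-cong-< n λ k _ → eq k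

  ∑-zero : ∀ n → (∀ k → k < n → f k ≡ 𝟘) → ∑ n f ≡ 𝟘
  ∑-zero zero    eq = refl
  ∑-zero (suc n) eq = trans
    (cong₂ _⊕_ (∑-zero n λ k k<n → eq k (m<n⇒m<1+n k<n)) (eq n ≤-refl)) (⊕-identityʳ 𝟘)

  ∑-⊛ : ∀ n c → ∑ n (λ k → c ⊛ f k) ≡ c ⊛ ∑ n f
  ∑-⊛         zero    c = sym (zeroʳ c)
  ∑-⊛ {f = f} (suc n) c = trans (cong (_⊕ (c ⊛ f n)) (∑-⊛ n c)) (sym (distribˡ c _ _))

  interchange : ∀ a b c d → (a ⊕ b) ⊕ (c ⊕ d) ≡ (a ⊕ c) ⊕ (b ⊕ d)
  interchange a b c d = begin
    (a ⊕ b) ⊕ (c ⊕ d)   ≡⟨ ⊕-assoc a b _ ⟩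
    a ⊕ (b ⊕ (c ⊕ d))   ≡⟨ cong (a ⊕_) (⊕-assoc b c d) ⟨
    a ⊕ ((b ⊕ c) ⊕ d)   ≡⟨ cong (λ # → a ⊕ (# ⊕ d)) (⊕-comm b c) ⟩
    a ⊕ ((c ⊕ b) ⊕ d)   ≡⟨ cong (a ⊕_) (⊕-assoc c b d) ⟩
    a ⊕ (c ⊕ (b ⊕ d))   ≡⟨ ⊕-assoc a c _ ⟨
    (a ⊕ c) ⊕ (b ⊕ d)   ∎

  ∑-⊕ : ∀ n (f g : ℕ → A) → ∑ n (λ k → f k ⊕ g k) ≡ ∑ n f ⊕ ∑ n g
  ∑-⊕ zero    f g = sym (⊕-identityʳ 𝟘)
  ∑-⊕ (suc n) f g = trans (cong (_⊕ (f n ⊕ g n)) (∑-⊕ n f g)) (interchange _ _ _ _)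

  ∑-swap : ∀ m n (f : ℕ → ℕ → A) → ∑ m (λ i → ∑ n (f i)) ≡ ∑ n (λ j → ∑ m (λ i → f i j))
  ∑-swap zero    n f = sym (∑-zero n λ _ _ → refl)
  ∑-swap (suc m) n f = begin
    ∑ m (λ i → ∑ n (f i)) ⊕ ∑ n (f m)               ≡⟨ cong (_⊕ ∑ n (f m)) (∑-swap m n f) ⟩
    ∑ n (λ j → ∑ m (λ i → f i j)) ⊕ ∑ n (f m)       ≡⟨ ∑-⊕ n _ _ ⟨
    ∑ n (λ j → ∑ m (λ i → f i j) ⊕ f m j)           ∎

  ∑-split : ∀ m n (f : ℕ → A) → ∑ (m + n) f ≡ ∑ m f ⊕ ∑ n (λ k → f (m + k))
  ∑-split m zero    f = trans (cong (λ # → ∑ # f) (+-identityʳ m)) (sym (⊕-identityʳ _))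
  ∑-split m (suc n) f = begin
    ∑ (m + suc n) f                                   ≡⟨ cong (λ # → ∑ # f) (+-suc m n) ⟩
    ∑ (m + n) f ⊕ f (m + n)                           ≡⟨ cong (_⊕ f (m + n)) (∑-split m n f) ⟩
    (∑ m f ⊕ ∑ n (λ k → f (m + k))) ⊕ f (m + n)       ≡⟨ ⊕-assoc _ _ _ ⟩
    ∑ m f ⊕ ∑ (suc n) (λ k → f (m + k))               ∎

  ∑-head : ∀ n (f : ℕ → A) → ∑ (suc n) f ≡ f 0 ⊕ ∑ n (f ∘ suc)
  ∑-head n f = trans (∑-split 1 n f) (cong (_⊕ ∑ n (f ∘ suc)) (⊕-identityˡ (f 0)))

  ∑-extend : ∀ {m n} → m ≤ n → (∀ k → m ≤ k → f k ≡ 𝟘) → ∑ n f ≡ ∑ m f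
  ∑-extend {f = f} {m} {n} m≤n eq = begin
    ∑ n f                                    ≡⟨ cong (λ # → ∑ # f) (m+[n∸m]≡n m≤n) ⟨
    ∑ (m + (n ∸ m)) f                        ≡⟨ ∑-split m (n ∸ m) f ⟩
    ∑ m f ⊕ ∑ (n ∸ m) (λ k → f (m + k))      ≡⟨ cong (∑ m f ⊕_) (∑-zero (n ∸ m) λ k _ → eq (m + k) (m≤m+n m k)) ⟩
    ∑ m f ⊕ 𝟘                                ≡⟨ ⊕-identityʳ _ ⟩
    ∑ m f                                    ∎

module ℕΣ = Summation +-*-isCommutativeSemiring
module ℤΣ = Summation ℤₚ.+-*-isCommutativeSemiring

pos-∑ : ∀ n (f : ℕ → ℕ) → + ℕΣ.∑ n f ≡ ℤΣ.∑ n (λ k → + f k)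
pos-∑ zero    f = refl
pos-∑ (suc n) f = cong (ℤ._+ + f n) (pos-∑ n f)

n≤n*n : ∀ n → n ≤ n * n
n≤n*n zero    = z≤n
n≤n*n (suc n) = m≤m*n (suc n) (suc n)

-- Squares modulo 8

square≢5+8m : ∀ n m → n * n ≢ 5 + m * 8
square≢5+8m n m eq = go (n % 8) (m%n<n n 8)
  (trans (sym (%-distribˡ-* n n 8)) (trans (cong (_% 8) eq) ([m+kn]%n≡m%n 5 m 8)))
  where
  go : ∀ r → r < 8 → (r * r) % 8 ≢ 5
  go 0 _ ()
  go 1 _ ()
  go 2 _ ()
  go 3 _ ()
  go 4 _ ()
  go 5 _ ()
  go 6 _ ()
  go 7 _ ()
  go (suc (suc (suc (suc (suc (suc (suc (suc r)))))))) r<8 = contradiction r<8 (≤⇒≯ (m≤m+n 8 r))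

4*≢5+8m : ∀ a m → 4 * a ≢ 5 + m * 8
4*≢5+8m a m eq = 0≢1+n (trans (sym (m*n%n≡0 a 4)) (trans (cong (_% 4) a*4≡) ([m+kn]%n≡m%n 5 (m * 2) 4)))
  where
  a*4≡ : a * 4 ≡ 5 + m * 2 * 4
  a*4≡ = trans (*-comm a 4) (trans eq (cong (_+_ 5) (sym (*-assoc m 2 4))))

-- Recentring a finitely supported sum over ℤ

module _ (L : ℕ) where
  open ℤΣ
  open ≡-Reasoning

  -- The centre itself is left out, so that the offsets `suc r` are positive and can later be the
  -- third member of a superbase.
  symmetricSum : (ℤ → ℤ) → ℤ → ℤ
  symmetricSum h c = ∑ L (λ r → h (c ℤ.+ + suc r) ℤ.+ h (c ℤ.- + suc r))

  private
    centred : (ℤ → ℤ) → ℤ → ℤ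
    centred h c = h c ℤ.+ symmetricSum h c

    up down : (ℤ → ℤ) → ℤ → ℤ
    up   h c = ∑ L (λ r → h (c ℤ.+ + suc r))
    down h c = ∑ L (λ r → h (c ℤ.- + suc r))

    shift-up : ∀ h c → up h c ℤ.+ h (c ℤ.+ + suc L) ≡ h (c ℤ.+ + 1) ℤ.+ up h (c ℤ.+ + 1)
    shift-up h c = trans (∑-head L (λ r → h (c ℤ.+ + suc r)))
      (cong (λ # → h (c ℤ.+ + 1) ℤ.+ #) (∑-cong L λ r → cong h (sym (ℤₚ.+-assoc c (+ 1) (+ suc r)))))

    shift-down : ∀ h c → down h (c ℤ.+ + 1) ℤ.+ h (c ℤ.- + L) ≡ h c ℤ.+ down h c
    shift-down h c = begin
      down h (c ℤ.+ + 1) ℤ.+ h (c ℤ.- + L)   ≡⟨ cong (ℤ._+ h (c ℤ.- + L)) (∑-cong L λ r → cong h (cancel c (+ r))) ⟩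
      ∑ (suc L) (λ r → h (c ℤ.- + r))        ≡⟨ ∑-head L (λ r → h (c ℤ.- + r)) ⟩
      h (c ℤ.- + 0) ℤ.+ down h c             ≡⟨ cong (λ # → h # ℤ.+ down h c) (ℤₚ.+-identityʳ c) ⟩
      h c ℤ.+ down h c                       ∎
      where
      cancel : ∀ c r → (c ℤ.+ + 1) ℤ.- (+ 1 ℤ.+ r) ≡ c ℤ.- r
      cancel = ℤ-Solver.solve-∀

    -- Moving the window of 2L + 1 integers one step to the right loses c - L and gains c + L + 1,
    -- and h vanishes at both.
    centred-step : ∀ h c → h (c ℤ.- + L) ≡ 0ℤ → h (c ℤ.+ + suc L) ≡ 0ℤ →
                   centred h (c ℤ.+ + 1) ≡ centred h c
    centred-step h c low high = begin
      h c′ ℤ.+ symmetricSum h c′                 ≡⟨ cong (λ # → h c′ ℤ.+ #) (∑-⊕ L _ _) ⟩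
      h c′ ℤ.+ (up h c′ ℤ.+ down h c′)           ≡⟨ ℤₚ.+-assoc (h c′) _ _ ⟨
      h c′ ℤ.+ up h c′ ℤ.+ down h c′             ≡⟨ cong₂ ℤ._+_ (shift-up h c) (ℤₚ.+-identityʳ _) ⟨
      up h c ℤ.+ h (c ℤ.+ + suc L) ℤ.+ (down h c′ ℤ.+ 0ℤ)
        ≡⟨ cong₂ (λ u v → up h c ℤ.+ u ℤ.+ (down h c′ ℤ.+ v)) high (sym low) ⟩
      up h c ℤ.+ 0ℤ ℤ.+ (down h c′ ℤ.+ h (c ℤ.- + L))
        ≡⟨ cong₂ ℤ._+_ (ℤₚ.+-identityʳ (up h c)) (shift-down h c) ⟩
      up h c ℤ.+ (h c ℤ.+ down h c)              ≡⟨ rotate (up h c) (h c) (down h c) ⟩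
      h c ℤ.+ (up h c ℤ.+ down h c)              ≡⟨ cong (λ # → h c ℤ.+ #) (∑-⊕ L _ _) ⟨
      h c ℤ.+ symmetricSum h c                   ∎
      where
      c′ = c ℤ.+ + 1
      rotate : ∀ a b c → a ℤ.+ (b ℤ.+ c) ≡ b ℤ.+ (a ℤ.+ c)
      rotate = ℤ-Solver.solve-∀

    -- The target centre j + k stays fixed while j descends. The point gained at each step lies
    -- beyond L, and the point lost lies L + 1 + k to the left of the target, so each is outside one
    -- of the two windows known to contain the support.
    centred-pos : ∀ h → (∀ z → L < ∣ z ∣ → h z ≡ 0ℤ) →
                  ∀ j k → (∀ z → L < ∣ z ℤ.- + (j + k) ∣ → h z ≡ 0ℤ) →
                  centred h (+ j) ≡ centred h 0ℤ
    centred-pos h supp zero    k suppᶜ = refl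
    centred-pos h supp (suc j) k suppᶜ = begin
      centred h (+ suc j)       ≡⟨ cong (λ # → centred h (+ #)) (+-comm 1 j) ⟩
      centred h (+ j ℤ.+ + 1)   ≡⟨ centred-step h (+ j) (suppᶜ _ low) (supp _ (m≤n+m (suc L) j)) ⟩
      centred h (+ j)
        ≡⟨ centred-pos h supp j (suc k) (λ z → suppᶜ z ∘ subst (λ # → L < ∣ z ℤ.- + # ∣) (+-suc j k)) ⟩
      centred h 0ℤ              ∎
      where
      gap : ∀ j k L → j ℤ.- L ℤ.- (+ 1 ℤ.+ (j ℤ.+ k)) ≡ ℤ.- (+ 1 ℤ.+ (L ℤ.+ k))
      gap = ℤ-Solver.solve-∀
      low : L < ∣ + j ℤ.- + L ℤ.- + (suc j + k) ∣
      low = subst (λ # → L < ∣ # ∣) (sym (gap (+ j) (+ k) (+ L))) (s≤s (m≤m+n L k))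

    centred-invariant : ∀ h c → (∀ z → L < ∣ z ∣ → h z ≡ 0ℤ) →
                        (∀ z → L < ∣ z ℤ.- c ∣ → h z ≡ 0ℤ) → centred h c ≡ centred h 0ℤ
    centred-invariant h (+ n) supp suppᶜ =
      centred-pos h supp n 0 λ z → suppᶜ z ∘ subst (λ # → L < ∣ z ℤ.- + # ∣) (+-identityʳ n)
    -- A negative centre is reduced to a positive one by the reflection z ↦ -z.
    centred-invariant h -[1+ n ] supp suppᶜ = begin
      centred h -[1+ n ]     ≡⟨ cong (λ # → h -[1+ n ] ℤ.+ #) (∑-cong L λ r → reflect (+ suc n) (+ suc r)) ⟩
      centred h′ (+ suc n)   ≡⟨ centred-pos h′ supp′ (suc n) 0 suppᶜ′ ⟩
      centred h′ 0ℤ          ≡⟨ cong (λ # → h 0ℤ ℤ.+ #) (∑-cong L λ r → reflect 0ℤ (+ suc r)) ⟨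
      centred h 0ℤ           ∎
      where
      h′ : ℤ → ℤ
      h′ z = h (ℤ.- z)
      neg-+ : ∀ c r → ℤ.- c ℤ.+ r ≡ ℤ.- (c ℤ.- r)
      neg-+ = ℤ-Solver.solve-∀
      neg-- : ∀ c r → ℤ.- c ℤ.- r ≡ ℤ.- (c ℤ.+ r)
      neg-- = ℤ-Solver.solve-∀
      reflect : ∀ c r → h (ℤ.- c ℤ.+ r) ℤ.+ h (ℤ.- c ℤ.- r) ≡ h′ (c ℤ.+ r) ℤ.+ h′ (c ℤ.- r)
      reflect c r = trans (cong₂ (λ u v → h u ℤ.+ h v) (neg-+ c r) (neg-- c r)) (ℤₚ.+-comm _ (h′ (c ℤ.+ r)))
      supp′ : ∀ z → L < ∣ z ∣ → h′ z ≡ 0ℤ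
      supp′ z = supp (ℤ.- z) ∘ subst (L <_) (sym (ℤₚ.∣-i∣≡∣i∣ z))
      neg-diff : ∀ z c → ℤ.- z ℤ.- (ℤ.- c) ≡ ℤ.- (z ℤ.- c)
      neg-diff = ℤ-Solver.solve-∀
      suppᶜ′ : ∀ z → L < ∣ z ℤ.- + (suc n + 0) ∣ → h′ z ≡ 0ℤ
      suppᶜ′ z L< = suppᶜ (ℤ.- z) (subst (L <_) eq L<)
        where
        eq : ∣ z ℤ.- + (suc n + 0) ∣ ≡ ∣ ℤ.- z ℤ.- -[1+ n ] ∣
        eq = trans (cong (λ # → ∣ z ℤ.- + suc # ∣) (+-identityʳ n))
          (trans (sym (ℤₚ.∣-i∣≡∣i∣ (z ℤ.- + suc n))) (cong ∣_∣ (sym (neg-diff z (+ suc n)))))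

  recentre : ∀ h c → h 0ℤ ≡ 0ℤ → h c ≡ 0ℤ → (∀ z → L < ∣ z ∣ → h z ≡ 0ℤ) →
             (∀ z → L < ∣ z ℤ.- c ∣ → h z ≡ 0ℤ) → symmetricSum h 0ℤ ≡ symmetricSum h c
  recentre h c h0 hc supp suppᶜ = begin
    symmetricSum h 0ℤ   ≡⟨ drop 0ℤ h0 ⟨
    centred h 0ℤ        ≡⟨ centred-invariant h c supp suppᶜ ⟨
    centred h c         ≡⟨ drop c hc ⟩
    symmetricSum h c    ∎
    where
    drop : ∀ c → h c ≡ 0ℤ → centred h c ≡ symmetricSum h c
    drop c hc = trans (cong (ℤ._+ symmetricSum h c) hc) (ℤₚ.+-identityˡ _)

-- Indicators of an equation

δ : ℤ → ℤ
δ (+ zero)  = + 1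
δ (+ suc _) = 0ℤ
δ -[1+ _ ]  = 0ℤ

-- Beside `δ z` a coefficient may be rewritten by means of the equation z = 0; this is how N is
-- replaced by x² + 4de.
δ-cong : ∀ a b z → (z ≡ 0ℤ → a ≡ b) → a ℤ.* δ z ≡ b ℤ.* δ z
δ-cong a b (+ zero)  eq = cong (ℤ._* + 1) (eq refl)
δ-cong a b (+ suc _) eq = trans (ℤₚ.*-zeroʳ a) (sym (ℤₚ.*-zeroʳ b))
δ-cong a b -[1+ _ ]  eq = trans (ℤₚ.*-zeroʳ a) (sym (ℤₚ.*-zeroʳ b))

*-δ-zero : ∀ a z → z ≢ 0ℤ → a ℤ.* δ z ≡ 0ℤ
*-δ-zero a z z≢0 = trans (δ-cong a 0ℤ z (λ z≡0 → contradiction z≡0 z≢0)) (ℤₚ.*-zeroˡ (δ z))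

square-abs : ∀ x → x ℤ.* x ≡ + (∣ x ∣ * ∣ x ∣)
square-abs (+ n)    = sym (ℤₚ.pos-* n n)
square-abs -[1+ n ] = refl

opaque
  [_≈_] : ℕ → ℕ → ℕ
  [ m ≈ n ] with m ≟ n
  ... | yes _ = 1
  ... | no  _ = 0

  ≈-yes : ∀ {m n} → m ≡ n → [ m ≈ n ] ≡ 1
  ≈-yes {m} {n} eq with m ≟ n
  ... | yes _  = refl
  ... | no neq = contradiction eq neq

  ≈-no : ∀ {m n} → m ≢ n → [ m ≈ n ] ≡ 0
  ≈-no {m} {n} neq with m ≟ n
  ... | yes eq = contradiction eq neq
  ... | no  _  = refl

≈-cong : ∀ {m n m′ n′} → (m ≡ n → m′ ≡ n′) → (m′ ≡ n′ → m ≡ n) → [ m ≈ n ] ≡ [ m′ ≈ n′ ]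
≈-cong {m} {n} to from with m ≟ n
... | yes eq = trans (≈-yes eq) (sym (≈-yes (to eq)))
... | no neq = trans (≈-no neq) (sym (≈-no (neq ∘ from)))

δ-indicator : ∀ m n → δ (+ m ℤ.- + n) ≡ + [ n ≈ m ]
δ-indicator m n with n ≟ m
... | yes refl = trans (cong δ (ℤₚ.+-inverseʳ (+ n))) (cong +_ (sym (≈-yes refl)))
... | no n≢m   = trans (trans (sym (ℤₚ.*-identityˡ _))
  (*-δ-zero (+ 1) (+ m ℤ.- + n) (n≢m ∘ sym ∘ ℤₚ.+-injective ∘ ℤₚ.i-j≡0⇒i≡j (+ m) (+ n))))
  (cong +_ (sym (≈-no n≢m)))

-- The recurrence for divisor sums

-- The sum of the divisors of (N − a)/4.
divisorSum : ℕ → ℕ → ℕ → ℕ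
divisorSum L N a = ∑ L λ i → ∑ L λ j → suc i * [ N ≈ a + 4 * (suc i * suc j) ]
  where open ℕΣ

-- A solution (x, d, e) of x² + 4de = N is the indefinite form dX² + xXY − eY² of discriminant N.
-- Writing x = e − d ∓ r turns the solutions (x ∈ ℤ, d, e > 0) into triples (p, q, r) of
-- absolute values of the form on a superbase, and exchanging q and r is a symmetry.
module FormSum (N M L : ℕ) (N≡ : N ≡ 5 + M * 8) (3N≤L : 3 * N ≤ L) where
  open ℤΣ
  open ≡-Reasoning

  private
    pos : ℕ → ℤ
    pos i = + suc i

  form : ℤ → ℤ → ℤ → ℤ
  form d x e = x ℤ.* x ℤ.+ + 4 ℤ.* d ℤ.* e ℤ.- + N

  private
    N≤L : N ≤ L
    N≤L = ≤-trans (m≤n*m N 3) 3N≤L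

    weighted : (ℤ → ℤ → ℤ → ℤ) → ℤ → ℤ → ℤ → ℤ
    weighted G d e x = G d x e ℤ.* δ (form d x e)

    solution : ∀ i j x → form (pos i) x (pos j) ≡ 0ℤ → ∣ x ∣ * ∣ x ∣ + 4 * (suc i * suc j) ≡ N
    solution i j x eq = ℤₚ.+-injective (begin
      + (∣ x ∣ * ∣ x ∣) ℤ.+ + (4 * (suc i * suc j))   ≡⟨ cong₂ ℤ._+_ (sym (square-abs x)) four ⟩
      x ℤ.* x ℤ.+ + 4 ℤ.* pos i ℤ.* pos j             ≡⟨ ℤₚ.i-j≡0⇒i≡j _ (+ N) eq ⟩
      + N                                             ∎)
      where
      four : + (4 * (suc i * suc j)) ≡ + 4 ℤ.* pos i ℤ.* pos j
      four = trans (ℤₚ.pos-* 4 (suc i * suc j))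
        (trans (cong (λ # → + 4 ℤ.* #) (ℤₚ.pos-* (suc i) (suc j))) (sym (ℤₚ.*-assoc (+ 4) (pos i) (pos j))))

    ∣x∣≤N : ∀ i j x → form (pos i) x (pos j) ≡ 0ℤ → ∣ x ∣ ≤ N
    ∣x∣≤N i j x eq = ≤-trans (n≤n*n ∣ x ∣) (subst (∣ x ∣ * ∣ x ∣ ≤_) (solution i j x eq) (m≤m+n _ _))

    d≤N : ∀ i j x → form (pos i) x (pos j) ≡ 0ℤ → suc i ≤ N
    d≤N i j x eq = subst (suc i ≤_) (solution i j x eq)
      (≤-trans (≤-trans (m≤m*n (suc i) (suc j)) (m≤n*m _ 4)) (m≤n+m _ (∣ x ∣ * ∣ x ∣)))

    e≤N : ∀ i j x → form (pos i) x (pos j) ≡ 0ℤ → suc j ≤ N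
    e≤N i j x eq = subst (suc j ≤_) (solution i j x eq)
      (≤-trans (≤-trans (m≤n*m (suc j) (suc i)) (m≤n*m _ 4)) (m≤n+m _ (∣ x ∣ * ∣ x ∣)))

    -- A solution with x = 0 would give N = 4de, and one with x = e - d would give N = (d + e)²;
    -- both contradict N ≡ 5 (mod 8). So neither omitted centre carries weight, and the sum over x ≠
    -- 0 is also the sum over x ≠ e - d.
    recentre-at : ∀ G i j → symmetricSum L (weighted G (pos i) (pos j)) 0ℤ
                          ≡ symmetricSum L (weighted G (pos i) (pos j)) (pos j ℤ.- pos i)
    recentre-at G i j = recentre L (weighted G (pos i) (pos j)) (pos j ℤ.- pos i)
      (*-δ-zero (G (pos i) 0ℤ (pos j)) (form (pos i) 0ℤ (pos j)) at-0)
      (*-δ-zero (G (pos i) (pos j ℤ.- pos i) (pos j)) (form (pos i) (pos j ℤ.- pos i) (pos j)) at-centre)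
      (λ z L<∣z∣ → *-δ-zero (G (pos i) z (pos j)) (form (pos i) z (pos j))
        λ eq → <⇒≱ L<∣z∣ (≤-trans (∣x∣≤N i j z eq) N≤L))
      (λ z L< → *-δ-zero (G (pos i) z (pos j)) (form (pos i) z (pos j)) λ eq → <⇒≱ L< (near z eq))
      where
      at-0 : form (pos i) 0ℤ (pos j) ≢ 0ℤ
      at-0 eq = 4*≢5+8m (suc i * suc j) M (trans (solution i j 0ℤ eq) N≡)
      sum-square : ∀ d e n → (e ℤ.- d) ℤ.* (e ℤ.- d) ℤ.+ + 4 ℤ.* d ℤ.* e ℤ.- n ≡ (d ℤ.+ e) ℤ.* (d ℤ.+ e) ℤ.- n
      sum-square = ℤ-Solver.solve-∀
      at-centre : form (pos i) (pos j ℤ.- pos i) (pos j) ≢ 0ℤ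
      at-centre eq = square≢5+8m (suc i + suc j) M (trans (ℤₚ.+-injective (begin
        + ((suc i + suc j) * (suc i + suc j))   ≡⟨ ℤₚ.pos-* (suc i + suc j) (suc i + suc j) ⟩
        (pos i ℤ.+ pos j) ℤ.* (pos i ℤ.+ pos j)
          ≡⟨ ℤₚ.i-j≡0⇒i≡j _ (+ N) (trans (sym (sum-square (pos i) (pos j) (+ N))) eq) ⟩
        + N                                     ∎)) N≡)
      -- |x|, d and e are each at most N, which is where 3N ≤ L comes from.
      near : ∀ z → form (pos i) z (pos j) ≡ 0ℤ → ∣ z ℤ.- (pos j ℤ.- pos i) ∣ ≤ L
      near z eq = ≤-trans (ℤₚ.∣i-j∣≤∣i∣+∣j∣ z (pos j ℤ.- pos i))
        (≤-trans (+-mono-≤ (∣x∣≤N i j z eq) (≤-trans (ℤₚ.∣i-j∣≤∣i∣+∣j∣ (pos j) (pos i))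
          (+-mono-≤ (e≤N i j z eq) (≤-trans (d≤N i j z eq) (m≤m+n N 0))))) 3N≤L)

    ∑³ : (ℕ → ℕ → ℕ → ℤ) → ℤ
    ∑³ F = ∑ L λ i → ∑ L λ j → ∑ L λ r → F i j r

    ∑³-cong : ∀ {F F′} → (∀ i j r → F i j r ≡ F′ i j r) → ∑³ F ≡ ∑³ F′
    ∑³-cong eq = ∑-cong L λ i → ∑-cong L λ j → ∑-cong L λ r → eq i j r

    ∑³-+ : ∀ F F′ → ∑³ (λ i j r → F i j r ℤ.+ F′ i j r) ≡ ∑³ F ℤ.+ ∑³ F′
    ∑³-+ F F′ = trans
      (∑-cong L λ i → trans (∑-cong L λ j → ∑-⊕ L (F i j) (F′ i j)) (∑-⊕ L _ _))
      (∑-⊕ L _ _)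

    ∑³-swap₁₂ : ∀ F → ∑³ F ≡ ∑³ (λ i j r → F j i r)
    ∑³-swap₁₂ F = ∑-swap L L λ i j → ∑ L (F i j)

    ∑³-swap₂₃ : ∀ F → ∑³ F ≡ ∑³ (λ i j r → F i r j)
    ∑³-swap₂₃ F = ∑-cong L λ i → ∑-swap L L (F i)

    formSum : (ℤ → ℤ → ℤ → ℤ) → ℤ
    formSum G = ∑ L λ i → ∑ L λ j → symmetricSum L (weighted G (pos i) (pos j)) 0ℤ

    X : ℕ → ℕ → ℕ → ℤ
    X i j r = pos j ℤ.- pos i ℤ.- pos r

    τ : ℕ → ℕ → ℕ → ℤ
    τ i j r = δ (form (pos i) (X i j r) (pos j))

    -- For x = q - p - r the value x² + 4pq equals p² + q² + r² + 2pq + 2pr - 2qr, which is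
    -- symmetric in q and r.
    τ-sym : ∀ i j r → τ i j r ≡ τ i r j
    τ-sym i j r = cong δ (eq (pos i) (pos j) (pos r) (+ N))
      where
      eq : ∀ p q r n → (q ℤ.- p ℤ.- r) ℤ.* (q ℤ.- p ℤ.- r) ℤ.+ + 4 ℤ.* p ℤ.* q ℤ.- n
                     ≡ (r ℤ.- p ℤ.- q) ℤ.* (r ℤ.- p ℤ.- q) ℤ.+ + 4 ℤ.* p ℤ.* r ℤ.- n
      eq = ℤ-Solver.solve-∀

    -- After d and e trade places, the solutions with x = e - d + r run over the same triples as
    -- those with x = e - d - r, with x replaced by -x.
    superbaseSum : ∀ G → formSum G ≡ ∑³ λ i j r →
      (G (pos j) (ℤ.- X i j r) (pos i) ℤ.+ G (pos i) (X i j r) (pos j)) ℤ.* τ i j r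
    superbaseSum G = begin
      formSum G                            ≡⟨ ∑-cong L (λ i → ∑-cong L λ j → recentre-at G i j) ⟩
      ∑³ (λ i j r → A i j r ℤ.+ B i j r)   ≡⟨ ∑³-+ A B ⟩
      ∑³ A ℤ.+ ∑³ B                        ≡⟨ cong (λ # → # ℤ.+ ∑³ B) (∑³-swap₁₂ A) ⟩
      ∑³ (λ i j r → A j i r) ℤ.+ ∑³ B      ≡⟨ ∑³-+ _ B ⟨
      ∑³ (λ i j r → A j i r ℤ.+ B i j r)   ≡⟨ ∑³-cong collect ⟩
      ∑³ (λ i j r → (G (pos j) (ℤ.- X i j r) (pos i) ℤ.+ G (pos i) (X i j r) (pos j)) ℤ.* τ i j r) ∎
      where
      A B : ℕ → ℕ → ℕ → ℤ
      A i j r = weighted G (pos i) (pos j) (pos j ℤ.- pos i ℤ.+ pos r)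
      B i j r = weighted G (pos i) (pos j) (pos j ℤ.- pos i ℤ.- pos r)
      negX : ∀ p q r → p ℤ.- q ℤ.+ r ≡ ℤ.- (q ℤ.- p ℤ.- r)
      negX = ℤ-Solver.solve-∀
      form-flip : ∀ p q x n → (ℤ.- x) ℤ.* (ℤ.- x) ℤ.+ + 4 ℤ.* q ℤ.* p ℤ.- n ≡ x ℤ.* x ℤ.+ + 4 ℤ.* p ℤ.* q ℤ.- n
      form-flip = ℤ-Solver.solve-∀
      collect : ∀ i j r → A j i r ℤ.+ B i j r ≡
        (G (pos j) (ℤ.- X i j r) (pos i) ℤ.+ G (pos i) (X i j r) (pos j)) ℤ.* τ i j r
      collect i j r = trans
        (cong (ℤ._+ B i j r) (trans
          (cong (weighted G (pos j) (pos i)) (negX (pos i) (pos j) (pos r)))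
          (cong (λ # → G (pos j) (ℤ.- X i j r) (pos i) ℤ.* δ #) (form-flip (pos i) (pos j) (X i j r) (+ N)))))
        (sym (ℤₚ.*-distribʳ-+ (τ i j r) (G (pos j) (ℤ.- X i j r) (pos i)) (G (pos i) (X i j r) (pos j))))

    -- Their superbase sums agree after symmetrising in q and r, and odd-cubic is odd in x.
    cubic odd-cubic : ℤ → ℤ → ℤ → ℤ
    cubic     d x e = d ℤ.* (d ℤ.* e ℤ.- x ℤ.* x)
    odd-cubic d x e = (d ℤ.* d ℤ.- e ℤ.* e) ℤ.* x

    odd-vanishes : formSum odd-cubic ≡ 0ℤ
    odd-vanishes = ∑-zero L λ i _ → ∑-zero L λ j _ → ∑-zero L λ r _ → cancel (pos i) (pos j) (pos r)
      where
      odd : ∀ d e x u → (d ℤ.* d ℤ.- e ℤ.* e) ℤ.* x ℤ.* u ℤ.+ (d ℤ.* d ℤ.- e ℤ.* e) ℤ.* (ℤ.- x) ℤ.* u ≡ 0ℤ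
      odd = ℤ-Solver.solve-∀
      even : ∀ d e x n → (ℤ.- x) ℤ.* (ℤ.- x) ℤ.+ + 4 ℤ.* d ℤ.* e ℤ.- n ≡ x ℤ.* x ℤ.+ + 4 ℤ.* d ℤ.* e ℤ.- n
      even = ℤ-Solver.solve-∀
      cancel : ∀ d e x → weighted odd-cubic d e (0ℤ ℤ.+ x) ℤ.+ weighted odd-cubic d e (0ℤ ℤ.- x) ≡ 0ℤ
      cancel d e x rewrite ℤₚ.+-identityˡ x | ℤₚ.+-identityˡ (ℤ.- x) = trans
        (cong (λ # → odd-cubic d x e ℤ.* δ (form d x e) ℤ.+ odd-cubic d (ℤ.- x) e ℤ.* δ #) (even d e x (+ N)))
        (odd d e x (δ (form d x e)))

    cubic-vanishes : formSum cubic ≡ 0ℤ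
    -- Two copies of the sum are taken in order to symmetrise in q and r; the result is the
    -- superbase sum of `odd-cubic`.
    cubic-vanishes = ℤₚ.*-cancelˡ-≡ (+ 2) (formSum cubic) 0ℤ (begin
      + 2 ℤ.* formSum cubic                         ≡⟨ double (formSum cubic) ⟩
      formSum cubic ℤ.+ formSum cubic               ≡⟨ cong₂ ℤ._+_ (superbaseSum cubic)
                                                          (trans (superbaseSum cubic) (∑³-swap₂₃ C)) ⟩
      ∑³ C ℤ.+ ∑³ (λ i j r → C i r j)               ≡⟨ ∑³-+ C _ ⟨
      ∑³ (λ i j r → C i j r ℤ.+ C i r j)            ≡⟨ ∑³-cong symmetrised ⟩
      ∑³ (λ i j r → K i j r ℤ.+ K i r j)            ≡⟨ ∑³-+ K _ ⟩
      ∑³ K ℤ.+ ∑³ (λ i j r → K i r j)               ≡⟨ cong (λ # → ∑³ K ℤ.+ #) (∑³-swap₂₃ K) ⟨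
      ∑³ K ℤ.+ ∑³ K                                 ≡⟨ ∑³-+ K K ⟨
      ∑³ (λ i j r → K i j r ℤ.+ K i j r)            ≡⟨ ∑³-cong (λ i j r → odd-pair (pos i) (pos j) (X i j r) (τ i j r)) ⟩
      ∑³ (λ i j r → (odd-cubic (pos j) (ℤ.- X i j r) (pos i) ℤ.+ odd-cubic (pos i) (X i j r) (pos j)) ℤ.* τ i j r)
                                                    ≡⟨ superbaseSum odd-cubic ⟨
      formSum odd-cubic                             ≡⟨ odd-vanishes ⟩
      0ℤ                                            ∎)
      where
      C K : ℕ → ℕ → ℕ → ℤ
      C i j r = (cubic (pos j) (ℤ.- X i j r) (pos i) ℤ.+ cubic (pos i) (X i j r) (pos j)) ℤ.* τ i j r
      K i j r = (pos i ℤ.* pos i ℤ.- pos j ℤ.* pos j) ℤ.* X i j r ℤ.* τ i j r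
      double : ∀ a → + 2 ℤ.* a ≡ a ℤ.+ a
      double = ℤ-Solver.solve-∀
      odd-pair : ∀ p q x t → (p ℤ.* p ℤ.- q ℤ.* q) ℤ.* x ℤ.* t ℤ.+ (p ℤ.* p ℤ.- q ℤ.* q) ℤ.* x ℤ.* t
        ≡ ((q ℤ.* q ℤ.- p ℤ.* p) ℤ.* (ℤ.- x) ℤ.+ (p ℤ.* p ℤ.- q ℤ.* q) ℤ.* x) ℤ.* t
      odd-pair = ℤ-Solver.solve-∀
      key : ∀ p q r t →
        (q ℤ.* (q ℤ.* p ℤ.- (ℤ.- (q ℤ.- p ℤ.- r)) ℤ.* (ℤ.- (q ℤ.- p ℤ.- r))) ℤ.+
          p ℤ.* (p ℤ.* q ℤ.- (q ℤ.- p ℤ.- r) ℤ.* (q ℤ.- p ℤ.- r))) ℤ.* t ℤ.+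
        (r ℤ.* (r ℤ.* p ℤ.- (ℤ.- (r ℤ.- p ℤ.- q)) ℤ.* (ℤ.- (r ℤ.- p ℤ.- q))) ℤ.+
          p ℤ.* (p ℤ.* r ℤ.- (r ℤ.- p ℤ.- q) ℤ.* (r ℤ.- p ℤ.- q))) ℤ.* t
        ≡ (p ℤ.* p ℤ.- q ℤ.* q) ℤ.* (q ℤ.- p ℤ.- r) ℤ.* t ℤ.+ (p ℤ.* p ℤ.- r ℤ.* r) ℤ.* (r ℤ.- p ℤ.- q) ℤ.* t
      key = ℤ-Solver.solve-∀
      symmetrised : ∀ i j r → C i j r ℤ.+ C i r j ≡ K i j r ℤ.+ K i r j
      symmetrised i j r rewrite sym (τ-sym i j r) = key (pos i) (pos j) (pos r) (τ i j r)

  cubicSum≡0 : ∑ L (λ i → ∑ L λ j → ∑ L λ r → cubic (pos i) (pos r) (pos j) ℤ.* δ (form (pos i) (pos r) (pos j))) ≡ 0ℤ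
  cubicSum≡0 = ℤₚ.*-cancelˡ-≡ (+ 2) _ 0ℤ (trans (sym halve) cubic-vanishes)
    where
    even : ∀ d e x n → (ℤ.- x) ℤ.* (ℤ.- x) ℤ.+ + 4 ℤ.* d ℤ.* e ℤ.- n ≡ x ℤ.* x ℤ.+ + 4 ℤ.* d ℤ.* e ℤ.- n
    even = ℤ-Solver.solve-∀
    double : ∀ d e x t → d ℤ.* (d ℤ.* e ℤ.- x ℤ.* x) ℤ.* t ℤ.+ d ℤ.* (d ℤ.* e ℤ.- (ℤ.- x) ℤ.* (ℤ.- x)) ℤ.* t
      ≡ + 2 ℤ.* (d ℤ.* (d ℤ.* e ℤ.- x ℤ.* x) ℤ.* t)
    double = ℤ-Solver.solve-∀
    fold : ∀ d e x → weighted cubic d e (0ℤ ℤ.+ x) ℤ.+ weighted cubic d e (0ℤ ℤ.- x) ≡ + 2 ℤ.* weighted cubic d e x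
    fold d e x rewrite ℤₚ.+-identityˡ x | ℤₚ.+-identityˡ (ℤ.- x) = trans
      (cong (λ # → cubic d x e ℤ.* δ (form d x e) ℤ.+ cubic d (ℤ.- x) e ℤ.* δ #) (even d e x (+ N)))
      (double d e x (δ (form d x e)))
    halve : formSum cubic ≡ + 2 ℤ.* ∑³ (λ i j r → weighted cubic (pos i) (pos j) (pos r))
    halve = trans (∑-cong L λ i → trans (∑-cong L λ j → trans (∑-cong L λ r → fold (pos i) (pos j) (pos r))
      (∑-⊛ L (+ 2))) (∑-⊛ L (+ 2))) (∑-⊛ L (+ 2))

  -- On x² + 4de = N one has N·d = 5x²·d + 4d(de - x²), so the difference of the two sides is four
  -- times the vanishing sum of `cubic`.
  divisor-recurrence : N * ℕΣ.∑ L (λ r → divisorSum L N (suc r * suc r))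
                     ≡ ℕΣ.∑ L (λ r → 5 * (suc r * suc r) * divisorSum L N (suc r * suc r))
  divisor-recurrence = ℤₚ.+-injective (begin
    + (N * ℕΣ.∑ L s)                              ≡⟨ ℤₚ.pos-* N (ℕΣ.∑ L s) ⟩
    + N ℤ.* + ℕΣ.∑ L s                            ≡⟨ cong (λ # → + N ℤ.* #) (pos-∑ L s) ⟩
    + N ℤ.* ∑ L (λ r → + s r)                     ≡⟨ ∑-⊛ L (+ N) ⟨
    ∑ L (λ r → + N ℤ.* + s r)                     ≡⟨ ∑-cong L row ⟩
    ∑ L (λ r → + (5 * sq r * s r) ℤ.+ + 4 ℤ.* ∑ L (λ i → ∑ L (λ j → C i j r)))
                                                  ≡⟨ ∑-⊕ L _ _ ⟩
    ∑ L (λ r → + (5 * sq r * s r)) ℤ.+ ∑ L (λ r → + 4 ℤ.* ∑ L (λ i → ∑ L (λ j → C i j r)))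
                                                  ≡⟨ cong (λ # → ∑ L (λ r → + (5 * sq r * s r)) ℤ.+ #) rest ⟩
    ∑ L (λ r → + (5 * sq r * s r)) ℤ.+ 0ℤ         ≡⟨ ℤₚ.+-identityʳ _ ⟩
    ∑ L (λ r → + (5 * sq r * s r))                ≡⟨ pos-∑ L _ ⟨
    + ℕΣ.∑ L (λ r → 5 * sq r * s r)               ∎)
    where
    sq s : ℕ → ℕ
    sq r = suc r * suc r
    s r = divisorSum L N (sq r)
    C : ℕ → ℕ → ℕ → ℤ
    C i j r = weighted cubic (pos i) (pos j) (pos r)

    rest : ∑ L (λ r → + 4 ℤ.* ∑ L (λ i → ∑ L (λ j → C i j r))) ≡ 0ℤ
    rest = begin
      ∑ L (λ r → + 4 ℤ.* ∑ L (λ i → ∑ L (λ j → C i j r)))   ≡⟨ ∑-⊛ L (+ 4) ⟩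
      + 4 ℤ.* ∑ L (λ r → ∑ L (λ i → ∑ L (λ j → C i j r)))
        ≡⟨ cong (λ # → + 4 ℤ.* #) (trans (∑-swap L L _) (∑-cong L λ i → ∑-swap L L _)) ⟩
      + 4 ℤ.* ∑³ C                                          ≡⟨ cong (λ # → + 4 ℤ.* #) cubicSum≡0 ⟩
      0ℤ                                                    ∎

    term : ∀ i j r → + N ℤ.* + (suc i * [ N ≈ sq r + 4 * (suc i * suc j) ])
      ≡ + (5 * sq r) ℤ.* + (suc i * [ N ≈ sq r + 4 * (suc i * suc j) ]) ℤ.+ + 4 ℤ.* C i j r
    term i j r = begin
      + N ℤ.* + (suc i * I)                ≡⟨ cong (λ # → + N ℤ.* #) (trans (ℤₚ.pos-* (suc i) I) (cong (λ # → d ℤ.* #) I≡)) ⟩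
      + N ℤ.* (d ℤ.* Δ)                    ≡⟨ ℤₚ.*-assoc (+ N) d Δ ⟨
      + N ℤ.* d ℤ.* Δ                      ≡⟨ δ-cong (+ N ℤ.* d) _ (form d x e) (λ eq → on-form d x e (+ N) eq) ⟩
      (+ 5 ℤ.* (x ℤ.* x) ℤ.* d ℤ.+ + 4 ℤ.* cubic d x e) ℤ.* Δ
                                           ≡⟨ regroup (x ℤ.* x) d (cubic d x e) Δ ⟩
      + 5 ℤ.* (x ℤ.* x) ℤ.* (d ℤ.* Δ) ℤ.+ + 4 ℤ.* C i j r
        ≡⟨ cong₂ (λ u v → u ℤ.* v ℤ.+ + 4 ℤ.* C i j r) (sym (trans (ℤₚ.pos-* 5 (sq r)) (cong (λ # → + 5 ℤ.* #) (ℤₚ.pos-* (suc r) (suc r)))))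
                                           (sym (trans (ℤₚ.pos-* (suc i) I) (cong (λ # → d ℤ.* #) I≡))) ⟩
      + (5 * sq r) ℤ.* + (suc i * I) ℤ.+ + 4 ℤ.* C i j r ∎
      where
      d e x Δ : ℤ
      d = pos i
      e = pos j
      x = pos r
      Δ = δ (form d x e)
      I = [ N ≈ sq r + 4 * (suc i * suc j) ]
      I≡ : + I ≡ Δ
      I≡ = trans (sym (δ-indicator (sq r + 4 * (suc i * suc j)) N))
        (cong (λ # → δ (# ℤ.- + N)) (cong₂ ℤ._+_ (ℤₚ.pos-* (suc r) (suc r))
          (trans (ℤₚ.pos-* 4 (suc i * suc j))
            (trans (cong (λ # → + 4 ℤ.* #) (ℤₚ.pos-* (suc i) (suc j))) (sym (ℤₚ.*-assoc (+ 4) d e))))))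
      expand : ∀ d x e → (x ℤ.* x ℤ.+ + 4 ℤ.* d ℤ.* e) ℤ.* d
        ≡ + 5 ℤ.* (x ℤ.* x) ℤ.* d ℤ.+ + 4 ℤ.* (d ℤ.* (d ℤ.* e ℤ.- x ℤ.* x))
      expand = ℤ-Solver.solve-∀
      on-form : ∀ d x e n → x ℤ.* x ℤ.+ + 4 ℤ.* d ℤ.* e ℤ.- n ≡ 0ℤ →
        n ℤ.* d ≡ + 5 ℤ.* (x ℤ.* x) ℤ.* d ℤ.+ + 4 ℤ.* (d ℤ.* (d ℤ.* e ℤ.- x ℤ.* x))
      on-form d x e n eq = trans (cong (ℤ._* d) (sym (ℤₚ.i-j≡0⇒i≡j (x ℤ.* x ℤ.+ + 4 ℤ.* d ℤ.* e) n eq))) (expand d x e)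
      regroup : ∀ s d c t → (+ 5 ℤ.* s ℤ.* d ℤ.+ + 4 ℤ.* c) ℤ.* t ≡ + 5 ℤ.* s ℤ.* (d ℤ.* t) ℤ.+ + 4 ℤ.* (c ℤ.* t)
      regroup = ℤ-Solver.solve-∀

    row : ∀ r → + N ℤ.* + s r ≡ + (5 * sq r * s r) ℤ.+ + 4 ℤ.* ∑ L (λ i → ∑ L (λ j → C i j r))
    row r = begin
      + N ℤ.* + s r                              ≡⟨ spread (+ N) ⟩
      ∑ L (λ i → ∑ L λ j → + N ℤ.* + t i j)      ≡⟨ ∑-cong L (λ i → ∑-cong L λ j → term i j r) ⟩
      ∑ L (λ i → ∑ L λ j → + (5 * sq r) ℤ.* + t i j ℤ.+ + 4 ℤ.* C i j r)
        ≡⟨ trans (∑-cong L λ i → ∑-⊕ L _ _) (∑-⊕ L _ _) ⟩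
      ∑ L (λ i → ∑ L λ j → + (5 * sq r) ℤ.* + t i j) ℤ.+ ∑ L (λ i → ∑ L λ j → + 4 ℤ.* C i j r)
        ≡⟨ cong₂ ℤ._+_ (sym (spread (+ (5 * sq r)))) (trans (∑-cong L λ i → ∑-⊛ L (+ 4)) (∑-⊛ L (+ 4))) ⟩
      + (5 * sq r) ℤ.* + s r ℤ.+ + 4 ℤ.* ∑ L (λ i → ∑ L (λ j → C i j r))
        ≡⟨ cong (ℤ._+ + 4 ℤ.* ∑ L (λ i → ∑ L (λ j → C i j r))) (ℤₚ.pos-* (5 * sq r) (s r)) ⟨
      + (5 * sq r * s r) ℤ.+ + 4 ℤ.* ∑ L (λ i → ∑ L (λ j → C i j r)) ∎
      where
      t : ℕ → ℕ → ℕ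
      t i j = suc i * [ N ≈ sq r + 4 * (suc i * suc j) ]
      spread : ∀ c → c ℤ.* + s r ≡ ∑ L (λ i → ∑ L λ j → c ℤ.* + t i j)
      spread c = begin
        c ℤ.* + s r                              ≡⟨ cong (λ # → c ℤ.* #) (trans (pos-∑ L _) (∑-cong L λ i → pos-∑ L (t i))) ⟩
        c ℤ.* ∑ L (λ i → ∑ L λ j → + t i j)      ≡⟨ ∑-⊛ L c ⟨
        ∑ L (λ i → c ℤ.* ∑ L λ j → + t i j)      ≡⟨ ∑-cong L (λ i → ∑-⊛ L c) ⟨
        ∑ L (λ i → ∑ L λ j → c ℤ.* + t i j)      ∎

open ℕΣ using (∑; ∑-cong; ∑-cong-<; ∑-zero; ∑-⊛; ∑-⊕; ∑-swap; ∑-split; ∑-head; ∑-extend)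

-- Inequalities between sums, and sums over pairs of indices

∑-mono : ∀ n {f g : ℕ → ℕ} → (∀ k → k < n → f k ≤ g k) → ∑ n f ≤ ∑ n g
∑-mono zero    f≤g = z≤n
∑-mono (suc n) f≤g = +-mono-≤ (∑-mono n λ k k<n → f≤g k (m<n⇒m<1+n k<n)) (f≤g n ≤-refl)

∑-term : ∀ {n} (f : ℕ → ℕ) {k} → k < n → f k ≤ ∑ n f
∑-term {suc n} f {k} k<1+n with k ≟ n
... | yes refl = m≤n+m (f k) (∑ n f)
... | no  k≢n  = ≤-trans (∑-term f (≤∧≢⇒< (s≤s⁻¹ k<1+n) k≢n)) (m≤m+n _ (f n))

∑-pairs : ∀ n (f : ℕ → ℕ) → ∑ (2 * n) f ≡ ∑ n (λ k → f (2 * k) + f (1 + 2 * k))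
∑-pairs zero    f = refl
∑-pairs (suc n) f = begin
  ∑ (2 * suc n) f                                ≡⟨ cong (λ # → ∑ # f) (*-suc 2 n) ⟩
  ∑ (2 * n) f + f (2 * n) + f (1 + 2 * n)        ≡⟨ +-assoc (∑ (2 * n) f) _ _ ⟩
  ∑ (2 * n) f + (f (2 * n) + f (1 + 2 * n))      ≡⟨ cong (_+ (f (2 * n) + f (1 + 2 * n))) (∑-pairs n f) ⟩
  ∑ (suc n) (λ k → f (2 * k) + f (1 + 2 * k))    ∎
  where open ≡-Reasoning

-- Parity

odd : ℕ → ℕ
odd 0             = 0
odd 1             = 1
odd (suc (suc n)) = odd n

-- even± counts x ≥ 0 with the number of even integers of absolute value x.
positive even⁺ isZero even± : ℕ → ℕ
positive zero    = 0
positive (suc _) = 1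
even⁺ zero     = 0
even⁺ (suc n)  = odd n
isZero zero    = 1
isZero (suc _) = 0
even± x = isZero x + 2 * even⁺ x

positive≤1 : ∀ x → positive x ≤ 1
positive≤1 zero    = z≤n
positive≤1 (suc _) = s≤s z≤n

odd≤positive : ∀ x → odd x ≤ positive x
odd≤positive 0             = z≤n
odd≤positive 1             = s≤s z≤n
odd≤positive (suc (suc x)) = ≤-trans (odd≤positive x) (positive≤1 x)

even⁺≤positive : ∀ x → even⁺ x ≤ positive x
even⁺≤positive zero    = z≤n
even⁺≤positive (suc x) = ≤-trans (odd≤positive x) (positive≤1 x)

odd-double : ∀ y → odd (2 * y) ≡ 0
odd-double zero    = refl
odd-double (suc y) = trans (cong odd (*-suc 2 y)) (odd-double y)

odd-1+double : ∀ y → odd (1 + 2 * y) ≡ 1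
odd-1+double zero    = refl
odd-1+double (suc y) = trans (cong (odd ∘ suc) (*-suc 2 y)) (odd-1+double y)

data Half : ℕ → Set where
  even-form : ∀ y → Half (2 * y)
  odd-form  : ∀ y → Half (1 + 2 * y)

half : ∀ n → Half n
half zero    = even-form 0
half (suc n) with half n
... | even-form y = odd-form y
... | odd-form y  = subst Half (*-suc 2 y) (even-form (suc y))

pronic-even : ∀ y → ∃ λ t → y * (1 + y) ≡ 2 * t
pronic-even y with half y
... | even-form z = z * (1 + 2 * z) , *-assoc 2 z (1 + 2 * z)
... | odd-form z  = (1 + 2 * z) * (1 + z) , lemma z
  where
  lemma : ∀ z → (1 + 2 * z) * (1 + (1 + 2 * z)) ≡ 2 * ((1 + 2 * z) * (1 + z))
  lemma = ℕ-Solver.solve-∀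

odd-square : ∀ y → ∃ λ t → (1 + 2 * y) * (1 + 2 * y) ≡ 1 + t * 8
odd-square y with pronic-even y
... | t , eq = t , trans (expand y) (trans (cong (λ # → 1 + 4 * #) eq) (regroup t))
  where
  expand : ∀ y → (1 + 2 * y) * (1 + 2 * y) ≡ 1 + 4 * (y * (1 + y))
  expand = ℕ-Solver.solve-∀
  regroup : ∀ t → 1 + 4 * (2 * t) ≡ 1 + t * 8
  regroup = ℕ-Solver.solve-∀

-- Sums over squares

module Squares (B : ℕ) where
  open ≡-Reasoning

  opaque
    S : (ℕ → ℕ) → (ℕ → ℕ) → ℕ
    S w Ψ = ∑ B λ x → w x * Ψ (x * x)

    S-def : ∀ w Ψ → S w Ψ ≡ ∑ B (λ x → w x * Ψ (x * x))
    S-def w Ψ = refl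

  private variable
    w v Φ Ψ : ℕ → ℕ

  private
    *-rotate : ∀ a b c → a * (b * c) ≡ b * (a * c)
    *-rotate = ℕ-Solver.solve-∀

  opaque
    unfolding S

    S-cong-on : (∀ x → w x * Φ (x * x) ≡ w x * Ψ (x * x)) → S w Φ ≡ S w Ψ
    S-cong-on eq = ∑-cong B eq

    S-cong : (∀ s → Φ s ≡ Ψ s) → S w Φ ≡ S w Ψ
    S-cong {w = w} eq = ∑-cong B λ x → cong (w x *_) (eq (x * x))

    S-+ : ∀ w Φ Ψ → S w (λ s → Φ s + Ψ s) ≡ S w Φ + S w Ψ
    S-+ w Φ Ψ = trans (∑-cong B λ x → *-distribˡ-+ (w x) _ _) (∑-⊕ B _ _)

    S-* : ∀ w c Φ → S w (λ s → c * Φ s) ≡ c * S w Φ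
    S-* w c Φ = trans (∑-cong B λ x → *-rotate (w x) c (Φ (x * x))) (∑-⊛ B c)

    S-swap : ∀ w v (F : ℕ → ℕ → ℕ) → S w (λ s → S v (F s)) ≡ S v (λ t → S w (λ s → F s t))
    S-swap w v F = begin
      ∑ B (λ x → w x * ∑ B (λ y → v y * F (x * x) (y * y)))   ≡⟨ ∑-cong B (λ x → ∑-⊛ B (w x)) ⟨
      ∑ B (λ x → ∑ B (λ y → w x * (v y * F (x * x) (y * y)))) ≡⟨ ∑-swap B B _ ⟩
      ∑ B (λ y → ∑ B (λ x → w x * (v y * F (x * x) (y * y))))
        ≡⟨ ∑-cong B (λ y → trans (∑-cong B λ x → *-rotate (w x) (v y) _) (∑-⊛ B (v y))) ⟩
      ∑ B (λ y → v y * ∑ B (λ x → w x * F (x * x) (y * y)))   ∎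

    S-zero : ∀ w → (∀ s → Φ s ≡ 0) → S w Φ ≡ 0
    S-zero w eq = ∑-zero B λ x _ → trans (cong (w x *_) (eq (x * x))) (*-zeroʳ (w x))

    S-mono : (∀ x → w x ≤ v x) → (∀ s → Φ s ≤ Ψ s) → S w Φ ≤ S v Ψ
    S-mono w≤v Φ≤Ψ = ∑-mono B λ x _ → *-mono-≤ (w≤v x) (Φ≤Ψ (x * x))

    S-isZero : ∀ Φ → 0 < B → S isZero Φ ≡ Φ 0
    S-isZero Φ (s≤s {n = L} _) = begin
      ∑ (suc L) (λ x → isZero x * Φ (x * x))   ≡⟨ ∑-head L _ ⟩
      Φ 0 + 0 + ∑ L (λ _ → 0)                  ≡⟨ cong₂ _+_ (+-identityʳ (Φ 0)) (∑-zero L λ _ _ → refl) ⟩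
      Φ 0 + 0                                  ≡⟨ +-identityʳ (Φ 0) ⟩
      Φ 0                                      ∎

    S-even± : ∀ Φ → S even± Φ ≡ S isZero Φ + 2 * S even⁺ Φ
    S-even± Φ = begin
      ∑ B (λ x → even± x * Φ (x * x))   ≡⟨ ∑-cong B (λ x → split (isZero x) (even⁺ x) (Φ (x * x))) ⟩
      ∑ B (λ x → isZero x * Φ (x * x) + 2 * (even⁺ x * Φ (x * x)))   ≡⟨ ∑-⊕ B _ _ ⟩
      S isZero Φ + ∑ B (λ x → 2 * (even⁺ x * Φ (x * x)))   ≡⟨ cong (_+_ (S isZero Φ)) (∑-⊛ B 2) ⟩
      S isZero Φ + 2 * S even⁺ Φ        ∎
      where
      split : ∀ z e p → (z + 2 * e) * p ≡ z * p + 2 * (e * p)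
      split = ℕ-Solver.solve-∀

  S-odd-support : (∀ t → Φ (1 + t * 8) ≡ Ψ (1 + t * 8)) → S odd Φ ≡ S odd Ψ
  S-odd-support {Φ} {Ψ} eq = S-cong-on λ x → go (half x)
    where
    go : ∀ {x} → Half x → odd x * Φ (x * x) ≡ odd x * Ψ (x * x)
    go (even-form y) rewrite odd-double y = refl
    go (odd-form y) with odd-square y
    ... | t , sq≡ rewrite sq≡ = cong (odd (1 + 2 * y) *_) (eq t)

  S-even-support : (∀ t → Φ (4 * t) ≡ Ψ (4 * t)) → S even± Φ ≡ S even± Ψ
  S-even-support {Φ} {Ψ} eq = S-cong-on λ x → go (half x)
    where
    square-double : ∀ y → 2 * y * (2 * y) ≡ 4 * (y * y)
    square-double = ℕ-Solver.solve-∀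
    go : ∀ {x} → Half x → even± x * Φ (x * x) ≡ even± x * Ψ (x * x)
    go (odd-form y) rewrite odd-double y = refl
    go (even-form y) = cong (even± (2 * y) *_) (begin
      Φ (2 * y * (2 * y))   ≡⟨ cong Φ (square-double y) ⟩
      Φ (4 * (y * y))       ≡⟨ eq (y * y) ⟩
      Ψ (4 * (y * y))       ≡⟨ cong Ψ (square-double y) ⟨
      Ψ (2 * y * (2 * y))   ∎)

  opaque
    unfolding S

    S-halves : ∀ w Φ → (∀ m → B ≤ m → Φ m ≡ 0) →
      S w Φ ≡ S (λ x → w (2 * x)) (λ s → Φ (4 * s)) + ∑ B (λ x → w (1 + 2 * x) * Φ ((1 + 2 * x) * (1 + 2 * x)))
    S-halves w Φ vanish = begin
      ∑ B f                                       ≡⟨ ∑-extend (m≤m+n B (B + 0)) far ⟨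
      ∑ (2 * B) f                                 ≡⟨ ∑-pairs B f ⟩
      ∑ B (λ x → f (2 * x) + f (1 + 2 * x))       ≡⟨ ∑-⊕ B _ _ ⟩
      ∑ B (λ x → f (2 * x)) + ∑ B (λ x → f (1 + 2 * x))
        ≡⟨ cong (_+ ∑ B (λ x → f (1 + 2 * x))) (∑-cong B λ x → cong (λ # → w (2 * x) * Φ #) (square-double x)) ⟩
      S (λ x → w (2 * x)) (λ s → Φ (4 * s)) + ∑ B (λ x → f (1 + 2 * x)) ∎
      where
      f : ℕ → ℕ
      f x = w x * Φ (x * x)
      square-double : ∀ y → 2 * y * (2 * y) ≡ 4 * (y * y)
      square-double = ℕ-Solver.solve-∀
      far : ∀ x → B ≤ x → f x ≡ 0
      far x B≤x = trans (cong (w x *_) (vanish _ (≤-trans B≤x (n≤n*n x)))) (*-zeroʳ (w x))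

    -- An even integer is 2y for an arbitrary integer y. Odd y come in pairs ±y, hence the factor 2;
    -- even y keep their signed weight.
    S-even±-quarter : ∀ Φ → (∀ m → B ≤ m → Φ m ≡ 0) →
      S even± Φ ≡ 2 * S odd (λ s → Φ (4 * s)) + S even± (λ s → Φ (4 * s))
    S-even±-quarter Φ vanish = begin
      S even± Φ                                      ≡⟨ S-halves even± Φ vanish ⟩
      S (λ x → even± (2 * x)) Φ₄ + ∑ B (λ x → even± (1 + 2 * x) * Φ ((1 + 2 * x) * (1 + 2 * x)))
        ≡⟨ cong (_+_ (S (λ x → even± (2 * x)) Φ₄)) (∑-zero B λ x _ → cong (λ # → 2 * # * Φ ((1 + 2 * x) * (1 + 2 * x))) (odd-double x)) ⟩
      S (λ x → even± (2 * x)) Φ₄ + 0                 ≡⟨ +-identityʳ _ ⟩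
      S (λ x → even± (2 * x)) Φ₄                     ≡⟨ ∑-cong B (λ x → trans (cong (_* Φ₄ (x * x)) (weight x)) (split (odd x) (even± x) (Φ₄ (x * x)))) ⟩
      ∑ B (λ x → 2 * (odd x * Φ₄ (x * x)) + even± x * Φ₄ (x * x))   ≡⟨ ∑-⊕ B _ _ ⟩
      ∑ B (λ x → 2 * (odd x * Φ₄ (x * x))) + S even± Φ₄             ≡⟨ cong (_+ S even± Φ₄) (∑-⊛ B 2) ⟩
      2 * S odd Φ₄ + S even± Φ₄                      ∎
      where
      Φ₄ : ℕ → ℕ
      Φ₄ s = Φ (4 * s)
      split : ∀ a b c → (2 * a + b) * c ≡ 2 * (a * c) + b * c
      split = ℕ-Solver.solve-∀
      odd+odd-suc : ∀ x → odd (suc x) + odd x ≡ 1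
      odd+odd-suc 0             = refl
      odd+odd-suc 1             = refl
      odd+odd-suc (suc (suc x)) = odd+odd-suc x
      weight : ∀ x → even± (2 * x) ≡ 2 * odd x + even± x
      weight zero    = refl
      weight (suc x) = begin
        2 * odd (x + suc (x + 0))       ≡⟨ cong (λ # → 2 * odd #) (+-suc x (x + 0)) ⟩
        2 * odd (1 + 2 * x)             ≡⟨ cong (2 *_) (trans (odd-1+double x) (sym (odd+odd-suc x))) ⟩
        2 * (odd (suc x) + odd x)       ≡⟨ *-distribˡ-+ 2 (odd (suc x)) (odd x) ⟩
        2 * odd (suc x) + 2 * odd x     ∎

    -- The map y ↦ 2y sends the odd y injectively to positive integers, and (2y)² = 4y².
    S-odd≤S-positive : ∀ Φ → (∀ m → B ≤ m → Φ m ≡ 0) → S odd (λ s → Φ (4 * s)) ≤ S positive Φ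
    S-odd≤S-positive Φ vanish = ≤-trans
      (∑-mono B λ x _ → *-monoˡ-≤ (Φ (4 * (x * x))) (weight x))
      (≤-trans (m≤m+n _ _) (≤-reflexive (sym (S-halves positive Φ vanish))))
      where
      weight : ∀ x → odd x ≤ positive (2 * x)
      weight 0             = z≤n
      weight 1             = s≤s z≤n
      weight (suc (suc x)) = ≤-trans (odd≤positive x) (≤-trans (positive≤1 x) (s≤s z≤n))

  -- The number of ways to write N − a as an ordered sum of j squares, each square x² weighted by w x.
  representations : (ℕ → ℕ) → ℕ → ℕ → ℕ → ℕ
  representations w zero    N a = [ N ≈ a ]
  representations w (suc j) N a = S w λ s → representations w j N (a + s)

  oddSquares : ℕ → ℕ → ℕ → ℕ
  oddSquares = representations odd

  representations-shift : ∀ w j N a c → representations w j (N + c) (a + c) ≡ representations w j N a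
  representations-shift w zero    N a c = ≈-cong (+-cancelʳ-≡ c N a) (cong (_+ c))
  representations-shift w (suc j) N a c = S-cong λ s →
    trans (cong (representations w j (N + c)) (lemma a c s)) (representations-shift w j N (a + s) c)
    where
    lemma : ∀ a c s → a + c + s ≡ a + s + c
    lemma = ℕ-Solver.solve-∀

  private
    moment : ℕ → ℕ → ℕ → ℕ
    moment zero    N a = 0
    moment (suc j) N a = S odd λ s → s * oddSquares j N (a + s)

    -- The first two squares are exchanged. The factor j on both sides covers j = 0, where there is
    -- no second square.
    moment-suc : ∀ j N a → j * S odd (λ s → moment j N (a + s)) ≡ j * moment (suc j) N a
    moment-suc zero    N a = refl
    moment-suc (suc j) N a = cong (suc j *_) (begin
      S odd (λ s → S odd λ t → t * oddSquares j N (a + s + t))   ≡⟨ S-swap odd odd _ ⟩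
      S odd (λ t → S odd λ s → t * oddSquares j N (a + s + t))
        ≡⟨ S-cong (λ t → trans (S-cong λ s → cong (λ # → t * oddSquares j N #) (lemma a s t)) (S-* odd t _)) ⟩
      S odd (λ t → t * S odd λ s → oddSquares j N (a + t + s))   ∎)
      where
      lemma : ∀ a c s → a + c + s ≡ a + s + c
      lemma = ℕ-Solver.solve-∀

  -- By symmetry each of the j squares contributes the same first moment to the total N − a.
  first-moment : ∀ j N a → N * oddSquares j N a ≡ a * oddSquares j N a + j * moment j N a
  first-moment zero    N a with N ≟ a
  ... | yes refl = sym (+-identityʳ _)
  ... | no  N≢a  rewrite ≈-no N≢a = trans (*-zeroʳ N) (sym (trans (+-identityʳ _) (*-zeroʳ a)))
  first-moment (suc j) N a = begin
    N * S odd R                                            ≡⟨ S-* odd N R ⟨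
    S odd (λ s → N * R s)                                  ≡⟨ S-cong (λ s → first-moment j N (a + s)) ⟩
    S odd (λ s → (a + s) * R s + j * moment j N (a + s))   ≡⟨ S-+ odd _ _ ⟩
    S odd (λ s → (a + s) * R s) + S odd (λ s → j * moment j N (a + s))
      ≡⟨ cong₂ _+_ (trans (S-cong λ s → *-distribʳ-+ (R s) a s) (S-+ odd _ _))
                   (trans (S-* odd j _) (moment-suc j N a)) ⟩
    S odd (λ s → a * R s) + moment (suc j) N a + j * moment (suc j) N a
      ≡⟨ cong (λ # → # + moment (suc j) N a + j * moment (suc j) N a) (S-* odd a R) ⟩
    a * S odd R + moment (suc j) N a + j * moment (suc j) N a   ≡⟨ +-assoc (a * S odd R) _ _ ⟩
    a * S odd R + suc j * moment (suc j) N a               ∎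
    where
    R : ℕ → ℕ
    R s = oddSquares j N (a + s)

  -- The first moment of j + 1 squares with nothing subtracted; j = 4 yields the coefficient in N -
  -- 5x².
  oddSquares-recurrence : ∀ j N → N * S odd (oddSquares j N) ≡ S odd (λ s → suc j * s * oddSquares j N s)
  oddSquares-recurrence j N = begin
    N * S odd (oddSquares j N)                     ≡⟨ first-moment (suc j) N 0 ⟩
    suc j * S odd (λ s → s * oddSquares j N s)     ≡⟨ S-* odd (suc j) _ ⟨
    S odd (λ s → suc j * (s * oddSquares j N s))   ≡⟨ S-cong (λ s → *-assoc (suc j) s _) ⟨
    S odd (λ s → suc j * s * oddSquares j N s)     ∎

  oddSquares-small : ∀ j N a → N < j + a → oddSquares j N a ≡ 0
  oddSquares-small zero    N a N<a = ≈-no (<⇒≢ N<a)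
  oddSquares-small (suc j) N a N<  = trans (S-def odd _) (∑-zero B vanish)
    where
    vanish : ∀ x → x < B → odd x * oddSquares j N (a + x * x) ≡ 0
    vanish zero    _ = refl
    vanish (suc x) _ = trans (cong (odd (suc x) *_) (oddSquares-small j N (a + suc x * suc x)
      (<-≤-trans N< (subst (_≤ j + (a + suc x * suc x)) (lemma j a) (+-monoʳ-≤ j (+-monoʳ-≤ a (s≤s (z≤n {x + x * suc x}))))))))
      (*-zeroʳ (odd (suc x)))
      where
      lemma : ∀ j a → j + (a + 1) ≡ 1 + j + a
      lemma = ℕ-Solver.solve-∀

-- Jacobi's count of four odd squares

oddSquares-minimal : ∀ L j a → Squares.oddSquares (2 + L) j (j + a) a ≡ 1
oddSquares-minimal L zero    a = ≈-yes {a} refl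
oddSquares-minimal L (suc j) a = begin
  S odd g                               ≡⟨ S-def odd g ⟩
  ∑ (2 + L) f                           ≡⟨ ∑-split 2 L f ⟩
  1 * g 1 + ∑ L (λ x → f (2 + x))       ≡⟨ cong₂ _+_ (*-identityˡ (g 1)) (∑-zero L (λ x _ → vanish x)) ⟩
  g 1 + 0                               ≡⟨ +-identityʳ (g 1) ⟩
  g 1                                   ≡⟨ cong (λ # → oddSquares j # (a + 1)) (lemma j a) ⟩
  oddSquares j (j + (a + 1)) (a + 1)    ≡⟨ oddSquares-minimal L j (a + 1) ⟩
  1                                     ∎
  where
  open ≡-Reasoning
  open Squares (2 + L)
  g f : ℕ → ℕ
  g s = oddSquares j (suc j + a) (a + s)
  f x = odd x * g (x * x)
  lemma : ∀ j a → 1 + j + a ≡ j + (a + 1)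
  lemma = ℕ-Solver.solve-∀
  lemma₂ : ∀ j a x → j + (a + (2 + x) * (2 + x)) ≡ 2 + j + a + (2 + 4 * x + x * x)
  lemma₂ = ℕ-Solver.solve-∀
  vanish : ∀ x → f (2 + x) ≡ 0
  vanish x = trans (cong (odd x *_) (oddSquares-small j (suc j + a) (a + (2 + x) * (2 + x))
    (subst (2 + j + a ≤_) (sym (lemma₂ j a x)) (m≤m+n (2 + j + a) _)))) (*-zeroʳ (odd x))

divisorSum-shift : ∀ L N a c → divisorSum L (N + c) (a + c) ≡ divisorSum L N a
divisorSum-shift L N a c = ∑-cong L λ i → ∑-cong L λ j → cong (suc i *_) (≈-cong
  (λ eq → +-cancelʳ-≡ c N _ (trans eq (lemma a c _)))
  (λ eq → trans (cong (_+ c) eq) (sym (lemma a c _))))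
  where
  lemma : ∀ a c s → a + c + s ≡ a + s + c
  lemma = ℕ-Solver.solve-∀

divisorSum-zero : ∀ L N a → (∀ i j → N ≢ a + 4 * (suc i * suc j)) → divisorSum L N a ≡ 0
divisorSum-zero L N a N≢ = ∑-zero L λ i _ → ∑-zero L λ j _ →
  trans (cong (suc i *_) (≈-no (N≢ i j))) (*-zeroʳ (suc i))

divisorSum-4 : ∀ L → divisorSum (suc L) 4 0 ≡ 1
divisorSum-4 L = begin
  ∑ (suc L) (λ i → ∑ (suc L) (t i))                      ≡⟨ ∑-head L _ ⟩
  ∑ (suc L) (t 0) + ∑ L (λ i → ∑ (suc L) (t (suc i)))    ≡⟨ cong₂ _+_ (∑-head L (t 0))
                                                              (∑-zero L λ i _ → ∑-zero (suc L) λ j _ → off (suc i) j (s≤s z≤n)) ⟩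
  t 0 0 + ∑ L (λ j → t 0 (suc j)) + 0                    ≡⟨ +-identityʳ _ ⟩
  t 0 0 + ∑ L (λ j → t 0 (suc j))                        ≡⟨ cong (λ # → 1 * # + ∑ L (λ j → t 0 (suc j))) (≈-yes refl) ⟩
  1 + ∑ L (λ j → t 0 (suc j))                            ≡⟨ cong (_+_ 1) (∑-zero L λ j _ → off 0 (suc j) (s≤s z≤n)) ⟩
  1                                                      ∎
  where
  open ≡-Reasoning
  t : ℕ → ℕ → ℕ
  t i j = suc i * [ 4 ≈ 4 * (suc i * suc j) ]
  off : ∀ i j → 1 ≤ i + j → t i j ≡ 0
  off i j 1≤i+j = trans (cong (suc i *_) (≈-no λ eq → <⇒≢ (lt i j 1≤i+j) (*-cancelˡ-≡ 1 _ 4 eq))) (*-zeroʳ (suc i))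
    where
    lt : ∀ i j → 1 ≤ i + j → 1 < suc i * suc j
    lt i j 1≤ = subst (1 <_) (lemma i j) (s≤s (≤-trans 1≤ (m≤m+n (i + j) (i * j))))
      where
      lemma : ∀ i j → suc (i + j + i * j) ≡ suc i * suc j
      lemma = ℕ-Solver.solve-∀

-- The recurrence Σ (N − 5x²) F(N − x²) = 0 over odd x, where N = 4k + 1, determines F(N − 1).
module FourOddSquares (L : ℕ) where
  open Squares (suc L)
  open ≡-Reasoning

  private
    -- Even x contribute nothing to the divisor sum, since x² + 4de would then be divisible by 4. So
    -- the sum over all x is the sum over odd x.
    weighted-odd : ∀ N M → N ≡ 5 + M * 8 → ∀ x → odd x * divisorSum L N (x * x) ≡ divisorSum L N (x * x)
    weighted-odd N M N≡ x with half x
    ... | odd-form y rewrite odd-1+double y = +-identityʳ _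
    ... | even-form y rewrite odd-double y = sym (divisorSum-zero L N (2 * y * (2 * y)) λ i j eq →
      4*≢5+8m (y * y + suc i * suc j) M (trans (trans (lemma y (suc i * suc j)) (sym eq)) N≡))
      where
      lemma : ∀ y d → 4 * (y * y + d) ≡ 2 * y * (2 * y) + 4 * d
      lemma = ℕ-Solver.solve-∀

    -- The term r = 0 is x = 1. Once its share 5 · f 0 is moved across, it has the coefficient N - 5
    -- = suc c > 0, while everything else is common to f and g.
    determined : ∀ {L} → 1 ≤ L → ∀ N {f g h : ℕ → ℕ} (c : ℕ) → N ≡ 6 + c → h 0 ≡ 5 →
      N * ∑ L f ≡ ∑ L (λ r → h r * f r) →
      N * ∑ L g ≡ ∑ L (λ r → h r * g r) →
      (∀ r → f (suc r) ≡ g (suc r)) → f 0 ≡ g 0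
    determined {suc L} _ N {f} {g} {h} c refl h0 F G eq = *-cancelˡ-≡ (f 0) (g 0) (suc c) (+-cancelʳ-≡ rest _ _ (begin
      suc c * f 0 + rest     ≡⟨ isolate f F ⟩
      rest′                  ≡⟨ ∑-cong L (λ r → cong (h (suc r) *_) (eq r)) ⟩
      ∑ L (λ r → h (suc r) * g (suc r))            ≡⟨ isolate g G ⟨
      suc c * g 0 + N * ∑ L (g ∘ suc)              ≡⟨ cong (λ # → suc c * g 0 + N * #) (∑-cong L λ r → sym (eq r)) ⟩
      suc c * g 0 + rest     ∎))
      where
      rest rest′ : ℕ
      rest  = N * ∑ L (f ∘ suc)
      rest′ = ∑ L (λ r → h (suc r) * f (suc r))
      expand : ∀ c a b → 5 * a + (suc c * a + (6 + c) * b) ≡ (6 + c) * (a + b)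
      expand = ℕ-Solver.solve-∀
      isolate : ∀ f → N * ∑ (suc L) f ≡ ∑ (suc L) (λ r → h r * f r) →
        suc c * f 0 + N * ∑ L (f ∘ suc) ≡ ∑ L (λ r → h (suc r) * f (suc r))
      isolate f F = +-cancelˡ-≡ (5 * f 0) _ _ (begin
        5 * f 0 + (suc c * f 0 + N * ∑ L (f ∘ suc))   ≡⟨ expand c (f 0) (∑ L (f ∘ suc)) ⟩
        N * (f 0 + ∑ L (f ∘ suc))                     ≡⟨ cong (N *_) (∑-head L f) ⟨
        N * ∑ (suc L) f                               ≡⟨ F ⟩
        ∑ (suc L) (λ r → h r * f r)                   ≡⟨ ∑-head L _ ⟩
        h 0 * f 0 + ∑ L (λ r → h (suc r) * f (suc r)) ≡⟨ cong (λ # → # * f 0 + ∑ L (λ r → h (suc r) * f (suc r))) h0 ⟩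
        5 * f 0 + ∑ L (λ r → h (suc r) * f (suc r))   ∎)

  -- Strong induction on n in which `m` is the bound that decreases, while L stays fixed. An odd x >
  -- 1 has x² = 1 + 8(t + 1), so N - x² is either 4 + 8(n - t), a smaller instance, or negative,
  -- where both counts are 0.
  fourOddSquares≡divisorSum : ∀ m → 3 * (5 + m * 8) ≤ L → ∀ {n} → n ≤ m →
    oddSquares 4 (4 + n * 8) 0 ≡ divisorSum L (4 + n * 8) 0
  fourOddSquares≡divisorSum m bound {zero} n≤m = go L bound
    where
    go : ∀ L → 3 * (5 + m * 8) ≤ L → Squares.oddSquares (suc L) 4 4 0 ≡ divisorSum L 4 0
    go (suc L) _ = trans (oddSquares-minimal L 4 0) (sym (divisorSum-4 L))
  fourOddSquares≡divisorSum m@(suc m′) bound {suc n} (s≤s n≤m′) = begin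
    oddSquares 4 (4 + suc n * 8) 0        ≡⟨ representations-shift odd 4 (4 + suc n * 8) 0 1 ⟨
    oddSquares 4 (4 + suc n * 8 + 1) 1    ≡⟨ cong (λ # → oddSquares 4 # 1) (+-comm (4 + suc n * 8) 1) ⟩
    oddSquares 4 N 1                      ≡⟨ +-identityʳ _ ⟨
    f 0                                   ≡⟨ determined {L} (≤-trans (s≤s z≤n) 3N≤L) N {f} {g} {h} (7 + n * 8) refl refl F G agree ⟩
    g 0                                   ≡⟨ +-identityʳ _ ⟩
    divisorSum L N 1                      ≡⟨ cong (λ # → divisorSum L # 1) (+-comm 1 (4 + suc n * 8)) ⟩
    divisorSum L (4 + suc n * 8 + 1) 1    ≡⟨ divisorSum-shift L (4 + suc n * 8) 0 1 ⟩
    divisorSum L (4 + suc n * 8) 0        ∎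
    where
    N : ℕ
    N = 5 + suc n * 8
    3N≤L : 3 * N ≤ L
    3N≤L = ≤-trans (*-monoʳ-≤ 3 (+-monoʳ-≤ 5 (*-monoˡ-≤ 8 (s≤s n≤m′)))) bound
    f g h : ℕ → ℕ
    f r = odd (suc r) * oddSquares 4 N (suc r * suc r)
    g r = odd (suc r) * divisorSum L N (suc r * suc r)
    h r = 5 * (suc r * suc r)

    S-suc : ∀ Ψ → S odd Ψ ≡ ∑ L (λ r → odd (suc r) * Ψ (suc r * suc r))
    S-suc Ψ = trans (S-def odd Ψ) (∑-head L _)

    F : N * ∑ L f ≡ ∑ L (λ r → h r * f r)
    F = begin
      N * ∑ L f                                      ≡⟨ cong (N *_) (S-suc (oddSquares 4 N)) ⟨
      N * S odd (oddSquares 4 N)                     ≡⟨ oddSquares-recurrence 4 N ⟩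
      S odd (λ s → 5 * s * oddSquares 4 N s)         ≡⟨ S-suc _ ⟩
      ∑ L (λ r → odd (suc r) * (h r * oddSquares 4 N (suc r * suc r)))
        ≡⟨ ∑-cong L (λ r → *-rotate (odd (suc r)) (h r) _) ⟩
      ∑ L (λ r → h r * f r)                          ∎
      where
      *-rotate : ∀ a b c → a * (b * c) ≡ b * (a * c)
      *-rotate = ℕ-Solver.solve-∀

    G : N * ∑ L g ≡ ∑ L (λ r → h r * g r)
    G = begin
      N * ∑ L g       ≡⟨ cong (N *_) (∑-cong L (λ r → weighted-odd N (suc n) refl (suc r))) ⟩
      N * ∑ L (λ r → divisorSum L N (suc r * suc r))   ≡⟨ FormSum.divisor-recurrence N (suc n) L refl 3N≤L ⟩
      ∑ L (λ r → h r * divisorSum L N (suc r * suc r)) ≡⟨ ∑-cong L (λ r → cong (h r *_) (weighted-odd N (suc n) refl (suc r))) ⟨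
      ∑ L (λ r → h r * g r) ∎

    agree : ∀ r → f (suc r) ≡ g (suc r)
    agree r = go (half (2 + r)) (s≤s (s≤s z≤n))
      where
      go : ∀ {x} → Half x → 2 ≤ x → odd x * oddSquares 4 N (x * x) ≡ odd x * divisorSum L N (x * x)
      go (even-form y) _ rewrite odd-double y = refl
      go (odd-form y) 2≤x with odd-square y
      ... | zero  , sq≡ = contradiction (≤-trans (*-mono-≤ 2≤x 2≤x) (≤-reflexive sq≡)) λ { (s≤s ()) }
      ... | suc t , sq≡ = cong (odd (1 + 2 * y) *_) (subst (λ s → oddSquares 4 N s ≡ divisorSum L N s) (sym sq≡) at)
        where
        split : ∀ t q → 5 + suc (t + q) * 8 ≡ 4 + q * 8 + (1 + suc t * 8)
        split = ℕ-Solver.solve-∀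
        at : oddSquares 4 N (1 + suc t * 8) ≡ divisorSum L N (1 + suc t * 8)
        at with t ≤? n
        ... | yes t≤n = begin
          oddSquares 4 N s               ≡⟨ cong (λ # → oddSquares 4 # s) N≡ ⟩
          oddSquares 4 (4 + q * 8 + s) s ≡⟨ representations-shift odd 4 (4 + q * 8) 0 s ⟩
          oddSquares 4 (4 + q * 8) 0
            ≡⟨ fourOddSquares≡divisorSum m′ (≤-trans (*-monoʳ-≤ 3 (+-monoʳ-≤ 5 (*-monoˡ-≤ 8 (n≤1+n m′)))) bound)
                 (≤-trans (m∸n≤m n t) n≤m′) ⟩
          divisorSum L (4 + q * 8) 0     ≡⟨ divisorSum-shift L (4 + q * 8) 0 s ⟨
          divisorSum L (4 + q * 8 + s) s ≡⟨ cong (λ # → divisorSum L # s) N≡ ⟨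
          divisorSum L N s               ∎
          where
          q s : ℕ
          q = n ∸ t
          s = 1 + suc t * 8
          N≡ : N ≡ 4 + q * 8 + s
          N≡ = trans (cong (λ # → 5 + suc # * 8) (sym (m+[n∸m]≡n t≤n))) (split t q)
        ... | no t≰n = trans (oddSquares-small 4 N _ (≤-trans N<s (m≤n+m _ 4)))
          (sym (divisorSum-zero L N (1 + suc t * 8) λ i j → <⇒≢ (<-≤-trans N<s (m≤m+n _ _))))
          where
          N<s : N < 1 + suc t * 8
          N<s = ≤-trans (+-monoˡ-≤ (suc n * 8) (m≤m+n 6 3)) (+-monoʳ-≤ 1 (*-monoˡ-≤ 8 (s≤s (≰⇒> t≰n))))

  -- σ(k) ≥ k for k = 1 + 2m: only the divisor k itself is kept, the term i = 2m, j = 0.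
  fourOddSquares-≥ : ∀ m → 3 * (5 + m * 8) ≤ L → 1 + 2 * m ≤ oddSquares 4 (4 + m * 8) 0
  fourOddSquares-≥ m bound = subst (1 + 2 * m ≤_) (sym (fourOddSquares≡divisorSum m bound ≤-refl))
    (≤-trans (≤-reflexive (sym (trans (cong (suc (2 * m) *_) (≈-yes (lemma m))) (*-identityʳ _))))
      (≤-trans (∑-term (λ j → suc (2 * m) * [ 4 + m * 8 ≈ 4 * (suc (2 * m) * suc j) ]) (≤-trans (s≤s z≤n) k≤L))
        (∑-term (λ i → ∑ L λ j → suc i * [ 4 + m * 8 ≈ 4 * (suc i * suc j) ]) k≤L)))
    where
    lemma : ∀ m → 4 + m * 8 ≡ 4 * (suc (2 * m) * 1)
    lemma = ℕ-Solver.solve-∀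
    split : ∀ m → 3 * (5 + m * 8) ≡ 1 + 2 * m + (14 + 22 * m)
    split = ℕ-Solver.solve-∀
    k≤L : 1 + 2 * m ≤ L
    k≤L = ≤-trans (≤-trans (m≤m+n (1 + 2 * m) _) (≤-reflexive (sym (split m)))) bound

-- Double sums split along the diagonal

∑-shift : ∀ n {f : ℕ → ℕ} → f 0 ≡ 0 → f n ≡ 0 → ∑ n f ≡ ∑ n (f ∘ suc)
∑-shift n {f} f0 fn = begin
  ∑ n f                  ≡⟨ +-identityʳ _ ⟨
  ∑ n f + 0              ≡⟨ cong (_+_ (∑ n f)) fn ⟨
  ∑ (suc n) f            ≡⟨ ∑-head n f ⟩
  f 0 + ∑ n (f ∘ suc)    ≡⟨ cong (_+ ∑ n (f ∘ suc)) f0 ⟩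
  ∑ n (f ∘ suc)          ∎
  where open ≡-Reasoning

module _ where
  open ≡-Reasoning

  ∑-triangles : ∀ n (f : ℕ → ℕ → ℕ) →
    ∑ n (λ x → ∑ n (f x)) ≡ ∑ n (λ x → f x x) + ∑ n (λ x → ∑ x (λ y → f x y + f y x))
  ∑-triangles zero    f = refl
  ∑-triangles (suc n) f = begin
    ∑ n (λ x → ∑ n (f x) + f x n) + (∑ n (f n) + f n n)
      ≡⟨ cong (_+ (∑ n (f n) + f n n)) (trans (∑-⊕ n _ _) (cong (_+ ∑ n (λ x → f x n)) (∑-triangles n f))) ⟩
    D + E + ∑ n (λ x → f x n) + (∑ n (f n) + f n n)   ≡⟨ regroup D E (∑ n (λ x → f x n)) (∑ n (f n)) (f n n) ⟩
    D + f n n + (E + (∑ n (f n) + ∑ n (λ x → f x n))) ≡⟨ cong (λ # → D + f n n + (E + #)) (∑-⊕ n _ _) ⟨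
    D + f n n + (E + ∑ n (λ y → f n y + f y n))       ∎
    where
    D E : ℕ
    D = ∑ n (λ x → f x x)
    E = ∑ n (λ x → ∑ x (λ y → f x y + f y x))
    regroup : ∀ a b c d e → a + b + c + (d + e) ≡ a + e + (b + (d + c))
    regroup = ℕ-Solver.solve-∀

  below : ℕ → ℕ → ℕ
  below _       zero    = 0
  below zero    (suc _) = 1
  below (suc y) (suc x) = below y x

  below-< : ∀ {y x} → y < x → below y x ≡ 1
  below-< {zero}  {suc x} _         = refl
  below-< {suc y} {suc x} (s≤s y<x) = below-< y<x

  below-≥ : ∀ {y x} → x ≤ y → below y x ≡ 0
  below-≥ {y}     {zero}  _         = refl
  below-≥ {suc y} {suc x} (s≤s x≤y) = below-≥ x≤y

  triangle-by-gap : ∀ n (g : ℕ → ℕ → ℕ) → (∀ x y → n ≤ x → g x y ≡ 0) →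
    ∑ n (λ x → ∑ x (g x)) ≡ ∑ n (λ y → ∑ n (λ k → g (suc (y + k)) y))
  triangle-by-gap n g vanish = begin
    ∑ n (λ x → ∑ x (g x))                       ≡⟨ ∑-cong-< n row ⟩
    ∑ n (λ x → ∑ n (λ y → below y x * g x y))   ≡⟨ ∑-swap n n _ ⟩
    ∑ n (λ y → ∑ n (λ x → below y x * g x y))   ≡⟨ ∑-cong n column ⟩
    ∑ n (λ y → ∑ n (λ k → g (suc (y + k)) y))   ∎
    where
    row : ∀ x → x < n → ∑ x (g x) ≡ ∑ n (λ y → below y x * g x y)
    row x x<n = begin
      ∑ x (g x)                        ≡⟨ ∑-cong-< x (λ y y<x → trans (sym (+-identityʳ _)) (cong (_* g x y) (sym (below-< y<x)))) ⟩
      ∑ x (λ y → below y x * g x y)    ≡⟨ ∑-extend (<⇒≤ x<n) (λ y x≤y → cong (_* g x y) (below-≥ x≤y)) ⟨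
      ∑ n (λ y → below y x * g x y)    ∎
    column : ∀ y → ∑ n (λ x → below y x * g x y) ≡ ∑ n (λ k → g (suc (y + k)) y)
    column y = begin
      ∑ n h                                     ≡⟨ ∑-extend (m≤n+m n (suc y)) (λ x n≤x → trans (cong (below y x *_) (vanish x y n≤x)) (*-zeroʳ (below y x))) ⟨
      ∑ (suc y + n) h                           ≡⟨ ∑-split (suc y) n h ⟩
      ∑ (suc y) h + ∑ n (λ k → h (suc y + k))
        ≡⟨ cong₂ _+_ (∑-zero (suc y) λ x x≤y → cong (_* g x y) (below-≥ (s≤s⁻¹ x≤y)))
                     (∑-cong n λ k → trans (cong (_* g (suc (y + k)) y) (below-< (s≤s (m≤m+n y k)))) (+-identityʳ _)) ⟩
      ∑ n (λ k → g (suc (y + k)) y)             ∎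
      where
      h : ℕ → ℕ
      h x = below y x * g x y

  -- Off the diagonal a pair is given by its smaller entry y and its gap k + 1. As f vanishes
  -- outside the square, k may run over a range independent of y.
  ∑-by-gap : ∀ n (f : ℕ → ℕ → ℕ) → (∀ x y → n ≤ x → f x y ≡ 0) → (∀ x y → n ≤ y → f x y ≡ 0) →
    ∑ n (λ x → ∑ n (f x)) ≡ ∑ n (λ x → f x x) + ∑ n (λ y → ∑ n (λ k → f (suc (y + k)) y + f y (suc (y + k))))
  ∑-by-gap n f vanishˡ vanishʳ = trans (∑-triangles n f) (cong (_+_ (∑ n (λ x → f x x)))
    (triangle-by-gap n (λ x y → f x y + f y x) λ x y n≤x → cong₂ _+_ (vanishˡ x y n≤x) (vanishʳ y x n≤x)))

-- Sums of two odd squares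

odd-+double : ∀ y v → odd (y + 2 * v) ≡ odd y
odd-+double y zero    = cong odd (+-identityʳ y)
odd-+double y (suc v) = trans (cong odd (lemma y v)) (odd-+double y v)
  where
  lemma : ∀ y v → y + 2 * suc v ≡ suc (suc (y + 2 * v))
  lemma = ℕ-Solver.solve-∀

odd*odd : ∀ y → odd y * odd y ≡ odd y
odd*odd 0             = refl
odd*odd 1             = refl
odd*odd (suc (suc y)) = odd*odd y

odd*odd-suc : ∀ n → odd (suc n) * odd n ≡ 0
odd*odd-suc 0             = refl
odd*odd-suc 1             = refl
odd*odd-suc (suc (suc n)) = odd*odd-suc n

-- Since `even⁺ (suc v)` is `odd v`, this says that v + 1 and v + 1 + y have opposite parity exactly
-- when y is odd.
odd-+ : ∀ v y → odd (suc v + y) * odd v + odd (suc v) * odd (v + y) ≡ odd y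
odd-+ 0             y = trans (cong (_+ (odd y + 0)) (*-zeroʳ (odd (suc y)))) (+-identityʳ (odd y))
odd-+ 1             y = trans (+-identityʳ _) (*-identityʳ (odd y))
odd-+ (suc (suc v)) y = odd-+ v y

module PairOfOdds (B : ℕ) where
  open Squares B
  open ≡-Reasoning

  S² : (ℕ → ℕ) → (ℕ → ℕ) → (ℕ → ℕ) → ℕ
  S² w v Ψ = S w λ s → S v λ t → Ψ (s + t)

  private
    S²-def : ∀ w v Ψ → S² w v Ψ ≡ ∑ B (λ x → ∑ B (λ y → w x * v y * Ψ (x * x + y * y)))
    S²-def w v Ψ = trans (S-def w _) (∑-cong B λ x → begin
      w x * S v (λ t → Ψ (x * x + t))                 ≡⟨ cong (w x *_) (S-def v _) ⟩
      w x * ∑ B (λ y → v y * Ψ (x * x + y * y))       ≡⟨ ∑-⊛ B (w x) ⟨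
      ∑ B (λ y → w x * (v y * Ψ (x * x + y * y)))     ≡⟨ ∑-cong B (λ y → *-assoc (w x) (v y) _) ⟨
      ∑ B (λ y → w x * v y * Ψ (x * x + y * y))       ∎)


  -- (x, y) = (a + e, |a − e|) up to order, with a odd and e even of either sign.
  pair-of-odds : ∀ Ψ → (∀ m → B ≤ m → Ψ m ≡ 0) → S² odd odd Ψ ≡ S² odd even± (λ m → Ψ (2 * m))
  pair-of-odds Ψ vanish = begin
    S² odd odd Ψ                                                   ≡⟨ S²-def odd odd Ψ ⟩
    ∑ B (λ x → ∑ B (f x))                                          ≡⟨ ∑-by-gap B f (λ x y → f-far x y ∘ farˡ x y)
                                                                        (λ x y → f-far x y ∘ farʳ x y) ⟩
    ∑ B (λ x → f x x) + ∑ B (λ y → ∑ B (λ k → f (suc (y + k)) y + f y (suc (y + k))))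
      ≡⟨ cong₂ _+_ (∑-cong B diagonal) (trans (∑-cong B gaps) (∑-⊛ B 2)) ⟩
    Z + 2 * ∑ B (λ y → ∑ B (λ v → F y (suc v)))                    ≡⟨ cong (λ # → Z + 2 * #) reindex ⟩
    Z + 2 * ∑ B (λ x → ∑ B (g x))                                  ≡⟨ cong (_+_ Z) (trans (∑-cong B λ x → ∑-⊛ B 2) (∑-⊛ B 2)) ⟨
    Z + ∑ B (λ x → ∑ B (λ y → 2 * g x y))                          ≡⟨ ∑-⊕ B _ _ ⟨
    ∑ B (λ x → odd x * Ψ (2 * (x * x + 0)) + ∑ B (λ y → 2 * g x y))   ≡⟨ ∑-cong-< B collect ⟩
    ∑ B (λ x → ∑ B (λ y → odd x * even± y * Ψ (2 * (x * x + y * y)))) ≡⟨ S²-def odd even± (λ m → Ψ (2 * m)) ⟨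
    S² odd even± (λ m → Ψ (2 * m))                                 ∎
    where
    f g F : ℕ → ℕ → ℕ
    f x y = odd x * odd y * Ψ (x * x + y * y)
    g x y = odd x * even⁺ y * Ψ (2 * (x * x + y * y))
    -- y is the smaller odd number and 2a the gap; (y + 2a)² + y² = 2((y + a)² + a²).
    F y a = odd y * Ψ ((y + 2 * a) * (y + 2 * a) + y * y)
    -- Z is the diagonal x = y on the left and the case e = 0 on the right. Elsewhere a factor 2
    -- stands for the order of (x, y) on the left and for the sign of e on the right.
    Z : ℕ
    Z = ∑ B (λ x → odd x * Ψ (2 * (x * x + 0)))

    zero-at : ∀ c m → B ≤ m → c * Ψ m ≡ 0
    zero-at c m B≤m = trans (cong (c *_) (vanish m B≤m)) (*-zeroʳ c)

    f-far : ∀ x y → B ≤ x * x + y * y → f x y ≡ 0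
    f-far x y = zero-at (odd x * odd y) (x * x + y * y)

    g-far : ∀ x y → B ≤ x * x + y * y → g x y ≡ 0
    g-far x y B≤ = zero-at (odd x * even⁺ y) (2 * (x * x + y * y)) (≤-trans B≤ (m≤m+n _ _))

    farˡ : ∀ x y → B ≤ x → B ≤ x * x + y * y
    farˡ x y B≤x = ≤-trans B≤x (≤-trans (n≤n*n x) (m≤m+n _ _))

    farʳ : ∀ x y → B ≤ y → B ≤ x * x + y * y
    farʳ x y B≤y = ≤-trans B≤y (≤-trans (n≤n*n y) (m≤n+m _ _))

    diagonal : ∀ x → f x x ≡ odd x * Ψ (2 * (x * x + 0))
    diagonal x = cong₂ (λ u v → u * Ψ v) (odd*odd x) (lemma (x * x))
      where
      lemma : ∀ s → s + s ≡ 2 * (s + 0)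
      lemma = ℕ-Solver.solve-∀

    gaps : ∀ y → ∑ B (λ k → f (suc (y + k)) y + f y (suc (y + k))) ≡ 2 * ∑ B (λ v → F y (suc v))
    gaps y = begin
      ∑ B h                                          ≡⟨ ∑-extend (m≤m+n B (B + 0)) far ⟨
      ∑ (2 * B) h                                    ≡⟨ ∑-pairs B h ⟩
      ∑ B (λ v → h (2 * v) + h (1 + 2 * v))          ≡⟨ ∑-cong B (λ v → cong₂ _+_ (even-gap v) (odd-gap v)) ⟩
      ∑ B (λ v → 2 * F y (suc v))                    ≡⟨ ∑-⊛ B 2 ⟩
      2 * ∑ B (λ v → F y (suc v))                    ∎
      where
      h : ℕ → ℕ
      h k = f (suc (y + k)) y + f y (suc (y + k))
      lemma : ∀ y v → suc (y + suc (2 * v)) ≡ y + 2 * suc v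
      lemma = ℕ-Solver.solve-∀
      big : ∀ k → B ≤ k → B ≤ suc (y + k)
      big k B≤k = ≤-trans B≤k (≤-trans (m≤n+m k y) (n≤1+n _))
      far : ∀ k → B ≤ k → h k ≡ 0
      far k B≤k = cong₂ _+_ (f-far (suc (y + k)) y (farˡ (suc (y + k)) y (big k B≤k))) (f-far y (suc (y + k)) (farʳ y (suc (y + k)) (big k B≤k)))
      even-gap : ∀ v → h (2 * v) ≡ 0
      even-gap v rewrite odd-+double (suc y) v | odd*odd-suc y | *-comm (odd y) (odd (suc y)) | odd*odd-suc y = refl
      odd-gap : ∀ v → h (1 + 2 * v) ≡ 2 * F y (suc v)
      odd-gap v = trans (cong (λ # → f # y + f y #) (lemma y v)) (cong₂ _+_
        (cong (_* Ψ (x * x + y * y)) (trans (cong (_* odd y) (odd-+double y (suc v))) (odd*odd y)))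
        (trans (cong₂ (λ u m → u * Ψ m) (trans (cong (odd y *_) (odd-+double y (suc v))) (odd*odd y)) (+-comm (y * y) (x * x)))
          (sym (+-identityʳ _))))
        where
        x : ℕ
        x = y + 2 * suc v

    at-zero : ∀ n (h : ℕ → ℕ) → 0 < n → ∑ n (λ y → isZero y * h y) ≡ h 0
    at-zero (suc n) h _ = begin
      ∑ (suc n) (λ y → isZero y * h y)   ≡⟨ ∑-head n _ ⟩
      h 0 + 0 + ∑ n (λ _ → 0)            ≡⟨ cong₂ _+_ (+-identityʳ (h 0)) (∑-zero n λ _ _ → refl) ⟩
      h 0 + 0                            ≡⟨ +-identityʳ (h 0) ⟩
      h 0                                ∎

    collect : ∀ x → x < B → odd x * Ψ (2 * (x * x + 0)) + ∑ B (λ y → 2 * g x y)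
                          ≡ ∑ B (λ y → odd x * even± y * Ψ (2 * (x * x + y * y)))
    collect x x<B = begin
      odd x * Ψ (2 * (x * x + 0)) + ∑ B (λ y → 2 * g x y)
        ≡⟨ cong (_+ ∑ B (λ y → 2 * g x y)) (at-zero B (λ y → odd x * Ψ (2 * (x * x + y * y))) (≤-trans (s≤s z≤n) x<B)) ⟨
      ∑ B (λ y → isZero y * (odd x * Ψ (2 * (x * x + y * y)))) + ∑ B (λ y → 2 * g x y)
        ≡⟨ ∑-⊕ B _ _ ⟨
      ∑ B (λ y → isZero y * (odd x * Ψ (2 * (x * x + y * y))) + 2 * g x y)
        ≡⟨ ∑-cong B (λ y → split (isZero y) (even⁺ y) (odd x) (Ψ (2 * (x * x + y * y)))) ⟩
      ∑ B (λ y → odd x * even± y * Ψ (2 * (x * x + y * y))) ∎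
      where
      split : ∀ z e o p → z * (o * p) + 2 * (o * e * p) ≡ o * (z + 2 * e) * p
      split = ℕ-Solver.solve-∀

    -- The pair (y + a, a) has gap y. For odd y exactly one of its entries is odd, so both orders of
    -- the pair together meet the weights of `g` exactly once.
    reindex : ∑ B (λ y → ∑ B (λ v → F y (suc v))) ≡ ∑ B (λ x → ∑ B (g x))
    reindex = begin
      ∑ B (λ y → ∑ B (λ v → F y (suc v)))              ≡⟨ ∑-shift B (∑-zero B λ _ _ → refl) (∑-zero B λ v _ → zero-at (odd B) _ (farʳ (B + 2 * suc v) B ≤-refl)) ⟩
      ∑ B (λ k → ∑ B (λ v → F (suc k) (suc v)))        ≡⟨ ∑-swap B B _ ⟩
      ∑ B (λ v → ∑ B (λ k → F (suc k) (suc v)))        ≡⟨ ∑-cong B (λ v → ∑-cong B λ k → weights v k) ⟩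
      ∑ B (λ v → G (suc v))                            ≡⟨ ∑-shift B (∑-zero B λ k _ → cong (_+ 0) (cong (_* Ψ (2 * (suc k * suc k + 0))) (*-zeroʳ (odd (suc k)))))
                                                            (∑-zero B λ k _ → cong₂ _+_ (g-far (suc (B + k)) B (farʳ (suc (B + k)) B ≤-refl)) (g-far B (suc (B + k)) (farˡ B (suc (B + k)) ≤-refl))) ⟨
      ∑ B G                                            ≡⟨ cong (_+ ∑ B G) (∑-zero B λ x _ → no-diagonal x) ⟨
      ∑ B (λ x → g x x) + ∑ B G                        ≡⟨ ∑-by-gap B g (λ x y → g-far x y ∘ farˡ x y)
                                                            (λ x y → g-far x y ∘ farʳ x y) ⟨
      ∑ B (λ x → ∑ B (g x))                            ∎
      where
      G : ℕ → ℕ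
      G a = ∑ B (λ k → g (suc (a + k)) a + g a (suc (a + k)))
      no-diagonal : ∀ x → g x x ≡ 0
      no-diagonal zero    = refl
      no-diagonal (suc x) = cong (_* Ψ (2 * (suc x * suc x + suc x * suc x))) (odd*odd-suc x)
      weights : ∀ v k → F (suc k) (suc v) ≡ g (suc (suc v + k)) (suc v) + g (suc v) (suc (suc v + k))
      weights v k = begin
        odd (suc k) * Ψ m
          ≡⟨ cong (_* Ψ m) (odd-+ v (suc k)) ⟨
        (odd (suc v + suc k) * odd v + odd (suc v) * odd (v + suc k)) * Ψ m
          ≡⟨ *-distribʳ-+ (Ψ m) (odd (suc v + suc k) * odd v) _ ⟩
        odd (suc v + suc k) * odd v * Ψ m + odd (suc v) * odd (v + suc k) * Ψ m
          ≡⟨ cong₂ (λ u w → odd (suc u) * odd v * Ψ m + odd (suc v) * odd u * Ψ w) (+-suc v k) refl ⟩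
        odd (suc (suc v + k)) * odd v * Ψ m + odd (suc v) * odd (suc v + k) * Ψ m
          ≡⟨ cong₂ (λ u w → odd (suc (suc v + k)) * odd v * Ψ u + odd (suc v) * odd (suc v + k) * Ψ w) (sq v k) (sq′ v k) ⟩
        g (suc (suc v + k)) (suc v) + g (suc v) (suc (suc v + k)) ∎
        where
        m : ℕ
        m = (suc k + 2 * suc v) * (suc k + 2 * suc v) + suc k * suc k
        sq : ∀ v k → (suc k + 2 * suc v) * (suc k + 2 * suc v) + suc k * suc k
                   ≡ 2 * (suc (suc v + k) * suc (suc v + k) + suc v * suc v)
        sq = ℕ-Solver.solve-∀
        sq′ : ∀ v k → (suc k + 2 * suc v) * (suc k + 2 * suc v) + suc k * suc k
                   ≡ 2 * (suc v * suc v + suc (suc v + k) * suc (suc v + k))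
        sq′ = ℕ-Solver.solve-∀

-- Four squares of prescribed parities

mod-8 : ∀ r r′ a b → r + a * 8 ≡ r′ + b * 8 → r % 8 ≡ r′ % 8
mod-8 r r′ a b eq = trans (sym ([m+kn]%n≡m%n r a 8)) (trans (cong (_% 8) eq) ([m+kn]%n≡m%n r′ b 8))

module FourSquares (L : ℕ) where
  open Squares (suc L)
  open PairOfOdds (suc L)
  open FourOddSquares L
  open ≡-Reasoning

  private variable
    w v : ℕ → ℕ

  beyond : ∀ {N} m → N ≤ L → suc L ≤ m → [ N ≈ m ] ≡ 0
  beyond m N≤L L<m = ≈-no (<⇒≢ (≤-<-trans N≤L L<m))

  S²-cong : ∀ {Φ Ψ} → (∀ m → Φ m ≡ Ψ m) → S² w v Φ ≡ S² w v Ψ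
  S²-cong eq = S-cong λ s → S-cong λ t → eq (s + t)

  S²-zero : ∀ w v {Φ} → (∀ m → Φ m ≡ 0) → S² w v Φ ≡ 0
  S²-zero w v eq = S-zero w λ s → S-zero v λ t → eq (s + t)

  S²-* : ∀ w v c Φ → S² w v (λ m → c * Φ m) ≡ c * S² w v Φ
  S²-* w v c Φ = trans (S-cong λ s → S-* v c _) (S-* w c _)

  S²-comm : ∀ w v Ψ → S² w v Ψ ≡ S² v w Ψ
  S²-comm w v Ψ = trans (S-swap w v _) (S-cong λ t → S-cong λ s → cong Ψ (+-comm s t))

  -- Each of the two pairs of odd squares becomes twice the sum of an odd and a signed even square;
  -- then the common factor 2 is cancelled.
  fourOddSquares-halve : ∀ K → 4 * K ≤ L →
    oddSquares 4 (4 * K) 0 ≡ S² odd odd λ m → S² even± even± λ m′ → [ 2 * K ≈ m + m′ ]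
  fourOddSquares-halve K 4K≤L = begin
    oddSquares 4 (4 * K) 0
      ≡⟨ S-cong (λ s → S-cong λ t → S-cong λ u → S-cong λ v → cong [ 4 * K ≈_] (+-assoc (s + t) u v)) ⟩
    S² odd odd (λ m → S² odd odd λ m′ → [ 4 * K ≈ m + m′ ])
      ≡⟨ S²-cong (λ m → pair-of-odds _ λ m′ B≤m′ → beyond (m + m′) 4K≤L (≤-trans B≤m′ (m≤n+m m′ m))) ⟩
    S² odd odd (λ m → S² odd even± λ m′ → [ 4 * K ≈ m + 2 * m′ ])
      ≡⟨ pair-of-odds _ (λ m B≤m → S²-zero odd even± λ m′ → beyond (m + 2 * m′) 4K≤L (≤-trans B≤m (m≤m+n m _))) ⟩
    S² odd even± (λ m → S² odd even± λ m′ → [ 4 * K ≈ 2 * m + 2 * m′ ])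
      ≡⟨ S²-cong (λ m → S²-cong {odd} {even±} λ m′ → ≈-cong (to m m′) (from m m′)) ⟩
    S² odd even± (λ m → S² odd even± λ m′ → [ 2 * K ≈ m + m′ ])
      ≡⟨ S-cong (λ a → S-swap even± odd _) ⟩
    S odd (λ a → S odd λ c → S even± λ b → S even± λ d → [ 2 * K ≈ a + b + (c + d) ])
      ≡⟨ S-cong (λ a → S-cong λ c → S-cong λ b → S-cong λ d → cong [ 2 * K ≈_] (exchange a b c d)) ⟩
    S² odd odd (λ m → S² even± even± λ m′ → [ 2 * K ≈ m + m′ ]) ∎
    where
    exchange : ∀ a b c d → a + b + (c + d) ≡ a + c + (b + d)
    exchange = ℕ-Solver.solve-∀
    twice : ∀ k → 4 * k ≡ 2 * (2 * k)
    twice = ℕ-Solver.solve-∀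
    to : ∀ m m′ → 4 * K ≡ 2 * m + 2 * m′ → 2 * K ≡ m + m′
    to m m′ eq = *-cancelˡ-≡ _ _ 2 (trans (sym (twice K)) (trans eq (sym (*-distribˡ-+ 2 m m′))))
    from : ∀ m m′ → 2 * K ≡ m + m′ → 4 * K ≡ 2 * m + 2 * m′
    from m m′ eq = trans (twice K) (trans (cong (2 *_) eq) (*-distribˡ-+ 2 m m′))

  -- Halving both even integers gives (2·odd + even±)², expanded with the two mixed terms merged.
  S²-even±-quarter : ∀ Ψ → (∀ m → suc L ≤ m → Ψ m ≡ 0) → let Ψ₄ = λ m → Ψ (4 * m) in
    S² even± even± Ψ ≡ 4 * S² odd odd Ψ₄ + 4 * S² odd even± Ψ₄ + S² even± even± Ψ₄
  S²-even±-quarter Ψ vanish = begin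
    S even± Φ                                          ≡⟨ S-even±-quarter Φ (λ a B≤a → S-zero even± λ b → vanish (a + b) (≤-trans B≤a (m≤m+n a b))) ⟩
    2 * S odd (λ a → Φ (4 * a)) + S even± (λ a → Φ (4 * a))
      ≡⟨ cong₂ (λ u v → 2 * u + v) (expand odd) (expand even±) ⟩
    2 * (2 * S² odd odd Ψ₄ + S² odd even± Ψ₄) + (2 * S² even± odd Ψ₄ + S² even± even± Ψ₄)
      ≡⟨ cong (λ # → 2 * (2 * S² odd odd Ψ₄ + S² odd even± Ψ₄) + (2 * # + S² even± even± Ψ₄)) (S²-comm even± odd Ψ₄) ⟩
    2 * (2 * S² odd odd Ψ₄ + S² odd even± Ψ₄) + (2 * S² odd even± Ψ₄ + S² even± even± Ψ₄)
      ≡⟨ collect (S² odd odd Ψ₄) (S² odd even± Ψ₄) (S² even± even± Ψ₄) ⟩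
    4 * S² odd odd Ψ₄ + 4 * S² odd even± Ψ₄ + S² even± even± Ψ₄ ∎
    where
    Φ Ψ₄ : ℕ → ℕ
    Φ a = S even± λ b → Ψ (a + b)
    Ψ₄ m = Ψ (4 * m)
    collect : ∀ a b c → 2 * (2 * a + b) + (2 * b + c) ≡ 4 * a + 4 * b + c
    collect = ℕ-Solver.solve-∀
    row : ∀ a → Φ (4 * a) ≡ 2 * S odd (λ b → Ψ₄ (a + b)) + S even± (λ b → Ψ₄ (a + b))
    row a = trans
      (S-even±-quarter (λ b → Ψ (4 * a + b)) (λ b B≤b → vanish (4 * a + b) (≤-trans B≤b (m≤n+m b (4 * a)))))
      (cong₂ (λ u v → 2 * u + v) (S-cong λ b → cong Ψ (sym (*-distribˡ-+ 4 a b))) (S-cong λ b → cong Ψ (sym (*-distribˡ-+ 4 a b))))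
    expand : ∀ w → S w (λ a → Φ (4 * a)) ≡ 2 * S² w odd Ψ₄ + S² w even± Ψ₄
    expand w = trans (S-cong row) (trans (S-+ w _ _) (cong (_+ S² w even± Ψ₄) (S-* w 2 _)))

  S²-odd-support : ∀ Φ Ψ → (∀ t → Φ (2 + t * 8) ≡ Ψ (2 + t * 8)) → S² odd odd Φ ≡ S² odd odd Ψ
  S²-odd-support Φ Ψ eq = S-odd-support λ s → S-odd-support λ t →
    subst (λ m → Φ m ≡ Ψ m) (collect s t) (eq (s + t))
    where
    collect : ∀ s t → 2 + (s + t) * 8 ≡ 1 + s * 8 + (1 + t * 8)
    collect = ℕ-Solver.solve-∀

  -- Halving gives 2K = o² + o′² + 4m′ with m′ a sum of two squares of integers, and modulo 8 one of
  -- these is odd and the other even, in 4 ways of order and sign of the odd one. Then o² + o′²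
  -- becomes 2(a² + b²), and `pair-of-odds` read backwards turns 2m′ into two odd squares, so K = a²
  -- + b² + two odd squares. The sign of b ≠ 0 gives the remaining factor 2.
  fourOddSquares-seven : ∀ q → let K = 7 + q * 8 in 4 * K ≤ L →
    oddSquares 4 (4 * K) 0 ≡ 8 * S² odd even⁺ λ m → S² odd odd λ m′ → [ K ≈ m + m′ ]
  fourOddSquares-seven q 4K≤L = begin
    oddSquares 4 (4 * K) 0                                                        ≡⟨ fourOddSquares-halve K 4K≤L ⟩
    S² odd odd (λ m → S² even± even± λ m′ → [ 2 * K ≈ m + m′ ])                   ≡⟨ S²-odd-support (λ m → S² even± even± λ m′ → [ 2 * K ≈ m + m′ ]) (λ m → 4 * S² odd even± λ m′ → [ 2 * K ≈ m + 4 * m′ ]) quarter ⟩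
    S² odd odd (λ m → 4 * S² odd even± λ m′ → [ 2 * K ≈ m + 4 * m′ ])             ≡⟨ S²-* odd odd 4 (λ m → S² odd even± λ m′ → [ 2 * K ≈ m + 4 * m′ ]) ⟩
    4 * S² odd odd (λ m → S² odd even± λ m′ → [ 2 * K ≈ m + 4 * m′ ])
      ≡⟨ cong (4 *_) (pair-of-odds _ λ m B≤m → S²-zero odd even± λ m′ → beyond (m + 4 * m′) 2K≤L (≤-trans B≤m (m≤m+n m _))) ⟩
    4 * S² odd even± (λ m → S² odd even± λ m′ → [ 2 * K ≈ 2 * m + 4 * m′ ])
      ≡⟨ cong (4 *_) (S²-cong λ m → trans (S²-cong λ m′ → ≈-cong (to m m′) (from m m′))
           (sym (pair-of-odds _ λ m′ B≤m′ → beyond (m + m′) K≤L (≤-trans B≤m′ (m≤n+m m′ m))))) ⟩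
    4 * S² odd even± (λ m → S² odd odd λ m′ → [ K ≈ m + m′ ])                     ≡⟨ cong (4 *_) (S-odd-support no-zero) ⟩
    4 * S odd (λ a → 2 * S even⁺ λ b → S² odd odd λ m′ → [ K ≈ a + b + m′ ])      ≡⟨ cong (4 *_) (S-* odd 2 _) ⟩
    4 * (2 * S² odd even⁺ (λ m → S² odd odd λ m′ → [ K ≈ m + m′ ]))               ≡⟨ *-assoc 4 2 (S² odd even⁺ (λ m → S² odd odd λ m′ → [ K ≈ m + m′ ])) ⟨
    8 * S² odd even⁺ (λ m → S² odd odd λ m′ → [ K ≈ m + m′ ])                     ∎
    where
    K : ℕ
    K = 7 + q * 8
    2K≤L : 2 * K ≤ L
    2K≤L = ≤-trans (*-monoˡ-≤ K (s≤s (s≤s (z≤n {2})))) 4K≤L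
    K≤L : K ≤ L
    K≤L = ≤-trans (m≤m+n K (K + 0)) 2K≤L
    twice : ∀ m m′ → 2 * m + 4 * m′ ≡ 2 * (m + 2 * m′)
    twice = ℕ-Solver.solve-∀
    to : ∀ m m′ → 2 * K ≡ 2 * m + 4 * m′ → K ≡ m + 2 * m′
    to m m′ eq = *-cancelˡ-≡ _ _ 2 (trans eq (twice m m′))
    from : ∀ m m′ → K ≡ m + 2 * m′ → 2 * K ≡ 2 * m + 4 * m′
    from m m′ eq = trans (cong (2 *_) eq) (sym (twice m m′))

    double-K : ∀ q → 2 * (7 + q * 8) ≡ 6 + (1 + 2 * q) * 8
    double-K = ℕ-Solver.solve-∀

    -- 2K ≡ 6 (mod 8), and two odd squares make 2, so m′ must be odd; equal parities would make it
    -- even.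
    quarter : ∀ r → S² even± even± (λ m′ → [ 2 * K ≈ 2 + r * 8 + m′ ])
                  ≡ 4 * S² odd even± (λ m′ → [ 2 * K ≈ 2 + r * 8 + 4 * m′ ])
    quarter r = begin
      S² even± even± Ψ     ≡⟨ S²-even±-quarter Ψ (λ m′ B≤m′ → beyond (2 + r * 8 + m′) 2K≤L (≤-trans B≤m′ (m≤n+m m′ _))) ⟩
      4 * S² odd odd Ψ₄ + 4 * S² odd even± Ψ₄ + S² even± even± Ψ₄
        ≡⟨ cong₂ (λ u v → 4 * u + 4 * S² odd even± Ψ₄ + v) odd-odd even-even ⟩
      4 * S² odd even± Ψ₄ + 0   ≡⟨ +-identityʳ _ ⟩
      4 * S² odd even± Ψ₄       ∎
      where
      Ψ Ψ₄ : ℕ → ℕ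
      Ψ m′ = [ 2 * K ≈ 2 + r * 8 + m′ ]
      Ψ₄ m′ = Ψ (4 * m′)
      off : ∀ b m → 2 + r * 8 + 4 * m ≡ 2 + b * 8 → Ψ₄ m ≡ 0
      off b m eq = ≈-no λ eq′ → 6≢2 (mod-8 6 2 (1 + 2 * q) b (trans (sym (double-K q)) (trans eq′ eq)))
        where
        6≢2 : 6 ≢ 2
        6≢2 ()
      odd-odd : S² odd odd Ψ₄ ≡ 0
      odd-odd = trans (S²-odd-support Ψ₄ (λ _ → 0) λ t → off (r + 1 + 4 * t) (2 + t * 8) (lemma r t)) (S²-zero odd odd λ _ → refl)
        where
        lemma : ∀ r t → 2 + r * 8 + 4 * (2 + t * 8) ≡ 2 + (r + 1 + 4 * t) * 8
        lemma = ℕ-Solver.solve-∀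
      even-even : S² even± even± Ψ₄ ≡ 0
      even-even = trans (S-even-support {Ψ = λ _ → 0} λ s → trans (S-even-support {Ψ = λ _ → 0} λ t →
        off (r + 2 * s + 2 * t) (4 * s + 4 * t) (lemma r s t)) (S-zero even± λ _ → refl)) (S-zero even± λ _ → refl)
        where
        lemma : ∀ r s t → 2 + r * 8 + 4 * (4 * s + 4 * t) ≡ 2 + (r + 2 * s + 2 * t) * 8
        lemma = ℕ-Solver.solve-∀

    -- b = 0 would leave three odd squares, with sum 3 (mod 8) instead of 7.
    no-zero : ∀ s → S even± (λ b → S² odd odd λ m′ → [ K ≈ 1 + s * 8 + b + m′ ])
                  ≡ 2 * S even⁺ (λ b → S² odd odd λ m′ → [ K ≈ 1 + s * 8 + b + m′ ])
    no-zero s = trans (S-even± Φ) (cong (_+ 2 * S even⁺ Φ) (trans (S-isZero Φ (s≤s z≤n))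
      (trans (S²-odd-support (λ m′ → [ K ≈ 1 + s * 8 + 0 + m′ ]) (λ _ → 0) λ t → ≈-no λ eq → 7≢3 (mod-8 7 3 q (s + t) (trans eq (lemma s t))))
        (S²-zero odd odd λ _ → refl))))
      where
      Φ : ℕ → ℕ
      Φ b = S² odd odd λ m′ → [ K ≈ 1 + s * 8 + b + m′ ]
      lemma : ∀ s t → 1 + s * 8 + 0 + (2 + t * 8) ≡ 3 + (s + t) * 8
      lemma = ℕ-Solver.solve-∀
      7≢3 : 7 ≢ 3
      7≢3 ()

-- Lower bounds for ordered sums of five positive squares

∑-monoˡ : ∀ {m n} (f : ℕ → ℕ) → m ≤ n → ∑ m f ≤ ∑ n f
∑-monoˡ {m} {n} f m≤n = subst (λ # → ∑ m f ≤ ∑ # f) (m+[n∸m]≡n m≤n)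
  (subst (∑ m f ≤_) (sym (∑-split m (n ∸ m) f)) (m≤m+n _ _))

∑-progression : ∀ m c d (f : ℕ → ℕ) → ∑ m (λ i → f (c + suc d * i)) ≤ ∑ (c + suc d * m) f
∑-progression zero    c d f = z≤n
∑-progression (suc m) c d f = begin
  ∑ m (λ i → f (c + suc d * i)) + f (c + suc d * m)   ≤⟨ +-monoˡ-≤ _ (∑-progression m c d f) ⟩
  ∑ (suc (c + suc d * m)) f                           ≤⟨ ∑-monoˡ f (subst (suc (c + suc d * m) ≤_) (lemma c d m) (m≤m+n _ d)) ⟩
  ∑ (c + suc d * suc m) f                             ∎
  where
  open ≤-Reasoning
  lemma : ∀ c d m → suc (c + suc d * m) + d ≡ c + suc d * suc m
  lemma = ℕ-Solver.solve-∀

module LowerBounds (L : ℕ) where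
  open Squares (suc L)
  open PairOfOdds (suc L)
  open FourOddSquares L
  open FourSquares L

  tuples : ℕ → ℕ → ℕ → ℕ
  tuples = representations positive

  oddSquares≤tuples : ∀ j N a → oddSquares j N a ≤ tuples j N a
  oddSquares≤tuples zero    N a = ≤-refl
  oddSquares≤tuples (suc j) N a = S-mono odd≤positive λ s → oddSquares≤tuples j N (a + s)

  -- All entries are doubled; 4N ≤ L keeps the doubled entries that matter within the range of
  -- summation.
  oddSquares≤tuples-quadruple : ∀ j N a → 4 * N ≤ L → oddSquares j N a ≤ tuples j (4 * N) (4 * a)
  oddSquares≤tuples-quadruple zero    N a 4N≤L = ≤-reflexive (≈-cong (cong (4 *_)) (*-cancelˡ-≡ N a 4))
  oddSquares≤tuples-quadruple (suc j) N a 4N≤L = ≤-trans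
    (S-mono (λ _ → ≤-refl) λ s → subst (λ # → oddSquares j N (a + s) ≤ tuples j (4 * N) #) (*-distribˡ-+ 4 a s)
      (oddSquares≤tuples-quadruple j N (a + s) 4N≤L))
    (S-odd≤S-positive (λ s → tuples j (4 * N) (4 * a + s)) λ m B≤m → vanish j (≤-trans (<-≤-trans (s≤s 4N≤L) B≤m) (m≤n+m m _)))
    where
    vanish : ∀ j {N a} → N < a → tuples j N a ≡ 0
    vanish zero    N<a = ≈-no (<⇒≢ N<a)
    vanish (suc j) {a = a} N<a = S-zero positive λ s → vanish j (<-≤-trans N<a (m≤m+n a s))

  four-odd-bound : ∀ q → 3 * (5 + q * 8) ≤ L → 4 + q * 8 ≤ 4 * tuples 4 (4 + q * 8) 0
  four-odd-bound q bound = ≤-trans (≤-reflexive (lemma q))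
    (*-monoʳ-≤ 4 (≤-trans (fourOddSquares-≥ q bound) (oddSquares≤tuples 4 _ 0)))
    where
    lemma : ∀ q → 4 + q * 8 ≡ 4 * (1 + 2 * q)
    lemma = ℕ-Solver.solve-∀

  four-even-bound : ∀ q → 3 * (5 + q * 8) ≤ L → 4 * (4 + q * 8) ≤ L → 16 + q * 32 ≤ 16 * tuples 4 (16 + q * 32) 0
  four-even-bound q bound bound′ = ≤-trans (≤-reflexive (lemma q))
    (*-monoʳ-≤ 16 (≤-trans (fourOddSquares-≥ q bound)
      (subst (λ # → oddSquares 4 (4 + q * 8) 0 ≤ tuples 4 # 0) (lemma′ q) (oddSquares≤tuples-quadruple 4 (4 + q * 8) 0 bound′))))
    where
    lemma : ∀ q → 16 + q * 32 ≡ 16 * (1 + 2 * q)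
    lemma = ℕ-Solver.solve-∀
    lemma′ : ∀ q → 4 * (4 + q * 8) ≡ 16 + q * 32
    lemma′ = ℕ-Solver.solve-∀

  -- σ(K) ≥ K is applied to 4K = 4 + 8(3 + 4q), and `fourOddSquares-seven` trades the odd quadruples
  -- for 4K against quadruples for K.
  seven-bound : ∀ q → 3 * (5 + (3 + 4 * q) * 8) ≤ L → 7 + q * 8 ≤ 8 * tuples 4 (7 + q * 8) 0
  seven-bound q bound = begin
    7 + q * 8                           ≡⟨ lemma q ⟩
    1 + 2 * (3 + 4 * q)                 ≤⟨ fourOddSquares-≥ (3 + 4 * q) bound ⟩
    oddSquares 4 (4 + (3 + 4 * q) * 8) 0   ≡⟨ cong (λ # → oddSquares 4 # 0) (lemma′ q) ⟩
    oddSquares 4 (4 * K) 0              ≡⟨ fourOddSquares-seven q (≤-trans (≤-trans (m≤n+m (4 * K) (3 + 8 * K)) (≤-reflexive (lemma″ q))) bound) ⟩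
    8 * S² odd even⁺ (λ m → S² odd odd λ m′ → [ K ≈ m + m′ ])
      ≤⟨ *-monoʳ-≤ 8 (S-mono odd≤positive λ s → S-mono even⁺≤positive λ t → S-mono odd≤positive λ u → S-mono odd≤positive λ v →
           ≤-reflexive (cong [ K ≈_] (sym (+-assoc (s + t) u v)))) ⟩
    8 * tuples 4 K 0                    ∎
    where
    open ≤-Reasoning
    K : ℕ
    K = 7 + q * 8
    lemma : ∀ q → 7 + q * 8 ≡ 1 + 2 * (3 + 4 * q)
    lemma = ℕ-Solver.solve-∀
    lemma′ : ∀ q → 4 + (3 + 4 * q) * 8 ≡ 4 * (7 + q * 8)
    lemma′ = ℕ-Solver.solve-∀
    lemma″ : ∀ q → 3 + 8 * (7 + q * 8) + 4 * (7 + q * 8) ≡ 3 * (5 + (3 + 4 * q) * 8)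
    lemma″ = ℕ-Solver.solve-∀

  -- If a ≤ n, then n - a lies in the class ρ (mod μ), to which `hyp` applies. For t > M already a ≥
  -- s + (M + 1)μ ≥ n, because ρ ≤ μ.
  square-bound : ∀ μ ρ κ n → ρ ≤ μ → (∀ q → ρ + q * μ ≤ n → ρ + q * μ ≤ κ * tuples 4 (ρ + q * μ) 0) →
    ∀ s M → n ≡ s + ρ + M * μ → ∀ a t → a ≡ s + t * μ → n ≤ a + κ * tuples 4 n a
  square-bound μ ρ κ n ρ≤μ hyp s M refl a t refl with t ≤? M
  ... | yes t≤M = begin
    n                                 ≡⟨ n≡ ⟩
    r + a                             ≡⟨ +-comm r a ⟩
    a + r                             ≤⟨ +-monoʳ-≤ a (hyp q (subst (r ≤_) (sym n≡) (m≤m+n r a))) ⟩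
    a + κ * tuples 4 r 0              ≡⟨ cong (λ # → a + κ * #) (representations-shift positive 4 r 0 a) ⟨
    a + κ * tuples 4 (r + a) a        ≡⟨ cong (λ # → a + κ * tuples 4 # a) n≡ ⟨
    a + κ * tuples 4 n a              ∎
    where
    open ≤-Reasoning
    q r : ℕ
    q = M ∸ t
    r = ρ + q * μ
    lemma : ∀ s ρ t q μ → s + ρ + (t + q) * μ ≡ ρ + q * μ + (s + t * μ)
    lemma = ℕ-Solver.solve-∀
    n≡ : n ≡ r + a
    n≡ = trans (cong (λ # → s + ρ + # * μ) (sym (m+[n∸m]≡n t≤M))) (lemma s ρ t q μ)
  ... | no t≰M = ≤-trans (≤-trans (≤-trans (≤-reflexive (+-assoc s ρ _)) (+-monoʳ-≤ s (+-monoˡ-≤ (M * μ) ρ≤μ)))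
    (+-monoʳ-≤ s (*-monoˡ-≤ μ (≰⇒> t≰M)))) (m≤m+n _ _)

  S-progression : ∀ w Φ m c d → c + suc d * m ≤ suc L →
    ∑ m (λ i → w (c + suc d * i) * Φ ((c + suc d * i) * (c + suc d * i))) ≤ S w Φ
  S-progression w Φ m c d bound = subst (_ ≤_) (sym (S-def w Φ))
    (≤-trans (∑-progression m c d (λ x → w x * Φ (x * x))) (∑-monoˡ _ bound))

  -- A quadruple for n - a² together with a is a quintuple for n, and distinct a give distinct
  -- quintuples.
  progression-bound : ∀ n κ m c d → suc c + suc d * m ≤ suc L →
    (∀ i → let a = suc c + suc d * i in n ≤ a * a + κ * tuples 4 n (a * a)) →
    m * n ≤ ∑ m (λ i → (suc c + suc d * i) * (suc c + suc d * i)) + κ * tuples 5 n 0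
  progression-bound n κ m c d bound hyp = begin
    m * n                                                 ≡⟨ ∑-const m ⟨
    ∑ m (λ _ → n)                                         ≤⟨ ∑-mono m (λ i _ → hyp i) ⟩
    ∑ m (λ i → sq i + κ * tuples 4 n (sq i))              ≡⟨ ∑-⊕ m _ _ ⟩
    ∑ m sq + ∑ m (λ i → κ * tuples 4 n (sq i))            ≡⟨ cong (_+_ (∑ m sq)) (∑-⊛ m κ) ⟩
    ∑ m sq + κ * ∑ m (λ i → tuples 4 n (sq i))            ≡⟨ cong (λ # → ∑ m sq + κ * #) (∑-cong m λ i → sym (+-identityʳ _)) ⟩
    ∑ m sq + κ * ∑ m (λ i → 1 * tuples 4 n (sq i))        ≤⟨ +-monoʳ-≤ (∑ m sq) (*-monoʳ-≤ κ (S-progression positive (tuples 4 n) m (suc c) d bound)) ⟩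
    ∑ m sq + κ * tuples 5 n 0                             ∎
    where
    open ≤-Reasoning
    sq : ℕ → ℕ
    sq i = (suc c + suc d * i) * (suc c + suc d * i)
    ∑-const : ∀ m → ∑ m (λ _ → n) ≡ m * n
    ∑-const zero    = refl
    ∑-const (suc m) = trans (cong (_+ n) (∑-const m)) (+-comm (m * n) n)

  private
    -- Two non-zero entries have four choices of sign. A pair with a zero entry is one signed entry
    -- in one of two places, where (0, 0) is counted twice; hence the inequality.
    absorb-zeros : ∀ Ψ → S² even± even± Ψ ≤ 4 * S² even⁺ even⁺ Ψ + 2 * S even± Ψ
    absorb-zeros Ψ = begin
      S² even± even± Ψ                                  ≡⟨ S-even± _ ⟩
      S isZero (λ a → S even± λ b → Ψ (a + b)) + 2 * S even⁺ (λ a → S even± λ b → Ψ (a + b))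
        ≡⟨ cong₂ (λ u v → u + 2 * v) (S-isZero (λ a → S even± λ b → Ψ (a + b)) (s≤s z≤n)) (trans (S-cong row) (S-+ even⁺ Ψ _)) ⟩
      E + 2 * (S even⁺ Ψ + S even⁺ (λ a → 2 * S even⁺ λ b → Ψ (a + b)))
        ≡⟨ cong (λ # → E + 2 * (S even⁺ Ψ + #)) (S-* even⁺ 2 _) ⟩
      E + 2 * (S even⁺ Ψ + 2 * P)                       ≡⟨ collect E (S even⁺ Ψ) P ⟩
      4 * P + (E + 2 * S even⁺ Ψ)                       ≤⟨ +-monoʳ-≤ (4 * P) (+-monoʳ-≤ E half-E) ⟩
      4 * P + (E + (E + 0))                             ∎
      where
      open ≤-Reasoning
      E P : ℕ
      E = S even± Ψ
      P = S² even⁺ even⁺ Ψ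
      collect : ∀ e f p → e + 2 * (f + 2 * p) ≡ 4 * p + (e + 2 * f)
      collect = ℕ-Solver.solve-∀
      row : ∀ a → S even± (λ b → Ψ (a + b)) ≡ Ψ a + 2 * S even⁺ (λ b → Ψ (a + b))
      row a = trans (S-even± _) (cong (_+ 2 * S even⁺ (λ b → Ψ (a + b)))
        (trans (S-isZero (λ b → Ψ (a + b)) (s≤s z≤n)) (cong Ψ (+-identityʳ a))))
      half-E : 2 * S even⁺ Ψ ≤ E + 0
      half-E = subst (2 * S even⁺ Ψ ≤_) (trans (sym (S-even± Ψ)) (sym (+-identityʳ E))) (m≤n+m _ (S isZero Ψ))

  -- Every quadruple (o, o′, e, e′) of squares with a vanishing even entry, taken together with an even y,
  -- is itself a quadruple counted for 2k, so that the zeros cost no more than the divisor sum of k.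
  even-bound : ∀ h M → let k = 1 + 2 * M in 12 * k + 3 ≤ L → 2 + 2 * h ≤ suc L →
    h * k ≤ ∑ h (λ i → 2 * (suc i * suc i)) + (4 * tuples 5 (2 * k) 0 + oddSquares 4 (4 * k) 0)
  even-bound h M bound h-bound = begin
    h * k                                          ≡⟨ ∑-const h ⟨
    ∑ h (λ _ → k)                                  ≤⟨ ∑-mono h (λ i _ → term (suc i)) ⟩
    ∑ h (λ i → 2 * (suc i * suc i) + Q (4 * (suc i * suc i)))   ≡⟨ ∑-⊕ h _ _ ⟩
    ∑ h (λ i → 2 * (suc i * suc i)) + ∑ h (λ i → Q (4 * (suc i * suc i)))
      ≤⟨ +-monoʳ-≤ (∑ h (λ i → 2 * (suc i * suc i))) (begin
         ∑ h (λ i → Q (4 * (suc i * suc i)))       ≡⟨ ∑-cong h even-index ⟩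
         ∑ h (λ i → even⁺ (2 + 2 * i) * Q ((2 + 2 * i) * (2 + 2 * i)))   ≤⟨ S-progression even⁺ Q h 2 1 h-bound ⟩
         S even⁺ Q                                 ≤⟨ S-mono (λ _ → ≤-refl) zeros ⟩
         S even⁺ (λ s → 4 * P s + 2 * Z s)         ≡⟨ S-+ even⁺ _ _ ⟩
         S even⁺ (λ s → 4 * P s) + S even⁺ (λ s → 2 * Z s)   ≡⟨ cong₂ _+_ (S-* even⁺ 4 P) (S-* even⁺ 2 Z) ⟩
         4 * S even⁺ P + 2 * S even⁺ Z             ≤⟨ +-mono-≤ (*-monoʳ-≤ 4 P≤) Z≤ ⟩
         4 * tuples 5 n 0 + oddSquares 4 (4 * k) 0 ∎) ⟩
    ∑ h (λ i → 2 * (suc i * suc i)) + (4 * tuples 5 n 0 + oddSquares 4 (4 * k) 0) ∎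
    where
    open ≤-Reasoning
    k n : ℕ
    k = 1 + 2 * M
    n = 2 * k
    Q P Z : ℕ → ℕ
    Q s = S² odd odd λ m → S² even± even± λ m′ → [ n ≈ s + m + m′ ]
    P s = S² odd odd λ m → S² even⁺ even⁺ λ m′ → [ n ≈ s + m + m′ ]
    Z s = S² odd odd λ m → S even± λ t → [ n ≈ s + m + t ]

    ∑-const : ∀ m → ∑ m (λ _ → k) ≡ m * k
    ∑-const zero    = refl
    ∑-const (suc m) = trans (cong (_+ k) (∑-const m)) (+-comm (m * k) k)

    even-index : ∀ i → Q (4 * (suc i * suc i)) ≡ even⁺ (2 + 2 * i) * Q ((2 + 2 * i) * (2 + 2 * i))
    even-index i = sym (trans (cong (_* Q ((2 + 2 * i) * (2 + 2 * i))) (odd-1+double i))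
      (trans (+-identityʳ _) (cong Q (lemma i))))
      where
      lemma : ∀ i → (2 + 2 * i) * (2 + 2 * i) ≡ 4 * (suc i * suc i)
      lemma = ℕ-Solver.solve-∀

    4k≤L : 4 * k ≤ L
    4k≤L = ≤-trans (≤-trans (*-monoˡ-≤ k (m≤m+n 4 8)) (m≤m+n (12 * k) 3)) bound

    -- n - 4y² = 2K with K = k - 2y² odd, and Q(4y²) = σ(K) ≥ K. For y² > M already 2y² > k.
    term : ∀ y → k ≤ 2 * (y * y) + Q (4 * (y * y))
    term y with y * y ≤? M
    ... | no y²≰M = ≤-trans (≤-trans (≤-trans (n≤1+n k) (≤-reflexive (lemma M))) (*-monoʳ-≤ 2 (≰⇒> y²≰M))) (m≤m+n _ _)
      where
      lemma : ∀ M → suc (1 + 2 * M) ≡ 2 * suc M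
      lemma = ℕ-Solver.solve-∀
    ... | yes y²≤M = ≤-trans (≤-reflexive k≡) (+-monoʳ-≤ (2 * (y * y)) (begin
      K                                  ≤⟨ fourOddSquares-≥ j j-bound ⟩
      oddSquares 4 (4 + j * 8) 0         ≡⟨ cong (λ # → oddSquares 4 # 0) (lemma₂ j) ⟩
      oddSquares 4 (4 * K) 0             ≡⟨ fourOddSquares-halve K (≤-trans (*-monoʳ-≤ 4 K≤k) 4k≤L) ⟩
      S² odd odd (λ m → S² even± even± λ m′ → [ 2 * K ≈ m + m′ ])
        ≡⟨ S²-cong (λ m → S²-cong {even±} {even±} λ m′ → ≈-cong (λ eq → trans n≡ (trans (cong (_+_ (4 * (y * y))) eq) (sym (+-assoc (4 * (y * y)) m m′))))
             (λ eq → +-cancelˡ-≡ (4 * (y * y)) _ _ (trans (sym n≡) (trans eq (+-assoc (4 * (y * y)) m m′))))) ⟩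
      Q (4 * (y * y))                    ∎))
      where
      j K : ℕ
      j = M ∸ y * y
      K = 1 + 2 * j
      lemma₁ : ∀ s j → 1 + 2 * (s + j) ≡ 2 * s + (1 + 2 * j)
      lemma₁ = ℕ-Solver.solve-∀
      lemma₂ : ∀ j → 4 + j * 8 ≡ 4 * (1 + 2 * j)
      lemma₂ = ℕ-Solver.solve-∀
      lemma₃ : ∀ s j → 2 * (2 * s + (1 + 2 * j)) ≡ 4 * s + 2 * (1 + 2 * j)
      lemma₃ = ℕ-Solver.solve-∀
      lemma₄ : ∀ j → 12 * (1 + 2 * j) + 3 ≡ 3 * (5 + j * 8)
      lemma₄ = ℕ-Solver.solve-∀
      k≡ : k ≡ 2 * (y * y) + K
      k≡ = trans (cong (λ # → 1 + 2 * #) (sym (m+[n∸m]≡n y²≤M))) (lemma₁ (y * y) j)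
      n≡ : n ≡ 4 * (y * y) + 2 * K
      n≡ = trans (cong (2 *_) k≡) (lemma₃ (y * y) j)
      K≤k : K ≤ k
      K≤k = subst (K ≤_) (sym k≡) (m≤n+m K _)
      j-bound : 3 * (5 + j * 8) ≤ L
      j-bound = ≤-trans (≤-trans (≤-reflexive (sym (lemma₄ j))) (+-monoˡ-≤ 3 (*-monoʳ-≤ 12 K≤k))) bound

    zeros : ∀ s → Q s ≤ 4 * P s + 2 * Z s
    zeros s = begin
      Q s   ≤⟨ S-mono (λ _ → ≤-refl) (λ a → S-mono (λ _ → ≤-refl) λ b → absorb-zeros (λ m′ → [ n ≈ s + (a + b) + m′ ])) ⟩
      S² odd odd (λ m → 4 * S² even⁺ even⁺ (λ m′ → [ n ≈ s + m + m′ ]) + 2 * S even± (λ t → [ n ≈ s + m + t ]))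
            ≡⟨ trans (S-cong λ a → S-+ odd _ _) (S-+ odd _ _) ⟩
      S² odd odd (λ m → 4 * S² even⁺ even⁺ (λ m′ → [ n ≈ s + m + m′ ])) + S² odd odd (λ m → 2 * S even± (λ t → [ n ≈ s + m + t ]))
            ≡⟨ cong₂ _+_ (S²-* odd odd 4 (λ m → S² even⁺ even⁺ (λ m′ → [ n ≈ s + m + m′ ]))) (S²-* odd odd 2 (λ m → S even± (λ t → [ n ≈ s + m + t ]))) ⟩
      4 * P s + 2 * Z s ∎

    P≤ : S even⁺ P ≤ tuples 5 n 0
    P≤ = S-mono even⁺≤positive λ s → S-mono odd≤positive λ a → S-mono odd≤positive λ b →
      S-mono even⁺≤positive λ c → S-mono even⁺≤positive λ d → ≤-reflexive (cong [ n ≈_] (lemma s a b c d))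
      where
      lemma : ∀ s a b c d → s + (a + b) + (c + d) ≡ s + a + b + c + d
      lemma = ℕ-Solver.solve-∀

    Z≤ : 2 * S even⁺ Z ≤ oddSquares 4 (4 * k) 0
    Z≤ = begin
      2 * S even⁺ Z                  ≤⟨ m≤n+m _ (S isZero Z) ⟩
      S isZero Z + 2 * S even⁺ Z     ≡⟨ S-even± Z ⟨
      S even± Z                      ≡⟨ trans (S-swap even± odd _) (S-cong λ a → S-swap even± odd _) ⟩
      S odd (λ a → S odd λ b → S even± λ s → S even± λ t → [ n ≈ s + (a + b) + t ])
        ≡⟨ S-cong (λ a → S-cong λ b → S-cong λ s → S-cong λ t → cong [ n ≈_] (lemma s (a + b) t)) ⟩
      S² odd odd (λ m → S² even± even± λ m′ → [ n ≈ m + m′ ])   ≡⟨ fourOddSquares-halve k 4k≤L ⟨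
      oddSquares 4 (4 * k) 0         ∎
      where
      lemma : ∀ s m t → s + m + t ≡ m + (s + t)
      lemma = ℕ-Solver.solve-∀

-- An elementary upper bound for σ

∑-unique-≤ : ∀ n (f : ℕ → ℕ) b → (∀ i → f i ≤ b) → (∀ i j → i < j → f j ≢ 0 → f i ≡ 0) → ∑ n f ≤ b
∑-unique-≤ zero    f b f≤b unique = z≤n
∑-unique-≤ (suc n) f b f≤b unique with f n ≟ 0
... | yes fn≡0 = subst (_≤ b) (trans (sym (+-identityʳ _)) (cong (_+_ (∑ n f)) (sym fn≡0))) (∑-unique-≤ n f b f≤b unique)
... | no  fn≢0 = subst (_≤ b) (cong (_+ f n) (sym (∑-zero n λ i i<n → unique i n i<n fn≢0))) (f≤b n)

∑-≤-const : ∀ n (f : ℕ → ℕ) b → (∀ i → i < n → f i ≤ b) → ∑ n f ≤ n * b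
∑-≤-const zero    f b f≤b = z≤n
∑-≤-const (suc n) f b f≤b = ≤-trans (+-mono-≤ (∑-≤-const n f b λ i i<n → f≤b i (m<n⇒m<1+n i<n)) (f≤b n ≤-refl))
  (≤-reflexive (+-comm (n * b) b))

-- A divisor or its codivisor is at most s; the codivisors beyond 15 contribute at most k/16 each.
divisorSum-≤ : ∀ L k s → 15 ≤ s → s ≤ L → k < suc s * suc s →
  16 * divisorSum L (4 * k) 0 ≤ 16 * (s * s) + (240 * k + s * k)
divisorSum-≤ L k s 15≤s s≤L k<s² = begin
  16 * divisorSum L (4 * k) 0                            ≤⟨ *-monoʳ-≤ 16 split ⟩
  16 * (∑ s (λ i → ∑ L (t i)) + ∑ s column)              ≡⟨ *-distribˡ-+ 16 (∑ s λ i → ∑ L (t i)) (∑ s column) ⟩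
  16 * ∑ s (λ i → ∑ L (t i)) + 16 * ∑ s column           ≤⟨ +-mono-≤ (*-monoʳ-≤ 16 (∑-≤-const s _ s λ i i<s → ≤-trans (row≤ i) i<s)) columns ⟩
  16 * (s * s) + (240 * k + s * k)                       ∎
  where
  open ≤-Reasoning
  t : ℕ → ℕ → ℕ
  t i j = suc i * [ 4 * k ≈ 4 * (suc i * suc j) ]
  column : ℕ → ℕ
  column j = ∑ L λ i → t i j

  t≢0⇒ : ∀ i j → t i j ≢ 0 → k ≡ suc i * suc j
  t≢0⇒ i j t≢0 with k ≟ suc i * suc j
  ... | yes eq = eq
  ... | no neq = contradiction (trans (cong (suc i *_) (≈-no (neq ∘ *-cancelˡ-≡ k _ 4))) (*-zeroʳ (suc i))) t≢0

  off : ∀ i j → k ≢ suc i * suc j → t i j ≡ 0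
  off i j neq with t i j ≟ 0
  ... | yes eq = eq
  ... | no t≢0 = contradiction (t≢0⇒ i j t≢0) neq

  t≤ : ∀ i j b → (k ≡ suc i * suc j → suc i ≤ b) → t i j ≤ b
  t≤ i j b hyp with k ≟ suc i * suc j
  ... | yes eq = ≤-trans (≤-reflexive (trans (cong (suc i *_) (≈-yes (cong (4 *_) eq))) (*-identityʳ (suc i)))) (hyp eq)
  ... | no neq = ≤-trans (≤-reflexive (off i j neq)) z≤n

  row≤ : ∀ i → ∑ L (t i) ≤ suc i
  row≤ i = ∑-unique-≤ L (t i) (suc i) (λ j → t≤ i j (suc i) λ _ → ≤-refl) λ j j′ j<j′ t≢0 →
    off i j λ eq → <⇒≢ (*-monoʳ-< (suc i) (s≤s j<j′)) (trans (sym eq) (t≢0⇒ i j′ t≢0))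

  column-unique : ∀ j i i′ → i < i′ → t i′ j ≢ 0 → t i j ≡ 0
  column-unique j i i′ i<i′ t≢0 = off i j λ eq → <⇒≢ (*-monoˡ-< (suc j) (s≤s i<i′)) (trans (sym eq) (t≢0⇒ i′ j t≢0))

  column≤k : ∀ j → column j ≤ k
  column≤k j = ∑-unique-≤ L (λ i → t i j) k
    (λ i → t≤ i j k λ eq → ≤-trans (m≤m*n (suc i) (suc j)) (≤-reflexive (sym eq))) (column-unique j)

  16column≤k : ∀ j → 16 * column (15 + j) ≤ k
  16column≤k j = begin
    16 * column (15 + j)              ≡⟨ ∑-⊛ L 16 ⟨
    ∑ L (λ i → 16 * t i (15 + j))     ≤⟨ ∑-unique-≤ L (λ i → 16 * t i (15 + j)) k (λ i → *-bound i)
                                           (λ i i′ i<i′ neq → cong (16 *_) (column-unique (15 + j) i i′ i<i′ λ eq → neq (cong (16 *_) eq))) ⟩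
    k                                 ∎
    where
    *-bound : ∀ i → 16 * t i (15 + j) ≤ k
    *-bound i with k ≟ suc i * suc (15 + j)
    ... | no neq = ≤-trans (≤-reflexive (cong (16 *_) (off i (15 + j) neq))) z≤n
    ... | yes eq = begin
      16 * t i (15 + j)        ≤⟨ *-monoʳ-≤ 16 (t≤ i (15 + j) (suc i) λ _ → ≤-refl) ⟩
      16 * suc i               ≡⟨ *-comm 16 (suc i) ⟩
      suc i * 16               ≤⟨ *-monoʳ-≤ (suc i) (m≤m+n 16 j) ⟩
      suc i * suc (15 + j)     ≡⟨ eq ⟨
      k                        ∎

  columns : 16 * ∑ s column ≤ 240 * k + s * k
  columns = begin
    16 * ∑ s column                                             ≡⟨ cong (λ # → 16 * ∑ # column) (m+[n∸m]≡n 15≤s) ⟨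
    16 * ∑ (15 + s′) column                                     ≡⟨ cong (16 *_) (∑-split 15 s′ column) ⟩
    16 * (∑ 15 column + ∑ s′ (λ j → column (15 + j)))           ≡⟨ *-distribˡ-+ 16 (∑ 15 column) _ ⟩
    16 * ∑ 15 column + 16 * ∑ s′ (λ j → column (15 + j))        ≡⟨ cong (_+_ (16 * ∑ 15 column)) (∑-⊛ s′ 16) ⟨
    16 * ∑ 15 column + ∑ s′ (λ j → 16 * column (15 + j))
      ≤⟨ +-mono-≤ (*-monoʳ-≤ 16 (∑-≤-const 15 column k λ j _ → column≤k j)) (∑-≤-const s′ _ k λ j _ → 16column≤k j) ⟩
    16 * (15 * k) + s′ * k                                      ≡⟨ cong (_+ s′ * k) (*-assoc 16 15 k) ⟨
    240 * k + s′ * k                                            ≤⟨ +-monoʳ-≤ (240 * k) (*-monoˡ-≤ k (m∸n≤m s 15)) ⟩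
    240 * k + s * k                                             ∎
    where
    s′ : ℕ
    s′ = s ∸ 15

  -- The corner i, j ≥ s is empty, as there (i + 1)(j + 1) ≥ (s + 1)² > k. So every solution lies in
  -- one of the first s rows or the first s columns.
  split : divisorSum L (4 * k) 0 ≤ ∑ s (λ i → ∑ L (t i)) + ∑ s column
  split = begin
    ∑ L (λ i → ∑ L (t i))                                       ≡⟨ cong (λ # → ∑ # (λ i → ∑ L (t i))) (m+[n∸m]≡n s≤L) ⟨
    ∑ (s + L′) (λ i → ∑ L (t i))                                ≡⟨ ∑-split s L′ _ ⟩
    ∑ s (λ i → ∑ L (t i)) + ∑ L′ (λ i → ∑ L (t (s + i)))        ≡⟨ cong (_+_ (∑ s (λ i → ∑ L (t i)))) (∑-cong L′ λ i → ∑-extend s≤L λ j s≤j →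
                                                                     off (s + i) j (<⇒≢ (<-≤-trans k<s² (*-mono-≤ (s≤s (m≤m+n s i)) (s≤s s≤j))))) ⟩
    ∑ s (λ i → ∑ L (t i)) + ∑ L′ (λ i → ∑ s (t (s + i)))        ≡⟨ cong (_+_ (∑ s (λ i → ∑ L (t i)))) (∑-swap L′ s _) ⟩
    ∑ s (λ i → ∑ L (t i)) + ∑ s (λ j → ∑ L′ (λ i → t (s + i) j))   ≤⟨ +-monoʳ-≤ (∑ s (λ i → ∑ L (t i))) (∑-mono s λ j _ → tail j) ⟩
    ∑ s (λ i → ∑ L (t i)) + ∑ s column                          ∎
    where
    L′ : ℕ
    L′ = L ∸ s
    tail : ∀ j → ∑ L′ (λ i → t (s + i) j) ≤ column j
    tail j = ≤-trans (m≤n+m _ (∑ s λ i → t i j)) (≤-reflexive (trans (sym (∑-split s L′ (λ i → t i j)))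
      (cong (λ # → ∑ # (λ i → t i j)) (m+[n∸m]≡n s≤L))))

-- Many ordered representations from 2¹⁶ onwards

-- h = ⌊√k / 2⌋ serves twice for n = 2k: as the number of even squares to subtract, and through s =
-- 1 + 2h = (number next below 2(h + 1)) as the cutoff in the bound for σ(k).
even-sqrt : ∀ k → ∃ λ h → 4 * (h * h) ≤ k × k < 4 * (suc h * suc h)
even-sqrt zero = 0 , z≤n , s≤s z≤n
even-sqrt (suc k) with even-sqrt k
... | h , lower , upper with suc k <? 4 * (suc h * suc h)
...   | yes lt = h , m≤n⇒m≤1+n lower , lt
...   | no ≮   = suc h , ≮⇒≥ ≮ , ≤-<-trans upper (*-monoʳ-< 4 (*-mono-< (n<1+n (suc h)) (n<1+n (suc h))))

module _ (n : ℕ) (n-large : 65536 ≤ n) where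
  private
    L : ℕ
    L = 12 * n + 3

  open Squares (suc L)
  open FourOddSquares L
  open LowerBounds L

  private
    256≤1+L : 256 ≤ suc L
    256≤1+L = ≤-trans (m≤m+n 256 _) (≤-trans n-large (≤-trans (≤-trans (m≤n*m n 12) (m≤m+n (12 * n) 3)) (n≤1+n L)))

    -- 22680 = 5! · 189.
    conclude : ∀ κ .{{_ : NonZero κ}} m A C → A + κ * 22680 ≤ m * 65536 → m * n ≤ A + κ * C → 22680 ≤ C
    conclude κ m A C enough bound = *-cancelˡ-≤ κ (+-cancelˡ-≤ A _ _ (≤-trans enough (≤-trans (*-monoʳ-≤ m n-large) bound)))

    squares : ℕ → ℕ → ℕ → ℕ
    squares m c d = ∑ m λ i → (suc c + suc d * i) * (suc c + suc d * i)

    -- Every a stays below 256 = √65536, so no n - a² is negative. The bound is linear in n, which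
    -- leaves a comparison of numerals at n = 65536.
    by-progression : ∀ κ .{{_ : NonZero κ}} m c d → suc c + suc d * m ≤ 256 → squares m c d + κ * 22680 ≤ m * 65536 →
      (∀ i → let a = suc c + suc d * i in n ≤ a * a + κ * tuples 4 n (a * a)) → 22680 ≤ tuples 5 n 0
    by-progression κ m c d short enough hyp =
      conclude κ m (squares m c d) (tuples 5 n 0) enough (progression-bound n κ m c d (≤-trans short 256≤1+L) hyp)

    decide : ∀ {a b} → {T (a ≤ᵇ b)} → a ≤ b
    decide {a} {b} {a≤b} = ≤ᵇ⇒≤ a b a≤b

    four-odd : ∀ q → 4 + q * 8 ≤ n → 4 + q * 8 ≤ 4 * tuples 4 (4 + q * 8) 0
    four-odd q q≤n = four-odd-bound q (≤-trans (≤-reflexive (lemma q)) (+-monoˡ-≤ 3 (*-mono-≤ (decide {3} {12}) q≤n)))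
      where
      lemma : ∀ q → 3 * (5 + q * 8) ≡ 3 * (4 + q * 8) + 3
      lemma = ℕ-Solver.solve-∀

    four-even : ∀ q → 16 + q * 32 ≤ n → 16 + q * 32 ≤ 16 * tuples 4 (16 + q * 32) 0
    four-even q q≤n = four-even-bound q
      (≤-trans (≤-reflexive (lemma q)) (+-monoˡ-≤ 3 (*-mono-≤ (decide {3} {12}) (≤-trans (≤-trans (m≤n*m (4 + q * 8) 4) (≤-reflexive (lemma′ q))) q≤n))))
      (≤-trans (≤-reflexive (lemma′ q)) (≤-trans q≤n (≤-trans (m≤n*m n 12) (m≤m+n _ 3))))
      where
      lemma : ∀ q → 3 * (5 + q * 8) ≡ 3 * (4 + q * 8) + 3
      lemma = ℕ-Solver.solve-∀
      lemma′ : ∀ q → 4 * (4 + q * 8) ≡ 16 + q * 32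
      lemma′ = ℕ-Solver.solve-∀

    seven : ∀ q → 7 + q * 8 ≤ n → 7 + q * 8 ≤ 8 * tuples 4 (7 + q * 8) 0
    seven q q≤n = seven-bound q (≤-trans (≤-reflexive (lemma q)) (+-monoˡ-≤ 3 (*-monoʳ-≤ 12 q≤n)))
      where
      lemma : ∀ q → 3 * (5 + (3 + 4 * q) * 8) ≡ 12 * (7 + q * 8) + 3
      lemma = ℕ-Solver.solve-∀

    4i : ∀ i → (4 + 4 * i) * (4 + 4 * i) ≡ 0 + 2 * (suc i * suc i) * 8
    4i = ℕ-Solver.solve-∀

    2+4i : ∀ i → (2 + 4 * i) * (2 + 4 * i) ≡ 4 + 2 * (i * suc i) * 8
    2+4i = ℕ-Solver.solve-∀

    -- Here and in the next four classes a is chosen so that n - a² is 4 or 7 (mod 8): a ≡ 0 (mod 4)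
    -- for n ≡ 4 and 7, odd a for n ≡ 5, and a ≡ 2 (mod 4) for n ≡ 0 and 3.
    class-4 : ∀ M → n ≡ 4 + M * 8 → 22680 ≤ tuples 5 n 0
    class-4 M eq = by-progression 4 63 3 3 decide decide λ i →
      square-bound 8 4 4 n decide four-odd 0 M eq _ (2 * (suc i * suc i)) (4i i)

    class-5 : ∀ M → n ≡ 5 + M * 8 → 22680 ≤ tuples 5 n 0
    class-5 M eq = by-progression 4 127 0 1 decide decide λ i →
      square-bound 8 4 4 n decide four-odd 1 M eq _ (proj₁ (odd-square i)) (proj₂ (odd-square i))

    class-8 : ∀ M → n ≡ 8 + M * 8 → 22680 ≤ tuples 5 n 0
    class-8 M eq = by-progression 4 63 1 3 decide decide λ i →
      square-bound 8 4 4 n decide four-odd 4 M eq _ (2 * (i * suc i)) (2+4i i)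

    class-7 : ∀ M → n ≡ 7 + M * 8 → 22680 ≤ tuples 5 n 0
    class-7 M eq = by-progression 8 63 3 3 decide decide λ i →
      square-bound 8 7 8 n decide seven 0 M eq _ (2 * (suc i * suc i)) (4i i)

    class-11 : ∀ M → n ≡ 11 + M * 8 → 22680 ≤ tuples 5 n 0
    class-11 M eq = by-progression 8 63 1 3 decide decide λ i →
      square-bound 8 7 8 n decide seven 4 M eq _ (2 * (i * suc i)) (2+4i i)

    -- For n ≡ 1 (mod 8) an even a leaves 1 or 5 (mod 8), and an odd a leaves a multiple of 8, so
    -- the aim is 16 (mod 32). The residue of a² modulo 32 depends on a modulo 16 only: a ≡ 7, 5, 1,
    -- 3 serve n ≡ 1, 9, 17, 25 (mod 32).
    class-1 : ∀ c → suc c + 16 * 15 ≤ 256 → squares 15 c 15 + 16 * 22680 ≤ 15 * 65536 →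
      ∀ M → n ≡ suc c * suc c + 16 + M * 32 → 22680 ≤ tuples 5 n 0
    class-1 c short enough M eq = by-progression 16 15 c 15 short enough λ i →
      square-bound 32 16 16 n decide four-even (suc c * suc c) M eq _ (8 * (i * i) + suc c * i) (lemma (suc c) i)
      where
      lemma : ∀ c i → (c + 16 * i) * (c + 16 * i) ≡ c * c + (8 * (i * i) + c * i) * 32
      lemma = ℕ-Solver.solve-∀

    class-2 : ∀ M → n ≡ 2 * (1 + 2 * M) → 22680 ≤ tuples 5 n 0
    class-2 M eq with even-sqrt (1 + 2 * M)
    ... | h , lower , upper = *-cancelˡ-≤ 64 (≤-trans (≤-trans (decide {64 * 22680} {251 * 32768}) (*-monoʳ-≤ 251 k-large)) 251k≤)
      where
      open ≤-Reasoning
      k s C σ h′ : ℕ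
      k = 1 + 2 * M
      s = 1 + 2 * h
      C = tuples 5 n 0
      σ = oddSquares 4 (4 * k) 0
      h′ = h ∸ 90

      k-large : 32768 ≤ k
      k-large = *-cancelˡ-≤ 2 (subst (65536 ≤_) eq n-large)

      -- 4 · 90² = 32400 ≤ 32768 ≤ k.
      90≤h : 90 ≤ h
      90≤h with 90 ≤? h
      ... | yes p = p
      ... | no ¬p = contradiction (≤-trans (decide {32400} {32768}) k-large)
        (<⇒≱ (<-≤-trans upper (*-monoʳ-≤ 4 (*-mono-≤ (≰⇒> ¬p) (≰⇒> ¬p)))))

      4h≤k : 4 * h ≤ k
      4h≤k = ≤-trans (*-monoʳ-≤ 4 (n≤n*n h)) lower

      12k+3≤L : 12 * k + 3 ≤ L
      12k+3≤L = +-monoˡ-≤ 3 (*-monoʳ-≤ 12 (≤-trans (m≤n*m k 2) (≤-reflexive (sym eq))))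

      s≤k : s ≤ k
      s≤k = ≤-trans (+-monoˡ-≤ (2 * h) (≤-trans (decide {1} {90}) 90≤h)) (≤-trans (*-monoˡ-≤ h (decide {3} {4})) 4h≤k)

      σ≤ : 16 * σ ≤ 288 * k + s * k
      σ≤ = begin
        16 * σ                              ≡⟨ cong (16 *_) σ≡ ⟩
        16 * divisorSum L (4 * k) 0         ≤⟨ divisorSum-≤ L k s 15≤s (≤-trans s≤k k≤L) (<-≤-trans upper (≤-reflexive (lemma h))) ⟩
        16 * (s * s) + (240 * k + s * k)    ≤⟨ +-monoˡ-≤ _ (*-monoʳ-≤ 16 s²≤3k) ⟩
        16 * (3 * k) + (240 * k + s * k)    ≡⟨ lemma′ k s ⟩
        288 * k + s * k                     ∎
        where
        lemma : ∀ h → 4 * (suc h * suc h) ≡ suc (1 + 2 * h) * suc (1 + 2 * h)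
        lemma = ℕ-Solver.solve-∀
        lemma′ : ∀ k s → 16 * (3 * k) + (240 * k + s * k) ≡ 288 * k + s * k
        lemma′ = ℕ-Solver.solve-∀
        k≤L : k ≤ L
        k≤L = ≤-trans (≤-trans (m≤n*m k 12) (m≤m+n _ 3)) 12k+3≤L
        15≤s : 15 ≤ s
        15≤s = ≤-trans (≤-trans (m≤m+n 15 75) 90≤h) (≤-trans (m≤m+n h (h + 0)) (n≤1+n _))
        -- s² = 4h² + 4h + 1, and k bounds both 4h² and 4h + 1 generously: 4h ≤ k and 1 ≤ k.
        s²≤3k : s * s ≤ 3 * k
        s²≤3k = begin
          s * s                        ≡⟨ square h ⟩
          4 * (h * h) + (4 * h + 1)    ≤⟨ +-mono-≤ lower (+-mono-≤ 4h≤k (s≤s z≤n)) ⟩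
          k + (k + k)                  ≡⟨ cong (λ # → k + (k + #)) (+-identityʳ k) ⟨
          3 * k                        ∎
          where
          square : ∀ h → (1 + 2 * h) * (1 + 2 * h) ≡ 4 * (h * h) + (4 * h + 1)
          square = ℕ-Solver.solve-∀
        4k≡ : 4 * k ≡ 4 + M * 8
        4k≡ = lemma″ M
          where
          lemma″ : ∀ M → 4 * (1 + 2 * M) ≡ 4 + M * 8
          lemma″ = ℕ-Solver.solve-∀
        σ≡ : σ ≡ divisorSum L (4 * k) 0
        σ≡ = subst (λ # → oddSquares 4 # 0 ≡ divisorSum L # 0) (sym 4k≡)
          (fourOddSquares≡divisorSum M (≤-trans (≤-reflexive (lemma″ M)) 12k+3≤L) ≤-refl)
          where
          lemma″ : ∀ M → 3 * (5 + M * 8) ≡ 12 * (1 + 2 * M) + 3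
          lemma″ = ℕ-Solver.solve-∀

      -- The subtracted squares cost at most 2h³ ≤ hk/2 by the choice of h, so half of hk survives.
      hk≤ : h * k ≤ 8 * C + 2 * σ
      hk≤ = +-cancelˡ-≤ (h * k) _ _ (begin
        h * k + h * k                            ≡⟨ cong (_+_ (h * k)) (+-identityʳ (h * k)) ⟨
        2 * (h * k)                              ≤⟨ *-monoʳ-≤ 2 (even-bound h M 12k+3≤L (≤-trans (s≤s s≤k) (s≤s k≤L))) ⟩
        2 * (∑ h (λ i → 2 * (suc i * suc i)) + (4 * tuples 5 (2 * k) 0 + σ))
          ≡⟨ cong (λ # → 2 * (∑ h (λ i → 2 * (suc i * suc i)) + (4 * tuples 5 # 0 + σ))) eq ⟨
        2 * (∑ h (λ i → 2 * (suc i * suc i)) + (4 * C + σ))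
          ≤⟨ *-monoʳ-≤ 2 (+-monoˡ-≤ _ (∑-≤-const h _ (2 * (h * h)) λ i i<h → *-monoʳ-≤ 2 (*-mono-≤ i<h i<h))) ⟩
        2 * (h * (2 * (h * h)) + (4 * C + σ))    ≡⟨ lemma h C σ ⟩
        h * (4 * (h * h)) + (8 * C + 2 * σ)      ≤⟨ +-monoˡ-≤ _ (*-monoʳ-≤ h lower) ⟩
        h * k + (8 * C + 2 * σ)                  ∎)
        where
        k≤L : k ≤ L
        k≤L = ≤-trans (≤-trans (m≤n*m k 12) (m≤m+n _ 3)) 12k+3≤L
        lemma : ∀ h C σ → 2 * (h * (2 * (h * h)) + (4 * C + σ)) ≡ h * (4 * (h * h)) + (8 * C + 2 * σ)
        lemma = ℕ-Solver.solve-∀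

      -- Of 8hk the bound for 16σ takes 2hk + 289k. With h ≥ 90 the remainder is at least (6 · 90 -
      -- 289)k = 251k.
      251k≤ : 251 * k ≤ 64 * C
      251k≤ = +-cancelˡ-≤ (289 * k + 2 * (h * k)) _ _ (begin
        289 * k + 2 * (h * k) + 251 * k          ≡⟨ lemma₁ h k ⟩
        2 * (h * k) + 6 * (90 * k)               ≤⟨ +-monoʳ-≤ (2 * (h * k)) (*-monoʳ-≤ 6 (*-monoˡ-≤ k 90≤h)) ⟩
        2 * (h * k) + 6 * (h * k)                ≡⟨ lemma₂ (h * k) ⟩
        8 * (h * k)                              ≤⟨ *-monoʳ-≤ 8 hk≤ ⟩
        8 * (8 * C + 2 * σ)                      ≡⟨ lemma₃ C σ ⟩
        16 * σ + 64 * C                          ≤⟨ +-monoˡ-≤ (64 * C) σ≤ ⟩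
        288 * k + s * k + 64 * C                 ≡⟨ lemma₄ h k C ⟩
        289 * k + 2 * (h * k) + 64 * C           ∎)
        where
        lemma₁ : ∀ h k → 289 * k + 2 * (h * k) + 251 * k ≡ 2 * (h * k) + 6 * (90 * k)
        lemma₁ = ℕ-Solver.solve-∀
        lemma₂ : ∀ a → 2 * a + 6 * a ≡ 8 * a
        lemma₂ = ℕ-Solver.solve-∀
        lemma₃ : ∀ C σ → 8 * (8 * C + 2 * σ) ≡ 16 * σ + 64 * C
        lemma₃ = ℕ-Solver.solve-∀
        lemma₄ : ∀ h k C → 288 * k + (1 + 2 * h) * k + 64 * C ≡ 289 * k + 2 * (h * k) + 64 * C
        lemma₄ = ℕ-Solver.solve-∀

  manyTuples : 22680 ≤ tuples 5 n 0
  manyTuples = go (n % 8) (n / 8) (m%n<n n 8) (m≡m%n+[m/n]*n n 8)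
    where
    small : ∀ {m} → n ≡ m → m < 65536 → 22680 ≤ tuples 5 n 0
    small n≡m m< = contradiction (subst (65536 ≤_) n≡m n-large) (<⇒≱ m<)

    -- n = 1, 33 and 9 are below a² + 16 for the chosen a and are excluded by size.
    go-1 : ∀ r M → r < 4 → n ≡ 1 + (r + M * 4) * 8 → 22680 ≤ tuples 5 n 0
    go-1 0 0             _ eq = small eq decide
    go-1 0 1             _ eq = small eq decide
    go-1 0 (suc (suc M)) _ eq = class-1 6 decide decide M (trans eq (lemma M))
      where
      lemma : ∀ M → 1 + (0 + (2 + M) * 4) * 8 ≡ 65 + M * 32
      lemma = ℕ-Solver.solve-∀
    go-1 1 0             _ eq = small eq decide
    go-1 1 (suc M)       _ eq = class-1 4 decide decide M (trans eq (lemma M))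
      where
      lemma : ∀ M → 1 + (1 + (1 + M) * 4) * 8 ≡ 41 + M * 32
      lemma = ℕ-Solver.solve-∀
    go-1 2 M             _ eq = class-1 0 decide decide M (trans eq (lemma M))
      where
      lemma : ∀ M → 1 + (2 + M * 4) * 8 ≡ 17 + M * 32
      lemma = ℕ-Solver.solve-∀
    go-1 3 M             _ eq = class-1 2 decide decide M (trans eq (lemma M))
      where
      lemma : ∀ M → 1 + (3 + M * 4) * 8 ≡ 25 + M * 32
      lemma = ℕ-Solver.solve-∀
    go-1 (suc (suc (suc (suc r)))) M r<4 _ = contradiction r<4 (≤⇒≯ (m≤m+n 4 r))

    go : ∀ r M → r < 8 → n ≡ r + M * 8 → 22680 ≤ tuples 5 n 0
    go 0 zero    _ eq = small eq decide
    go 0 (suc M) _ eq = class-8 M eq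
    go 1 M       _ eq = go-1 (M % 4) (M / 4) (m%n<n M 4) (trans eq (cong (λ # → 1 + # * 8) (m≡m%n+[m/n]*n M 4)))
    go 2 M       _ eq = class-2 (2 * M) (trans eq (lemma M))
      where
      lemma : ∀ M → 2 + M * 8 ≡ 2 * (1 + 2 * (2 * M))
      lemma = ℕ-Solver.solve-∀
    go 3 zero    _ eq = small eq decide
    go 3 (suc M) _ eq = class-11 M eq
    go 4 M       _ eq = class-4 M eq
    go 5 M       _ eq = class-5 M eq
    go 6 M       _ eq = class-2 (1 + 2 * M) (trans eq (lemma M))
      where
      lemma : ∀ M → 6 + M * 8 ≡ 2 * (1 + 2 * (1 + 2 * M))
      lemma = ℕ-Solver.solve-∀
    go 7 M       _ eq = class-7 M eq
    go (suc (suc (suc (suc (suc (suc (suc (suc r)))))))) M r<8 _ = contradiction r<8 (≤⇒≯ (m≤m+n 8 r))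

-- Ordered and unordered sums of squares

orderedCount unorderedCount : ℕ → ℕ → ℕ → ℕ → ℕ
orderedCount zero    m N a = [ N ≈ a ]
orderedCount (suc j) m N a = ∑ m λ i → orderedCount j m N (a + suc i * suc i)
unorderedCount zero    m N a = [ N ≈ a ]
unorderedCount (suc j) m N a = ∑ m λ i → unorderedCount j (suc i) N (a + suc i * suc i)

tuples≡orderedCount : ∀ L j N a → LowerBounds.tuples L j N a ≡ orderedCount j L N a
tuples≡orderedCount L zero    N a = refl
tuples≡orderedCount L (suc j) N a = trans (S-def positive _) (trans (∑-head L _)
  (∑-cong L λ i → trans (+-identityʳ _) (tuples≡orderedCount L j N (a + suc i * suc i))))
  where open Squares (suc L)

-- A tuple containing m + 1 has it in one of j + 1 places, and removing it there leaves a j-tuple.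
-- Tuples with several such entries are counted repeatedly, hence only an inequality.
orderedCount-step : ∀ j m N a → orderedCount (suc j) (suc m) N a
  ≤ orderedCount (suc j) m N a + suc j * orderedCount j (suc m) N (a + suc m * suc m)
orderedCount-step zero    m N a = ≤-reflexive (cong (_+_ (orderedCount 1 m N a)) (sym (+-identityʳ _)))
orderedCount-step (suc j) m N a = begin
  ∑ m (λ i → O (suc j) (suc m) (a + sq i)) + new
    ≤⟨ +-monoˡ-≤ new (∑-mono m λ i _ → orderedCount-step j m N (a + sq i)) ⟩
  ∑ m (λ i → O (suc j) m (a + sq i) + suc j * O j (suc m) (a + sq i + s)) + new
    ≡⟨ cong (_+ new) (trans (∑-⊕ m _ _) (cong (_+_ (O (2 + j) m a)) (∑-⊛ m (suc j)))) ⟩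
  O (2 + j) m a + suc j * ∑ m (λ i → O j (suc m) (a + sq i + s)) + new
    ≡⟨ cong (λ # → O (2 + j) m a + suc j * # + new) (∑-cong m λ i → cong (O j (suc m)) (exchange a (sq i) s)) ⟩
  O (2 + j) m a + suc j * ∑ m (λ i → O j (suc m) (a + s + sq i)) + new
    ≤⟨ +-monoˡ-≤ new (+-monoʳ-≤ (O (2 + j) m a) (*-monoʳ-≤ (suc j) (m≤m+n _ _))) ⟩
  O (2 + j) m a + suc j * new + new     ≡⟨ collect (O (2 + j) m a) (suc j) new ⟩
  O (2 + j) m a + (2 + j) * new         ∎
  where
  open ≤-Reasoning
  O : ℕ → ℕ → ℕ → ℕ
  O j m a = orderedCount j m N a
  sq : ℕ → ℕ
  sq i = suc i * suc i
  s new : ℕ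
  s = sq m
  new = O (suc j) (suc m) (a + s)
  exchange : ∀ a x s → a + x + s ≡ a + s + x
  exchange = ℕ-Solver.solve-∀
  collect : ∀ x c y → x + c * y + y ≡ x + (1 + c) * y
  collect = ℕ-Solver.solve-∀

orderedCount≤ : ∀ j m N a → orderedCount j m N a ≤ j ! * unorderedCount j m N a
orderedCount≤ zero    m       N a = ≤-reflexive (sym (*-identityˡ _))
orderedCount≤ (suc j) zero    N a = z≤n
orderedCount≤ (suc j) (suc m) N a = begin
  orderedCount (suc j) (suc m) N a
    ≤⟨ orderedCount-step j m N a ⟩
  orderedCount (suc j) m N a + suc j * orderedCount j (suc m) N a′
    ≤⟨ +-mono-≤ (orderedCount≤ (suc j) m N a) (*-monoʳ-≤ (suc j) (orderedCount≤ j (suc m) N a′)) ⟩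
  suc j ! * unorderedCount (suc j) m N a + suc j * (j ! * unorderedCount j (suc m) N a′)
    ≡⟨ cong (_+_ (suc j ! * unorderedCount (suc j) m N a)) (*-assoc (suc j) (j !) _) ⟨
  suc j ! * unorderedCount (suc j) m N a + suc j ! * unorderedCount j (suc m) N a′
    ≡⟨ *-distribˡ-+ (suc j !) (unorderedCount (suc j) m N a) (unorderedCount j (suc m) N a′) ⟨
  suc j ! * unorderedCount (suc j) (suc m) N a ∎
  where
  open ≤-Reasoning
  a′ : ℕ
  a′ = a + suc m * suc m

unorderedCount-small : ∀ j m {N a} → N < a → unorderedCount j m N a ≡ 0
unorderedCount-small zero    m N<a = ≈-no (<⇒≢ N<a)
unorderedCount-small (suc j) m N<a = ∑-zero m λ i _ → unorderedCount-small j (suc i) (<-≤-trans N<a (m≤m+n _ _))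

unorderedCount-stable : ∀ j {m m′} N → m ≤ m′ → N < suc m * suc m →
  unorderedCount (suc j) m′ N 0 ≡ unorderedCount (suc j) m N 0
unorderedCount-stable j N m≤m′ N< = ∑-extend m≤m′ λ i m≤i →
  unorderedCount-small j (suc i) (<-≤-trans N< (*-mono-≤ (s≤s m≤i) (s≤s m≤i)))

-- Sums over the lists enumerated by NonIncr

total : ∀ {A : Set} → (A → ℕ) → List A → ℕ
total φ []       = 0
total φ (x ∷ xs) = φ x + total φ xs

total-++ : ∀ {A : Set} (φ : A → ℕ) xs ys → total φ (xs ++ ys) ≡ total φ xs + total φ ys
total-++ φ []       ys = refl
total-++ φ (x ∷ xs) ys = trans (cong (_+_ (φ x)) (total-++ φ xs ys)) (sym (+-assoc (φ x) _ _))

total-map : ∀ {A B : Set} (φ : B → ℕ) (f : A → B) xs → total φ (map f xs) ≡ total (φ ∘ f) xs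
total-map φ f []       = refl
total-map φ f (x ∷ xs) = cong (_+_ (φ (f x))) (total-map φ f xs)

total-* : ∀ {A : Set} c (φ : A → ℕ) xs → total (λ x → c * φ x) xs ≡ c * total φ xs
total-* c φ []       = sym (*-zeroʳ c)
total-* c φ (x ∷ xs) = trans (cong (_+_ (c * φ x)) (total-* c φ xs)) (sym (*-distribˡ-+ c (φ x) _))

total-cong : ∀ {A : Set} {φ ψ : A → ℕ} → (∀ x → φ x ≡ ψ x) → ∀ xs → total φ xs ≡ total ψ xs
total-cong eq []       = refl
total-cong eq (x ∷ xs) = cong₂ _+_ (eq x) (total-cong eq xs)

total-concatMap : ∀ {A : Set} (φ : A → ℕ) (f : ℕ → List A) (g : ℕ → ℕ) m →
  total φ (concatMap f (applyUpTo g m)) ≡ ∑ m (λ i → total φ (f (g i)))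
total-concatMap φ f g zero    = refl
total-concatMap φ f g (suc m) = trans (total-++ φ (f (g 0)) _)
  (trans (cong (_+_ (total φ (f (g 0)))) (total-concatMap φ f (g ∘ suc) m)) (sym (∑-head m _)))

total-NonIncr : ∀ φ j m → total φ (NonIncr (suc j) m) ≡ ∑ m (λ i → total (λ xs → φ (suc i ∷ xs)) (NonIncr j (suc i)))
total-NonIncr φ j m = trans (total-concatMap φ _ (λ i → i) m)
  (∑-cong m λ i → total-map φ (suc i ∷_) (NonIncr j (suc i)))

unorderedCount≡total : ∀ j m N a → unorderedCount j m N a ≡ total (λ xs → [ N ≈ a + sqsum xs ]) (NonIncr j m)
unorderedCount≡total zero    m N a = sym (trans (+-identityʳ _) (cong [ N ≈_] (+-identityʳ a)))
unorderedCount≡total (suc j) m N a = sym (trans (total-NonIncr _ j m) (∑-cong m λ i →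
  trans (total-cong (λ xs → cong [ N ≈_] (sym (+-assoc a (suc i * suc i) (sqsum xs)))) (NonIncr j (suc i)))
    (sym (unorderedCount≡total j (suc i) N (a + suc i * suc i)))))

length-filter : ∀ n xss → length (filter (λ xs → sqsum xs ≟ n) xss) ≡ total (λ xs → [ n ≈ sqsum xs ]) xss
length-filter n []         = refl
length-filter n (xs ∷ xss) with sqsum xs ≟ n
... | yes eq = trans (cong length (filter-accept (λ xs → sqsum xs ≟ n) {xs} {xss} eq))
  (cong₂ _+_ (sym (≈-yes (sym eq))) (length-filter n xss))
... | no neq = trans (cong length (filter-reject (λ xs → sqsum xs ≟ n) {xs} {xss} neq))
  (cong₂ _+_ (sym (≈-no (neq ∘ sym))) (length-filter n xss))

p²≡unorderedCount : ∀ n j → p² n j ≡ unorderedCount j n n 0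
p²≡unorderedCount n j = trans (length-filter n (NonIncr j n)) (sym (unorderedCount≡total j n n 0))

p²-large : ∀ n → 65536 ≤ n → 189 ≤ p² n 5
p²-large n n-large = *-cancelˡ-≤ 120 (begin
  120 * 189                                 ≤⟨ manyTuples n n-large ⟩
  LowerBounds.tuples L 5 n 0                ≡⟨ tuples≡orderedCount L 5 n 0 ⟩
  orderedCount 5 L n 0                      ≤⟨ orderedCount≤ 5 L n 0 ⟩
  120 * unorderedCount 5 L n 0              ≡⟨ cong (120 *_) (unorderedCount-stable 4 n n≤L (m≤m*n (suc n) (suc n))) ⟩
  120 * unorderedCount 5 n n 0              ≡⟨ cong (120 *_) (p²≡unorderedCount n 5) ⟨
  120 * p² n 5                              ∎)
  where
  open ≤-Reasoning
  L : ℕ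
  L = 12 * n + 3
  n≤L : n ≤ L
  n≤L = ≤-trans (m≤n*m n 12) (m≤m+n (12 * n) 3)

length-NonIncr : ∀ j m M → m ≤ M → length (NonIncr j m) ≤ M ^ j
length-NonIncr j m M m≤M = ≤-trans (≤-reflexive (sym (total-1 (NonIncr j m)))) (go j m m≤M)
  where
  total-1 : ∀ {A : Set} (xs : List A) → total (λ _ → 1) xs ≡ length xs
  total-1 []       = refl
  total-1 (x ∷ xs) = cong suc (total-1 xs)
  go : ∀ j m → m ≤ M → total (λ _ → 1) (NonIncr j m) ≤ M ^ j
  go zero    m m≤M = ≤-refl
  go (suc j) m m≤M = ≤-trans (≤-reflexive (total-NonIncr (λ _ → 1) j m))
    (≤-trans (∑-≤-const m _ (M ^ j) λ i i<m → go j (suc i) (≤-trans i<m m≤M)) (*-monoˡ-≤ (M ^ j) m≤M))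

-- Digits of the generating function

module Digits (b : ℕ) .{{_ : NonZero b}} where

  digit : ℕ → ℕ → ℕ
  digit h i = h / b ^ i % b
    where instance _ = m^n≢0 b i

  private
    -- Exponents below n are collected in `low`, those equal to n are counted, and those above n go
    -- to `high`. The last component says that `low` is at most length · b^(n - 1), written without
    -- subtraction.
    parts : ∀ {A : Set} (φ : A → ℕ) n xs → ∃ λ low → ∃ λ high →
      total (λ x → b ^ φ x) xs ≡ low + (total (λ x → [ n ≈ φ x ]) xs + high * b) * b ^ n × low * b ≤ length xs * b ^ n
    parts φ n [] = 0 , 0 , refl , z≤n
    parts φ n (x ∷ xs) with parts φ n xs | <-cmp (φ x) n
    ... | low , high , eq , low≤ | tri< lt _ _ = b ^ φ x + low , high ,
      trans (cong (_+_ (b ^ φ x)) eq) (trans (sym (+-assoc (b ^ φ x) low _))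
        (cong (λ # → b ^ φ x + low + (# + total (λ x → [ n ≈ φ x ]) xs + high * b) * b ^ n) (sym (≈-no (<⇒≢ lt ∘ sym))))) ,
      (begin
        (b ^ φ x + low) * b           ≡⟨ *-distribʳ-+ b (b ^ φ x) low ⟩
        b ^ φ x * b + low * b         ≤⟨ +-mono-≤ (≤-trans (≤-reflexive (*-comm (b ^ φ x) b)) (^-monoʳ-≤ b lt)) low≤ ⟩
        b ^ n + length xs * b ^ n     ∎)
      where open ≤-Reasoning
    ... | low , high , eq , low≤ | tri≈ _ refl _ = low , high ,
      trans (cong (_+_ (b ^ n)) eq) (trans (lemma low (total (λ x → [ n ≈ φ x ]) xs) (high * b) (b ^ n))
        (cong (λ # → low + (# + total (λ x → [ n ≈ φ x ]) xs + high * b) * b ^ n) (sym (≈-yes {n} refl)))) ,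
      ≤-trans low≤ (m≤n+m _ (b ^ n))
      where
      lemma : ∀ l c h p → p + (l + (c + h) * p) ≡ l + (1 + c + h) * p
      lemma = ℕ-Solver.solve-∀
    ... | low , high , eq , low≤ | tri> _ _ gt = low , b ^ (φ x ∸ suc n) + high ,
      trans (cong₂ _+_ power eq) (trans (lemma low (total (λ x → [ n ≈ φ x ]) xs) high b (b ^ n) (b ^ (φ x ∸ suc n)))
        (cong (λ # → low + (# + total (λ x → [ n ≈ φ x ]) xs + (b ^ (φ x ∸ suc n) + high) * b) * b ^ n) (sym (≈-no (<⇒≢ gt))))) ,
      ≤-trans low≤ (m≤n+m _ (b ^ n))
      where
      lemma : ∀ l c h b p q → q * (b * p) + (l + (c + h * b) * p) ≡ l + (0 + c + (q + h) * b) * p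
      lemma = ℕ-Solver.solve-∀
      power : b ^ φ x ≡ b ^ (φ x ∸ suc n) * (b * b ^ n)
      power = trans (cong (b ^_) (sym (m∸n+n≡m gt))) (^-distribˡ-+-* b (φ x ∸ suc n) (suc n))

    count≤length : ∀ {A : Set} (φ : A → ℕ) n xs → total (λ x → [ n ≈ φ x ]) xs ≤ length xs
    count≤length φ n []       = z≤n
    count≤length φ n (x ∷ xs) with n ≟ φ x
    ... | yes eq = +-mono-≤ (≤-reflexive (≈-yes eq)) (count≤length φ n xs)
    ... | no neq = +-mono-≤ (≤-trans (≤-reflexive (≈-no neq)) z≤n) (count≤length φ n xs)

  -- With fewer than b summands neither the lower powers nor the count at position n can produce a
  -- carry.
  digit-total : ∀ {A : Set} (φ : A → ℕ) n xs → length xs < b →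
    digit (total (λ x → b ^ φ x) xs) n ≡ total (λ x → [ n ≈ φ x ]) xs
  digit-total φ n xs len<b = begin
    total (λ x → b ^ φ x) xs / b ^ n % b        ≡⟨ cong (λ # → # / b ^ n % b) eq ⟩
    (low + (c + high * b) * b ^ n) / b ^ n % b  ≡⟨ cong (_% b) (+-distrib-/-∣ʳ low {(c + high * b) * b ^ n} {b ^ n} (divides-refl (c + high * b))) ⟩
    (low / b ^ n + (c + high * b) * b ^ n / b ^ n) % b   ≡⟨ cong₂ (λ u v → (u + v) % b) (m<n⇒m/n≡0 low<) (m*n/n≡m (c + high * b) (b ^ n)) ⟩
    (c + high * b) % b                          ≡⟨ [m+kn]%n≡m%n c high b ⟩
    c % b                                       ≡⟨ m<n⇒m%n≡m (≤-<-trans (count≤length φ n xs) len<b) ⟩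
    c                                           ∎
    where
    open ≡-Reasoning
    instance _ = m^n≢0 b n
    c low high : ℕ
    c    = total (λ x → [ n ≈ φ x ]) xs
    low  = proj₁ (parts φ n xs)
    high = proj₁ (proj₂ (parts φ n xs))
    eq : total (λ x → b ^ φ x) xs ≡ low + (c + high * b) * b ^ n
    eq = proj₁ (proj₂ (proj₂ (parts φ n xs)))
    low≤ : low * b ≤ length xs * b ^ n
    low≤ = proj₂ (proj₂ (proj₂ (parts φ n xs)))
    low< : low < b ^ n
    low< = *-cancelʳ-< b low (b ^ n) (≤-<-trans low≤ (≤-trans (*-monoˡ-< (b ^ n) len<b) (≤-reflexive (*-comm b (b ^ n)))))

  b^2^ : ℕ → ℕ
  b^2^ zero    = b
  b^2^ (suc k) = b^2^ k * b^2^ k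

  b^2^≡ : ∀ k → b^2^ k ≡ b ^ (2 ^ k)
  b^2^≡ zero    = sym (*-identityʳ b)
  b^2^≡ (suc k) = trans (cong₂ _*_ (b^2^≡ k) (b^2^≡ k))
    (trans (sym (^-distribˡ-+-* b (2 ^ k) (2 ^ k))) (cong (λ # → b ^ (2 ^ k + #)) (sym (+-identityʳ (2 ^ k)))))

  b^2^≢0 : ∀ k → NonZero (b^2^ k)
  b^2^≢0 k = subst NonZero (sym (b^2^≡ k)) (m^n≢0 b (2 ^ k))

  -- Whether c is absent from the 2ᵏ lowest digits of h.
  absent : ℕ → ℕ → ℕ → Bool
  absent c zero    h = not (h % b ≡ᵇ c)
  absent c (suc k) h = absent c k (h % b^2^ k) ∧ absent c k (h / b^2^ k)
    where instance _ = b^2^≢0 k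

  absent-sound : ∀ c k h → absent c k h ≡ true → ∀ i → i < 2 ^ k → digit h i ≢ c
  absent-sound c zero h eq zero _ d≡c = go (h % b ≡ᵇ c) eq (≡⇒≡ᵇ (h % b) c (trans (cong (_% b) (sym (n/1≡n h))) d≡c))
    where
    go : ∀ t → not t ≡ true → T t → ⊥
    go false _ ()
  absent-sound c zero h eq (suc i) (s≤s ())
  absent-sound c (suc k) h eq = go (∧-true _ _ eq)
    where
    open ≡-Reasoning
    instance _ = b^2^≢0 k
    ∧-true : ∀ x y → x ∧ y ≡ true → x ≡ true × y ≡ true
    ∧-true true true _ = refl , refl
    go : absent c k (h % b^2^ k) ≡ true × absent c k (h / b^2^ k) ≡ true → ∀ i → i < 2 ^ suc k → digit h i ≢ c
    go (low , high) i i< with i <? 2 ^ k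
    ... | yes i<2^k = λ d≡c → absent-sound c k (h % b^2^ k) low i i<2^k (trans same d≡c)
      where
      r : ℕ
      r = 2 ^ k ∸ suc i
      2^k≡ : suc r + i ≡ 2 ^ k
      2^k≡ = trans (sym (+-suc r i)) (m∸n+n≡m i<2^k)
      P≡ : b^2^ k ≡ b ^ suc r * b ^ i
      P≡ = trans (b^2^≡ k) (trans (cong (b ^_) (sym 2^k≡)) (^-distribˡ-+-* b (suc r) i))
      instance
        _ = m^n≢0 b i
        _ = m^n≢0 b (suc r)
        _ = m*n≢0 (b ^ suc r) (b ^ i)
      same : digit (h % b^2^ k) i ≡ digit h i
      same = begin
        h % b^2^ k / b ^ i % b                ≡⟨ cong (λ # → # / b ^ i % b) (%-congʳ P≡) ⟩
        h % (b ^ suc r * b ^ i) / b ^ i % b   ≡⟨ cong (_% b) (m%[n*o]/o≡m/o%n h (b ^ suc r) (b ^ i)) ⟩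
        h / b ^ i % b ^ suc r % b             ≡⟨ m∣n⇒o%n%m≡o%m b (b ^ suc r) (h / b ^ i) (m∣m*n (b ^ r)) ⟩
        h / b ^ i % b                         ∎
    ... | no i≮2^k = λ d≡c → absent-sound c k (h / b^2^ k) high i′ i′< (trans same d≡c)
      where
      i′ : ℕ
      i′ = i ∸ 2 ^ k
      i≡ : 2 ^ k + i′ ≡ i
      i≡ = m+[n∸m]≡n (≮⇒≥ i≮2^k)
      i′< : i′ < 2 ^ k
      i′< = +-cancelˡ-< (2 ^ k) i′ (2 ^ k) (subst₂ _<_ (sym i≡) (cong (_+_ (2 ^ k)) (+-identityʳ (2 ^ k))) i<)
      instance
        _ = m^n≢0 b i
        _ = m^n≢0 b i′
        _ = m*n≢0 (b^2^ k) (b ^ i′)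
      P≡ : b^2^ k * b ^ i′ ≡ b ^ i
      P≡ = trans (cong (_* b ^ i′) (b^2^≡ k)) (trans (sym (^-distribˡ-+-* b (2 ^ k) i′)) (cong (b ^_) i≡))
      same : digit (h / b^2^ k) i′ ≡ digit h i
      same = begin
        h / b^2^ k / b ^ i′ % b          ≡⟨ cong (_% b) (m/n/o≡m/[n*o] h (b^2^ k) (b ^ i′)) ⟩
        h / (b^2^ k * b ^ i′) % b        ≡⟨ cong (_% b) (/-congʳ P≡) ⟩
        h / b ^ i % b                    ∎

  opaque
    generating : ℕ → ℕ → ℕ
    generating j m = total (λ xs → b ^ sqsum xs) (NonIncr j m)

    generating-def : ∀ j m → generating j m ≡ total (λ xs → b ^ sqsum xs) (NonIncr j m)
    generating-def j m = refl

    generating-0 : ∀ m → generating 0 m ≡ 1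
    generating-0 m = refl

    generating-empty : ∀ j → generating (suc j) 0 ≡ 0
    generating-empty j = refl

    -- The largest part is at most m or equal to m + 1. In the second case the remaining j parts may
    -- again be as large as m + 1.
    generating-suc : ∀ j m → generating (suc j) (suc m) ≡ generating (suc j) m + b ^ (suc m * suc m) * generating j (suc m)
    generating-suc j m = begin
      total φ (NonIncr (suc j) (suc m))                           ≡⟨ total-NonIncr φ j (suc m) ⟩
      ∑ m (λ i → total (λ xs → φ (suc i ∷ xs)) (NonIncr j (suc i))) + total (λ xs → φ (suc m ∷ xs)) (NonIncr j (suc m))
        ≡⟨ cong₂ _+_ (sym (total-NonIncr φ j m))
             (trans (total-cong (λ xs → ^-distribˡ-+-* b (suc m * suc m) (sqsum xs)) (NonIncr j (suc m)))
               (total-* (b ^ (suc m * suc m)) φ (NonIncr j (suc m)))) ⟩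
      generating (suc j) m + b ^ (suc m * suc m) * generating j (suc m) ∎
      where
      open ≡-Reasoning
      φ : List ℕ → ℕ
      φ xs = b ^ sqsum xs

  -- Passing each updated value as an argument makes the evaluator share it.
  module _ (f : ℕ → ℕ → ℕ → ℕ → ℕ → ℕ) (power : ℕ) where
    update₅ : ℕ → ℕ → ℕ → ℕ → ℕ → ℕ
    update₅ v₁ v₂ v₃ v₄ g₅ = f v₁ v₂ v₃ v₄ (g₅ + power * v₄)
    update₄ : ℕ → ℕ → ℕ → ℕ → ℕ → ℕ
    update₄ v₁ v₂ v₃ g₄ g₅ = update₅ v₁ v₂ v₃ (g₄ + power * v₃) g₅
    update₃ : ℕ → ℕ → ℕ → ℕ → ℕ → ℕ
    update₃ v₁ v₂ g₃ g₄ g₅ = update₄ v₁ v₂ (g₃ + power * v₂) g₄ g₅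
    update₂ : ℕ → ℕ → ℕ → ℕ → ℕ → ℕ
    update₂ v₁ g₂ g₃ g₄ g₅ = update₃ v₁ (g₂ + power * v₁) g₃ g₄ g₅
    update : ℕ → ℕ → ℕ → ℕ → ℕ → ℕ
    update g₁ g₂ g₃ g₄ g₅ = update₂ (g₁ + power * 1) g₂ g₃ g₄ g₅

  -- `power` and `ratio` stand for b^((m + 1)²) and b^(2m + 3): consecutive squares differ by odd
  -- numbers that grow by 2. Each update uses the value just computed for one part fewer, because
  -- parts may repeat.
  run : ℕ → ℕ → ℕ → ℕ → ℕ → ℕ → ℕ → ℕ → ℕ
  run zero    power ratio g₁ g₂ g₃ g₄ g₅ = g₅
  run (suc f) power ratio = update (run f (power * ratio) (ratio * (b * b))) power

  run-generating : ∀ f m → run f (b ^ (suc m * suc m)) (b ^ (3 + 2 * m))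
    (generating 1 m) (generating 2 m) (generating 3 m) (generating 4 m) (generating 5 m) ≡ generating 5 (f + m)
  run-generating zero    m = refl
  run-generating (suc f) m = trans
    (run-cong power-suc ratio-suc g₁≡ (next 1 g₁≡) (next 2 (next 1 g₁≡)) (next 3 (next 2 (next 1 g₁≡)))
      (next 4 (next 3 (next 2 (next 1 g₁≡)))))
    (trans (run-generating f (suc m)) (cong (generating 5) (+-suc f m)))
    where
    run-cong : ∀ {p p′ r r′ u u′ v v′ w w′ x x′ y y′} → p ≡ p′ → r ≡ r′ → u ≡ u′ → v ≡ v′ → w ≡ w′ → x ≡ x′ → y ≡ y′ →
      run f p r u v w x y ≡ run f p′ r′ u′ v′ w′ x′ y′
    run-cong refl refl refl refl refl refl refl = refl
    power-suc : b ^ (suc m * suc m) * b ^ (3 + 2 * m) ≡ b ^ (suc (suc m) * suc (suc m))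
    power-suc = trans (sym (^-distribˡ-+-* b (suc m * suc m) (3 + 2 * m))) (cong (b ^_) (lemma m))
      where
      lemma : ∀ m → suc m * suc m + (3 + 2 * m) ≡ suc (suc m) * suc (suc m)
      lemma = ℕ-Solver.solve-∀
    ratio-suc : b ^ (3 + 2 * m) * (b * b) ≡ b ^ (3 + 2 * suc m)
    ratio-suc = trans (lemma (b ^ (3 + 2 * m)) b) (cong (b ^_) (sym (lemma′ m)))
      where
      lemma : ∀ p b → p * (b * b) ≡ b * (b * p)
      lemma = ℕ-Solver.solve-∀
      lemma′ : ∀ m → 3 + 2 * suc m ≡ suc (suc (3 + 2 * m))
      lemma′ = ℕ-Solver.solve-∀
    next : ∀ j {g} → g ≡ generating j (suc m) →
      generating (suc j) m + b ^ (suc m * suc m) * g ≡ generating (suc j) (suc m)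
    next j refl = sym (generating-suc j m)
    g₁≡ : generating 1 m + b ^ (suc m * suc m) * 1 ≡ generating 1 (suc m)
    g₁≡ = next 0 (sym (generating-0 (suc m)))

  run≡generating : ∀ f → run f (b ^ 1) (b ^ 3) 0 0 0 0 0 ≡ generating 5 f
  run≡generating f = trans
    (sym (start (generating-empty 0) (generating-empty 1) (generating-empty 2) (generating-empty 3) (generating-empty 4)))
    (trans (run-generating f 0) (cong (generating 5) (+-identityʳ f)))
    where
    start : ∀ {u v w x y} → u ≡ 0 → v ≡ 0 → w ≡ 0 → x ≡ 0 → y ≡ 0 →
      run f (b ^ 1) (b ^ 3) u v w x y ≡ run f (b ^ 1) (b ^ 3) 0 0 0 0 0
    start refl refl refl refl refl = refl

  -- There are at most M⁵ < b lists, so no carries occur.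
  p²≢ : ∀ c k M → absent c k (run M (b ^ 1) (b ^ 3) 0 0 0 0 0) ≡ true → M ^ 5 < b → 2 ^ k ≤ suc M * suc M →
    ∀ n → n < 2 ^ k → p² n 5 ≢ c
  p²≢ c k M check M⁵<b 2^k≤ n n< p²≡c =
    absent-sound c k (run M (b ^ 1) (b ^ 3) 0 0 0 0 0) check n n< (begin
    digit (run M (b ^ 1) (b ^ 3) 0 0 0 0 0) n            ≡⟨ cong (λ # → digit # n) (trans (run≡generating M) (generating-def 5 M)) ⟩
    digit (total (λ xs → b ^ sqsum xs) (NonIncr 5 M)) n  ≡⟨ digit-total sqsum n (NonIncr 5 M) (≤-<-trans (length-NonIncr 5 M M ≤-refl) M⁵<b) ⟩
    total (λ xs → [ n ≈ sqsum xs ]) (NonIncr 5 M)        ≡⟨ unorderedCount≡total 5 M n 0 ⟨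
    unorderedCount 5 M n 0                               ≡⟨ stable ⟩
    unorderedCount 5 n n 0                               ≡⟨ p²≡unorderedCount n 5 ⟨
    p² n 5                                               ≡⟨ p²≡c ⟩
    c                                                    ∎)
    where
    open ≡-Reasoning
    stable : unorderedCount 5 M n 0 ≡ unorderedCount 5 n n 0
    stable with ≤-total n M
    ... | inj₁ n≤M = unorderedCount-stable 4 n n≤M (m≤m*n (suc n) (suc n))
    ... | inj₂ M≤n = sym (unorderedCount-stable 4 n M≤n (<-≤-trans n< 2^k≤))

-- The finite check and the conclusion

-- The base 2199023255552 = 2⁴¹ exceeds 256⁵ = 2⁴⁰, a bound for the number of lists. Parts up to 256
-- suffice because 257² > 65535, and `refl` evaluates the check of all 2¹⁶ digits.
p²-small : ∀ n → n < 65536 → p² n 5 ≢ 188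
p²-small = Digits.p²≢ 2199023255552 188 16 256 refl
  (≤ᵇ⇒≤ (suc (256 ^ 5)) 2199023255552 _) (≤ᵇ⇒≤ 65536 66049 _)

theorem6p1 : (n : ℕ) → ¬ (p² (suc n) 5 ≡ 188)
theorem6p1 n p²≡188 with suc n <? 65536
... | yes small = p²-small (suc n) small p²≡188
... | no ¬small = contradiction (p²-large (suc n) (≮⇒≥ ¬small)) (<⇒≱ (≤-reflexive (cong suc p²≡188)))
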